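{- (i) Let $p>3$ be a prime, and let $t=v/u\in\mathbb Q$ with $u,v\in\mathbb Z$, $p\nmid u$. Then $$\prod_{\substack{0<i<j<p/2\\ p\nmid i^2-ij+tj^2}}\Big(\frac{i^2-ij+tj^2}{p}\Big)=\begin{cases}-1 & \text{if } p\equiv 5,7\pmod 8 \text{ and } \big(\frac{4t-1}{p}\big)=-1,\\ 1 & \text{otherwise}.\end{cases}$$ (ii) Fix a nonzero $s\in\mathbb Z$ and let $p$ range over primes $p>3$ with $p\nmid s$. Then both $p\mapsto F_p(0,1,s^2)\bmod 16$ and $p\mapsto \prod_{0<i<j<p/2,\ p\nmid s^2i^2-j^2}\big(\frac{s^2i^2-j^2}{p}\big)$ are periodic functions of $p$.
   Context: $\big(\frac{\cdot}{p}\big)$ is the Legendre symbol; for a rational number $x$ whose denominator is prime to $p$, congruences and $\big(\frac{x}{p}\big)$ are understood by replacing $x$ with an integer congruent to it modulo $p$ (so $p\mid x$ and $\big(\frac{x}{p}\big)$ make sense). Products are over integers $i,j$. $F_p(0,1,n)=\sum_{y=1}^{p}\big(\frac{y(y+1)(y+n)}{p}\big)$, and "$\bmod 16$" denotes the least nonnegative residue modulo $16$. A function $g$ on a set of primes is periodic if there is $m\in\mathbb Z_{>0}$ with $g(p_1)=g(p_2)$ whenever $p_1\equiv p_2\pmod m$ lie in its domain. -}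

module Defs where

open import Data.Bool using (Bool; true; false; if_then_else_; _∨_)
open import Data.Nat as ℕ using (ℕ; zero; suc; _≡ᵇ_)
open import Data.Integer as ℤ using (ℤ; +_; _+_; _*_; _-_; -_)
open import Data.Integer.DivMod using (_%ℕ_)
open import Data.List using (List; []; _∷_; map; concatMap; filter; foldr; upTo; applyUpTo)
open import Data.Bool.ListAction using (any)
open import Data.Product using (∃; _×_)
open import Relation.Binary.PropositionalEquality using (_≡_)
open import Relation.Nullary.Decidable using (¬?)
open import Data.Nat.Properties using (_≟_)

-- least nonnegative residue of an integer modulo p (p = 0 is never used)
modp : ℕ → ℤ → ℕ
modp zero    a = 0
modp (suc n) a = a %ℕ suc n

legendre : ℕ → ℤ → ℤ
legendre p a with modp p a
... | zero  = + 0
... | suc r = if any (λ x → modp p (+ x * + x) ≡ᵇ suc r) (upTo p)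
                then + 1 else - (+ 1)

-- ratRed p v u : the integer r ∈ [0,p) with u·r ≡ v (mod p); i.e. the integer
-- congruent to t = v/u modulo p (unique when p is prime and p ∤ u).
ratRed : ℕ → ℤ → ℤ → ℤ
ratRed p v u = go p
  where
  go : ℕ → ℤ
  go zero    = + 0
  go (suc k) = if modp p (u * + k - v) ≡ᵇ 0 then + k else go k

prodℤ : List ℤ → ℤ
prodℤ = foldr _*_ (+ 1)

record Pair : Set where
  constructor _,,_
  field fst snd : ℕ

halfPairs : ℕ → List Pair
halfPairs p = concatMap (λ j → map (λ i → i ,, j) (applyUpTo suc (ℕ.pred j)))
                        (applyUpTo suc (p ℕ./ 2))

prodLeg : ℕ → (ℕ → ℕ → ℤ) → ℤ
prodLeg p f = prodℤ (map (λ q → legendre p (f (Pair.fst q) (Pair.snd q)))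
                    (filter (λ q → ¬? (modp p (f (Pair.fst q) (Pair.snd q)) ≟ 0))
                            (halfPairs p)))

Fp01 : ℕ → ℤ → ℤ
Fp01 p n = foldr _+_ (+ 0)
  (map (λ y → legendre p (+ y * (+ y + + 1) * (+ y + n))) (applyUpTo suc p))

Periodic : {A : Set} → (ℕ → Set) → (ℕ → A) → Set
Periodic D g = ∃ λ (m : ℕ) → (0 ℕ.< m) ×
  (∀ p₁ p₂ → D p₁ → D p₂ → modp m (+ p₁) ≡ modp m (+ p₂) → g p₁ ≡ g p₂)

{-# OPTIONS --safe #-}
module Submission where

-- Put n = (p - 1)/2 and S = {1, …, n}, a set of representatives of the nonzero residues up to sign.
--
-- (i) For fixed j the form i² - ij + tj² is invariant under i ↦ j - i, so modulo squares only the terms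
-- i = j/2 survive; there are ⌊n/2⌋ of them, each with the symbol of 4t - 1.
--
-- (ii) Writing i ≡ ±xj with x ∈ S, the pair i < j contributes ((s²x² - 1)/p), and by Gauss's lemma for
-- 1 - x and 1 + x the number of j ∈ S with |xj| < j has the parity that makes the product (-1)^N, where
-- N = #{y a nonzero square : y - 1 and s²y - 1 nonresidues}.  Expanding the indicator of this set in
-- characters expresses 8N by p, F_p(0,1,s²) and the symbols of -1 and s² - 1, so both claims reduce to
-- the parity of N.  It is found by counting the fixed points of an involution of this set
-- (s²yz = 1 if p ≡ 1 mod 4; s²yz - y - z + 1 = 0 if p ≡ 3 mod 4 and 1 - s² is a square; the remaining
-- case is reduced to the latter by s ↦ 1/s), and it depends only on the symbols of -1, 2, s, s ± 1.
-- These are periodic in p by Gauss's lemma again.  The primes dividing s² - 1 are separated by the modulus.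
open import Defs
open import Data.Nat as ℕ using (ℕ; zero; suc; _<_; _%_; z≤n; s≤s)
open import Data.Nat.Primality using (Prime; prime; euclidsLemma; prime⇒irreducible)
open import Data.Integer as ℤ using (ℤ; +_; _+_; _*_; _-_; -_; -[1+_])
open import Data.Integer.DivMod using (_%ℕ_; _/ℕ_; n%ℕd<d; a≡a%ℕn+[a/ℕn]*n)
open import Data.Integer.Divisibility using (_∣_)
open import Data.Product using (∃; _×_; _,_; proj₁; proj₂)
open import Data.Sum using (_⊎_; inj₁; inj₂)
open import Relation.Nullary using (¬_; Dec; yes; no)
open import Relation.Binary.PropositionalEquality
  using (_≡_; _≢_; refl; sym; trans; cong; cong₂; subst; module ≡-Reasoning)

open import Algebra.Properties.AbelianGroup using (∙-cancelˡ)
open import Data.Bool as Bool using (true; false)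
open import Data.Bool.ListAction using (any)
open import Data.Empty using (⊥; ⊥-elim)
import Data.Integer.Divisibility.Signed as ℤᵈ
import Data.Integer.Properties as ℤₚ
open import Data.Integer.Tactic.RingSolver using (solve; solve-∀)
open import Data.List using (List; []; _∷_; _++_; map; foldr; filter; concatMap; upTo; applyUpTo)
open import Data.List.Membership.Propositional using (lose; find)
open import Data.List.Membership.Propositional.Properties using (∈-upTo⁺)
open import Data.List.Relation.Unary.Any.Properties using (any⁺; any⁻)
open import Data.Nat.Coprimality using (prime⇒coprime; coprime-Bézout)
import Data.Nat.Divisibility as ℕᵈ
open import Data.Nat.DivMod using (m%n<n; m≡m%n+[m/n]*n; m*n/n≡m; +-distrib-/-∣ʳ; [m+kn]%n≡m%n)
import Data.Nat.GCD as GCD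
import Data.Nat.Properties as ℕₚ
import Data.Nat.Tactic.RingSolver as ℕ-Ring
import Data.Sum as Sum
open import Data.Unit using (tt)
open import Function using (_∘_)
open import Relation.Nullary.Decidable using (map′; ¬?; decidable-stable)
open ≡-Reasoning

-- Congruences and finite sums

-- Every count is a sum of integer indicators. A rearrangement is then an exchange of two
-- summations, and an involution is a symmetric 0-1 matrix whose total has the parity of its trace
-- (`∑-symmetric`). Gauss's lemma and the parity of `N` both arise in this way.
--
-- The modulus 16 comes from the coefficient of `N`: up to the sign χ(-1), F_p(0,1,s²) is 8N - (p +
-- 1) plus an expression in symbols, so modulo 16 only the parity of `N` matters.
--
-- The substitution y ↦ 1/(s²y) exchanges the two nonresidue conditions only up to the symbol of -1;
-- for p ≡ 3 mod 4 it therefore leaves the set, and a different fractional linear map has to be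
-- found. The fixed points of that map involve a root c of 1 - s², which varies with p and is no
-- fixed integer, so the symbol of 1 + c is not visibly periodic. A half-angle formula expresses it
-- through the symbols of 2 and 1 + s; this is where the symbol of 2 enters.

record Cong (m a b : ℤ) : Set where
  constructor cong-by
  field
    quotient   : ℤ
    difference : a ≡ b + quotient * m

infix 4 _≈₂_
_≈₂_ : ℤ → ℤ → Set
_≈₂_ = Cong (+ 2)

-- Because the quotient is explicit, matching on `cong-by k refl` turns each closure property into a
-- polynomial identity over the integers.
module _ {m : ℤ} where

  c-reflexive : ∀ {a b} → a ≡ b → Cong m a b
  c-reflexive {a} refl = cong-by (+ 0) (solve (a ∷ m ∷ []))

  c-refl : ∀ {a} → Cong m a a
  c-refl = c-reflexive refl

  c-sym : ∀ {a b} → Cong m a b → Cong m b a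
  c-sym {b = b} (cong-by k refl) = cong-by (- k) (solve (b ∷ k ∷ m ∷ []))

  c-trans : ∀ {a b c} → Cong m a b → Cong m b c → Cong m a c
  c-trans {c = c} (cong-by k refl) (cong-by l refl) = cong-by (k + l) (solve (c ∷ k ∷ l ∷ m ∷ []))

  c-+ : ∀ {a b c d} → Cong m a b → Cong m c d → Cong m (a + c) (b + d)
  c-+ {b = b} {d = d} (cong-by k refl) (cong-by l refl) =
    cong-by (k + l) (solve (b ∷ d ∷ k ∷ l ∷ m ∷ []))

  c-* : ∀ {a b c d} → Cong m a b → Cong m c d → Cong m (a * c) (b * d)
  c-* {b = b} {d = d} (cong-by k refl) (cong-by l refl) =
    cong-by (k * d + b * l + k * l * m) (solve (b ∷ d ∷ k ∷ l ∷ m ∷ []))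

  c-*ˡ : ∀ c {a b} → Cong m a b → Cong m (c * a) (c * b)
  c-*ˡ c = c-* (c-refl {c})

  c-*ʳ : ∀ c {a b} → Cong m a b → Cong m (a * c) (b * c)
  c-*ʳ c p = c-* p (c-refl {c})

  c-neg : ∀ {a b} → Cong m a b → Cong m (- a) (- b)
  c-neg {b = b} (cong-by k refl) = cong-by (- k) (solve (b ∷ k ∷ m ∷ []))

  c-- : ∀ {a b c d} → Cong m a b → Cong m c d → Cong m (a - c) (b - d)
  c-- p q = c-+ p (c-neg q)

  c-respˡ : ∀ {a b c} → Cong m b c → a ≡ b → Cong m a c
  c-respˡ p refl = p

  c-respʳ : ∀ {a b c} → Cong m a b → b ≡ c → Cong m a c
  c-respʳ p refl = p

  -- Congruences are proved by exhibiting a - b as a combination of quantities known to vanish.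
  c-comb₁ : ∀ {a b u} k → Cong m u (+ 0) → a - b ≡ k * u → Cong m a b
  c-comb₁ {a} {b} k (cong-by l refl) eq = cong-by (k * l) (begin
    a                          ≡⟨ solve (a ∷ b ∷ []) ⟩
    b + (a - b)                ≡⟨ cong (_+_ b) eq ⟩
    b + k * (+ 0 + l * m)      ≡⟨ solve (b ∷ k ∷ l ∷ m ∷ []) ⟩
    b + k * l * m              ∎)

  c-comb₂ : ∀ {a b u v} k l → Cong m u (+ 0) → Cong m v (+ 0) → a - b ≡ k * u + l * v → Cong m a b
  c-comb₂ {a} {b} k l (cong-by i refl) (cong-by j refl) eq = cong-by (k * i + l * j) (begin
    a                                                ≡⟨ solve (a ∷ b ∷ []) ⟩
    b + (a - b)                                      ≡⟨ cong (_+_ b) eq ⟩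
    b + (k * (+ 0 + i * m) + l * (+ 0 + j * m))      ≡⟨ solve (b ∷ k ∷ l ∷ i ∷ j ∷ m ∷ []) ⟩
    b + (k * i + l * j) * m                          ∎)

  c-modulus : Cong m m (+ 0)
  c-modulus = cong-by (+ 1) (solve (m ∷ []))

  c-diff : ∀ {a b} → Cong m a b → Cong m (a - b) (+ 0)
  c-diff {b = b} (cong-by k refl) = cong-by k (solve (b ∷ k ∷ m ∷ []))

  c-undiff : ∀ {a b} → Cong m (a - b) (+ 0) → Cong m a b
  c-undiff {a} {b} d = c-comb₁ (+ 1) d (solve (a ∷ b ∷ []))

-- Its uses read a parity from a congruence modulo 4 or 8: that of (p - 1)/2 from p, and that of `N`
-- from 4N.
c-cancel : ∀ {a b} k m .{{_ : ℤ.NonZero k}} → Cong (k * m) (k * a) (k * b) → Cong m a b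
c-cancel {a} {b} k m (cong-by l eq) = cong-by l
  (ℤₚ.*-cancelˡ-≡ k a (b + l * m) (trans eq (solve (b ∷ k ∷ l ∷ m ∷ []))))

-- The Iverson bracket, with integer values so that cardinalities are sums and linearity applies to
-- them.
⟦_⟧ : ∀ {P : Set} → Dec P → ℤ
⟦ yes _ ⟧ = + 1
⟦ no  _ ⟧ = + 0

⟦⟧-yes : ∀ {P : Set} (d : Dec P) → P → ⟦ d ⟧ ≡ + 1
⟦⟧-yes (yes _) _ = refl
⟦⟧-yes (no ¬x) x = ⊥-elim (¬x x)

⟦⟧-no : ∀ {P : Set} (d : Dec P) → ¬ P → ⟦ d ⟧ ≡ + 0
⟦⟧-no (yes x) ¬x = ⊥-elim (¬x x)
⟦⟧-no (no _)  _  = refl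

⟦⟧-⇔ : ∀ {P Q : Set} (d : Dec P) (e : Dec Q) → (P → Q) → (Q → P) → ⟦ d ⟧ ≡ ⟦ e ⟧
⟦⟧-⇔ (yes x) e f g = sym (⟦⟧-yes e (f x))
⟦⟧-⇔ (no ¬x) e f g = sym (⟦⟧-no e (¬x ∘ g))

∑ : ℕ → (ℕ → ℤ) → ℤ
∑ zero    f = + 0
∑ (suc n) f = ∑ n f + f n

∑-cong : ∀ n {f g} → (∀ i → i < n → f i ≡ g i) → ∑ n f ≡ ∑ n g
∑-cong zero    h = refl
∑-cong (suc n) h = cong₂ _+_ (∑-cong n (λ i i<n → h i (ℕₚ.m<n⇒m<1+n i<n))) (h n ℕₚ.≤-refl)

∑-cong-mod : ∀ {m} n {f g} → (∀ i → i < n → Cong m (f i) (g i)) → Cong m (∑ n f) (∑ n g)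
∑-cong-mod zero    h = c-refl
∑-cong-mod (suc n) h = c-+ (∑-cong-mod n (λ i i<n → h i (ℕₚ.m<n⇒m<1+n i<n))) (h n ℕₚ.≤-refl)

∑-+ : ∀ n f g → ∑ n (λ i → f i + g i) ≡ ∑ n f + ∑ n g
∑-+ zero    f g = refl
∑-+ (suc n) f g = trans (cong (_+ (f n + g n)) (∑-+ n f g)) (interchange (∑ n f) (∑ n g) (f n) (g n))
  where
  interchange : ∀ a b c d → a + b + (c + d) ≡ a + c + (b + d)
  interchange = solve-∀

∑-* : ∀ n c f → ∑ n (λ i → c * f i) ≡ c * ∑ n f
∑-* zero    c f = sym (ℤₚ.*-zeroʳ c)
∑-* (suc n) c f = trans (cong (_+ c * f n) (∑-* n c f)) (sym (ℤₚ.*-distribˡ-+ c (∑ n f) (f n)))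

∑-neg : ∀ n f → ∑ n (λ i → - f i) ≡ - ∑ n f
∑-neg zero    f = refl
∑-neg (suc n) f = trans (cong (_+ - f n) (∑-neg n f)) (sym (ℤₚ.neg-distrib-+ (∑ n f) (f n)))

∑-const : ∀ n c → ∑ n (λ _ → c) ≡ + n * c
∑-const zero    c = refl
∑-const (suc n) c = trans (cong (_+ c) (∑-const n c)) (suc-* (+ n) c)
  where
  suc-* : ∀ n c → n * c + c ≡ (+ 1 + n) * c
  suc-* = solve-∀

∑-zero : ∀ n {f} → (∀ i → i < n → f i ≡ + 0) → ∑ n f ≡ + 0
∑-zero n h = trans (∑-cong n h) (trans (∑-const n (+ 0)) (ℤₚ.*-zeroʳ (+ n)))

∑-swap : ∀ m n (f : ℕ → ℕ → ℤ) → ∑ m (λ i → ∑ n (f i)) ≡ ∑ n (λ j → ∑ m (λ i → f i j))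
∑-swap zero    n f = sym (∑-zero n (λ _ _ → refl))
∑-swap (suc m) n f = trans (cong (_+ ∑ n (f m)) (∑-swap m n f)) (sym (∑-+ n _ (f m)))

∑-single : ∀ n k {f} → k < n → (∀ i → i < n → i ≢ k → f i ≡ + 0) → ∑ n f ≡ f k
∑-single (suc n) k {f} k<1+n h with k ℕₚ.≟ n
... | yes refl = trans (cong (_+ f n) (∑-zero n (λ i i<n → h i (ℕₚ.m<n⇒m<1+n i<n) (ℕₚ.<⇒≢ i<n))))
                       (ℤₚ.+-identityˡ (f n))
... | no k≢n = trans (cong₂ _+_ (∑-single n k k<n (λ i i<n → h i (ℕₚ.m<n⇒m<1+n i<n)))
                                (h n ℕₚ.≤-refl (k≢n ∘ sym)))
                     (ℤₚ.+-identityʳ (f k))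
  where k<n = ℕₚ.≤∧≢⇒< (ℕₚ.≤-pred k<1+n) k≢n

∑-first : ∀ n f → ∑ (suc n) f ≡ f 0 + ∑ n (f ∘ suc)
∑-first zero    f = ℤₚ.+-comm (+ 0) (f 0)
∑-first (suc n) f = trans (cong (_+ f (suc n)) (∑-first n f)) (ℤₚ.+-assoc (f 0) _ _)

∑-split : ∀ m n f → ∑ (m ℕ.+ n) f ≡ ∑ m f + ∑ n (λ i → f (m ℕ.+ i))
∑-split zero    n f = sym (ℤₚ.+-identityˡ _)
∑-split (suc m) n f = begin
  ∑ (suc (m ℕ.+ n)) f                                           ≡⟨ ∑-first (m ℕ.+ n) f ⟩
  f 0 + ∑ (m ℕ.+ n) (f ∘ suc)                                   ≡⟨ cong (_+_ (f 0)) (∑-split m n (f ∘ suc)) ⟩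
  f 0 + (∑ m (f ∘ suc) + ∑ n (λ i → f (suc m ℕ.+ i)))           ≡⟨ ℤₚ.+-assoc (f 0) (∑ m (f ∘ suc)) _ ⟨
  f 0 + ∑ m (f ∘ suc) + ∑ n (λ i → f (suc m ℕ.+ i))             ≡⟨ cong (_+ ∑ n (λ i → f (suc m ℕ.+ i))) (∑-first m f) ⟨
  ∑ (suc m) f + ∑ n (λ i → f (suc m ℕ.+ i))                     ∎

∑-reverse : ∀ n f g → (∀ i j → suc (i ℕ.+ j) ≡ n → f i ≡ g j) → ∑ n f ≡ ∑ n g
∑-reverse zero    f g h = refl
∑-reverse (suc n) f g h = begin
  ∑ n f + f n          ≡⟨ cong₂ _+_ (∑-reverse n f (g ∘ suc) (λ i j eq → h i (suc j) (cong suc (trans (ℕₚ.+-suc i j) eq))))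
                                   (h n 0 (cong suc (ℕₚ.+-identityʳ n))) ⟩
  ∑ n (g ∘ suc) + g 0  ≡⟨ ℤₚ.+-comm _ (g 0) ⟩
  g 0 + ∑ n (g ∘ suc)  ≡⟨ ∑-first n g ⟨
  ∑ (suc n) g          ∎

-- Off-diagonal entries cancel in pairs modulo 2, leaving the trace. If the row sums of `G` form the
-- indicator of a set, the set has the parity of the number of fixed points of the involution that
-- `G` describes.
∑-symmetric : ∀ n (G : ℕ → ℕ → ℤ) → (∀ i j → G i j ≡ G j i) →
              ∑ n (λ i → ∑ n (G i)) ≈₂ ∑ n (λ i → G i i)
∑-symmetric zero    G h = c-refl
∑-symmetric (suc n) G h = c-trans (c-reflexive expand)
  (c-trans (cong-by (∑ n (G n)) (border (∑ n (λ i → ∑ n (G i))) (∑ n (G n)) (G n n)))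
           (c-+ (∑-symmetric n G h) c-refl))
  where
  border : ∀ a b c → a + b + (b + c) ≡ a + c + b * + 2
  border = solve-∀
  expand : ∑ n (λ i → ∑ n (G i) + G i n) + (∑ n (G n) + G n n)
         ≡ ∑ n (λ i → ∑ n (G i)) + ∑ n (G n) + (∑ n (G n) + G n n)
  expand = cong (_+ (∑ n (G n) + G n n))
    (trans (∑-+ n (λ i → ∑ n (G i)) (λ i → G i n)) (cong (_+_ (∑ n (λ i → ∑ n (G i)))) (∑-cong n (λ i _ → h i n))))

-- Signs and their indicators

is1 is-1 : ℤ → ℤ
is1 c  = ⟦ c ℤₚ.≟ + 1 ⟧
is-1 c = ⟦ c ℤₚ.≟ - + 1 ⟧

data ±1 : ℤ → Set where
  +one : ±1 (+ 1)
  -one : ±1 (- + 1)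

⟦⟧-bit : ∀ {P : Set} (d : Dec P) → ⟦ d ⟧ ≡ + 0 ⊎ ⟦ d ⟧ ≡ + 1
⟦⟧-bit (yes _) = inj₂ refl
⟦⟧-bit (no _)  = inj₁ refl

⟦⟧-idem : ∀ {P : Set} (d : Dec P) → ⟦ d ⟧ * ⟦ d ⟧ ≡ ⟦ d ⟧
⟦⟧-idem (yes _) = refl
⟦⟧-idem (no _)  = refl

unit-solve : ∀ {x y z} → ±1 x → ±1 y → ±1 z → x * y * z ≡ + 1 → z ≡ x * y
unit-solve +one +one +one _ = refl
unit-solve +one -one -one _ = refl
unit-solve -one +one -one _ = refl
unit-solve -one -one +one _ = refl

unit-*≡1 : ∀ {x y} → ±1 x → ±1 y → x * y ≡ + 1 → y ≡ x
unit-*≡1 +one +one _ = refl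
unit-*≡1 -one -one _ = refl

unit-square : ∀ {x} → ±1 x → x * x ≡ + 1
unit-square +one = refl
unit-square -one = refl

-- The product of the three binomials is 8 for u = 1, v = w = -1 and 0 for all other signs; this
-- expands the indicator `g` in characters at points where none of them vanishes.
eight-products : ∀ {u v w} → ±1 u → ±1 v → ±1 w →
  (+ 1 + u) * (+ 1 - v) * (+ 1 - w) - + 8 * (is1 u * (is-1 w * is-1 v)) ≡ + 0
eight-products +one +one +one = refl
eight-products +one +one -one = refl
eight-products +one -one +one = refl
eight-products +one -one -one = refl
eight-products -one +one +one = refl
eight-products -one +one -one = refl
eight-products -one -one +one = refl
eight-products -one -one -one = refl

four-products : ∀ {u v} → ±1 u → ±1 v → (+ 1 + u) * (+ 1 - v) - + 4 * (is1 u * (is-1 v * is-1 v)) ≡ + 0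
four-products +one +one = refl
four-products +one -one = refl
four-products -one +one = refl
four-products -one -one = refl

-- Floors as counts

count-≤ : ∀ L K → K ℕ.≤ L → ∑ L (λ l → ⟦ suc l ℕ.≤? K ⟧) ≡ + K
count-≤ L K K≤L = begin
  ∑ L f                                             ≡⟨ cong (λ m → ∑ m f) (ℕₚ.m+[n∸m]≡n K≤L) ⟨
  ∑ (K ℕ.+ (L ℕ.∸ K)) f                             ≡⟨ ∑-split K (L ℕ.∸ K) f ⟩
  ∑ K f + ∑ (L ℕ.∸ K) (λ i → f (K ℕ.+ i))           ≡⟨ cong₂ _+_
      (∑-cong K (λ i i<K → ⟦⟧-yes (suc i ℕ.≤? K) i<K))
      (∑-zero (L ℕ.∸ K) (λ i _ → ⟦⟧-no (suc (K ℕ.+ i) ℕ.≤? K) (λ h → ℕₚ.1+n≰n (ℕₚ.≤-trans (s≤s (ℕₚ.m≤m+n K i)) h)))) ⟩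
  ∑ K (λ _ → + 1) + + 0                             ≡⟨ trans (ℤₚ.+-identityʳ _) (trans (∑-const K (+ 1)) (ℤₚ.*-identityʳ (+ K))) ⟩
  + K                                               ∎
  where
  f : ℕ → ℤ
  f l = ⟦ suc l ℕ.≤? K ⟧

-- The two bounds on m say K = ⌊m/d⌋. A floor written as a sum of indicators can be exchanged with
-- the sum over S in Gauss's lemma.
count-multiples : ∀ L K d m → K ℕ.≤ L → K ℕ.* d ℕ.≤ m → m < suc K ℕ.* d →
                  ∑ L (λ l → ⟦ suc l ℕ.* d ℕ.≤? m ⟧) ≡ + K
count-multiples L K d m K≤L Kd≤m m<[1+K]d = trans
  (∑-cong L (λ l _ → ⟦⟧-⇔ (suc l ℕ.* d ℕ.≤? m) (suc l ℕ.≤? K)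
    (λ h → ℕₚ.≤-pred (ℕₚ.*-cancelʳ-< d (suc l) (suc K) (ℕₚ.≤-<-trans h m<[1+K]d)))
    (λ h → ℕₚ.≤-trans (ℕₚ.*-monoˡ-≤ d h) Kd≤m)))
  (count-≤ L K K≤L)

-- The number of j ∈ S with ⌊2aj/p⌋ at least l + 1; summed over l it gives the sum of these floors.
crossings : ℕ → ℕ → ℕ → ℕ → ℤ
crossings p n a l = ∑ n (λ j → ⟦ suc l ℕ.* p ℕ.≤? (a ℕ.+ a) ℕ.* suc j ⟧)

∑-≤0 : ∀ n {f} → (∀ i → i < n → f i ℤ.≤ + 0) → ∑ n f ℤ.≤ + 0
∑-≤0 zero    h = ℤₚ.≤-refl
∑-≤0 (suc n) h = ℤₚ.+-mono-≤ (∑-≤0 n (λ i i<n → h i (ℕₚ.m<n⇒m<1+n i<n))) (h n ℕₚ.≤-refl)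

∑-≤0-vanish : ∀ n {f} → (∀ i → i < n → f i ℤ.≤ + 0) → ∑ n f ≡ + 0 → ∀ i → i < n → f i ≡ + 0
∑-≤0-vanish (suc n) {f} h eq i i<1+n = split (i ℕ.≟ n)
  where
  h′ = λ i i<n → h i (ℕₚ.m<n⇒m<1+n i<n)
  last≡0 : f n ≡ + 0
  last≡0 = ℤₚ.≤-antisym (h n ℕₚ.≤-refl)
    (subst (ℤ._≤ f n) eq (subst (∑ n f + f n ℤ.≤_) (ℤₚ.+-identityˡ (f n)) (ℤₚ.+-monoˡ-≤ (f n) (∑-≤0 n h′))))
  init≡0 : ∑ n f ≡ + 0
  init≡0 = trans (sym (ℤₚ.+-identityʳ _)) (trans (cong (_+_ (∑ n f)) (sym last≡0)) eq)
  split : Dec (i ≡ n) → f i ≡ + 0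
  split (yes i≡n) = trans (cong f i≡n) last≡0
  split (no i≢n)  = ∑-≤0-vanish n h′ init≡0 i (ℕₚ.≤∧≢⇒< (ℕₚ.≤-pred i<1+n) i≢n)

-- Least nonnegative residues

modp-cong : ∀ {m} → 0 < m → ∀ a → Cong (+ m) a (+ modp m a)
modp-cong {suc m} _ a = cong-by (a /ℕ suc m) (a≡a%ℕn+[a/ℕn]*n a (suc m))

modp-< : ∀ {m} → 0 < m → ∀ a → modp m a < m
modp-< {suc m} _ a = n%ℕd<d a (suc m)

residue-unique : ∀ {m r s} → r < m → s < m → Cong (+ m) (+ r) (+ s) → r ≡ s
residue-unique {m} {r} {s} r<m s<m (cong-by k eq) = go k eq
  where
  large : ∀ {r s} j → r < m → + r ≡ + s + + suc j * + m → ⊥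
  large {r} {s} j r<m eq = ℕₚ.<⇒≱ r<m (subst (m ℕ.≤_) (sym r≡) (ℕₚ.≤-trans (ℕₚ.m≤m+n m (j ℕ.* m)) (ℕₚ.m≤n+m _ s)))
    where
    r≡ : r ≡ s ℕ.+ suc j ℕ.* m
    r≡ = ℤₚ.+-injective (trans eq (trans (cong (_+_ (+ s)) (sym (ℤₚ.pos-* (suc j) m))) (sym (ℤₚ.pos-+ s (suc j ℕ.* m)))))
  go : ∀ k → + r ≡ + s + k * + m → r ≡ s
  go (+ zero)  eq = ℤₚ.+-injective (trans eq (ℤₚ.+-identityʳ (+ s)))
  go (+ suc j) eq = ⊥-elim (large j r<m eq)
  go -[1+ j ]  eq = ⊥-elim (large j s<m (swap (+ suc j) (+ m) eq))
    where
    swap : ∀ {r s} k m → r ≡ s + (- k) * m → s ≡ r + k * m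
    swap {s = s} k m refl = solve (s ∷ k ∷ m ∷ [])

modp-unique : ∀ {m a b} → 0 < m → Cong (+ m) a b → modp m a ≡ modp m b
modp-unique {a = a} {b} 0<m a≈b = residue-unique (modp-< 0<m a) (modp-< 0<m b)
  (c-trans (c-sym (modp-cong 0<m a)) (c-trans a≈b (modp-cong 0<m b)))

modp-reflect : ∀ {m a b} → 0 < m → modp m a ≡ modp m b → Cong (+ m) a b
modp-reflect {a = a} {b} 0<m eq =
  c-trans (modp-cong 0<m a) (c-trans (c-reflexive (cong +_ eq)) (c-sym (modp-cong 0<m b)))

modp-small : ∀ {m r} → r < m → modp m (+ r) ≡ r
modp-small {m} {r} r<m = residue-unique (modp-< 0<m (+ r)) r<m (c-sym (modp-cong 0<m (+ r)))
  where 0<m = ℕₚ.≤-<-trans z≤n r<m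

Cong? : ∀ {m} → 0 < m → ∀ a b → Dec (Cong (+ m) a b)
Cong? {m} 0<m a b = map′ (modp-reflect 0<m) (modp-unique 0<m) (modp m a ℕ.≟ modp m b)

∣⇒Cong-0 : ∀ {m a} → m ℕᵈ.∣ ℤ.∣ a ∣ → Cong (+ m) a (+ 0)
∣⇒Cong-0 {m} {a} m∣a with ℤᵈ.∣ᵤ⇒∣ {+ m} {a} m∣a
... | ℤᵈ.divides k eq = cong-by k (trans eq (sym (ℤₚ.+-identityˡ _)))

Cong-0⇒∣ : ∀ {m a} → Cong (+ m) a (+ 0) → m ℕᵈ.∣ ℤ.∣ a ∣
Cong-0⇒∣ {m} {a} (cong-by k eq) = ℤᵈ.∣⇒∣ᵤ {+ m} {a} (ℤᵈ.divides k (trans eq (ℤₚ.+-identityˡ _)))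

-- Quadratic residues modulo an odd prime

module Residues (p n : ℕ) (p≡1+n+n : p ≡ suc (n ℕ.+ n)) (p-prime : Prime p) where

  0<p : 0 < p
  0<p = subst (0 <_) (sym p≡1+n+n) (s≤s z≤n)

  infix 4 _≈_ _≉_ _≈?_
  _≈_ _≉_ : ℤ → ℤ → Set
  _≈_ = Cong (+ p)
  a ≉ b = ¬ a ≈ b

  abstract
    _≈?_ : ∀ a b → Dec (a ≈ b)
    _≈?_ = Cong? 0<p

  rep : ∀ a → a ≈ + modp p a
  rep = modp-cong 0<p

  domain : ∀ a b → a * b ≈ + 0 → a ≈ + 0 ⊎ b ≈ + 0
  domain a b ab≈0 = Sum.map ∣⇒Cong-0 ∣⇒Cong-0
    (euclidsLemma ℤ.∣ a ∣ ℤ.∣ b ∣ p-prime (subst (p ℕᵈ.∣_) (ℤₚ.abs-* a b) (Cong-0⇒∣ ab≈0)))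

  domain-≉ : ∀ {a b} → a ≉ + 0 → b ≉ + 0 → a * b ≉ + 0
  domain-≉ {a} {b} a≉0 b≉0 ab≈0 with domain a b ab≈0
  ... | inj₁ a≈0 = a≉0 a≈0
  ... | inj₂ b≈0 = b≉0 b≈0

  cancel : ∀ a b c → a ≉ + 0 → a * b ≈ a * c → b ≈ c
  cancel a b c a≉0 eq with domain a (b - c) (c-comb₁ (+ 1) (c-diff eq) (solve (a ∷ b ∷ c ∷ [])))
  ... | inj₁ a≈0   = ⊥-elim (a≉0 a≈0)
  ... | inj₂ b-c≈0 = c-undiff b-c≈0

  small≉0 : ∀ {k} → 0 < k → k < p → + k ≉ + 0
  small≉0 0<k k<p k≈0 = ℕₚ.<⇒≢ 0<k (sym (residue-unique k<p 0<p k≈0))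

  inverse : ∀ a → a ≉ + 0 → ∃ λ x → a * x ≈ + 1
  inverse a a≉0 with modp p a in eq
  ... | zero  = ⊥-elim (a≉0 (c-trans (rep a) (c-reflexive (cong +_ eq))))
  ... | suc r with coprime-Bézout (prime⇒coprime p-prime (subst (_< p) eq (modp-< 0<p a)))
  ... | GCD.Bézout.+- x y e = - + y , c-trans (c-* (rep a) c-refl) (c-comb₁ (- + x) c-modulus claim)
    where
    e′ : + 1 + + y * + suc r ≡ + x * + p
    e′ = trans (cong (_+_ (+ 1)) (sym (ℤₚ.pos-* y (suc r)))) (trans (cong +_ e) (ℤₚ.pos-* x p))
    rearrange : ∀ r y → r * (- y) - + 1 ≡ - (+ 1 + y * r)
    rearrange = solve-∀
    claim : + modp p a * - + y - + 1 ≡ - + x * + p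
    claim = trans (cong (λ z → + z * - + y - + 1) eq)
      (trans (rearrange (+ suc r) (+ y)) (trans (cong -_ e′) (ℤₚ.neg-distribˡ-* (+ x) (+ p))))
  ... | GCD.Bézout.-+ x y e = + y , c-trans (c-* (rep a) c-refl) (cong-by (+ x)
          (trans (cong (λ z → + z * + y) eq) (trans (ℤₚ.*-comm (+ suc r) (+ y)) (sym e′))))
    where
    e′ : + 1 + + x * + p ≡ + y * + suc r
    e′ = trans (cong (_+_ (+ 1)) (sym (ℤₚ.pos-* x p))) (trans (cong +_ e) (ℤₚ.pos-* y (suc r)))

  inv : ℤ → ℤ
  inv a with a ≈? + 0
  -- The value 0 at 0 makes `inv` an involution of all residues, so sums over the whole field can be
  -- reindexed by it.
  ... | yes _  = + 0
  ... | no a≉0 = proj₁ (inverse a a≉0)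

  inv-*ʳ : ∀ {a} → a ≉ + 0 → a * inv a ≈ + 1
  inv-*ʳ {a} a≉0 with a ≈? + 0
  ... | yes a≈0 = ⊥-elim (a≉0 a≈0)
  ... | no a≉0′ = proj₂ (inverse a a≉0′)

  inv-0 : ∀ {a} → a ≈ + 0 → inv a ≈ + 0
  inv-0 {a} a≈0 with a ≈? + 0
  ... | yes _  = c-refl
  ... | no a≉0 = ⊥-elim (a≉0 a≈0)

  1≉0 : + 1 ≉ + 0
  1≉0 = small≉0 (s≤s z≤n) (ℕₚ.≤∧≢⇒< 0<p (λ { refl → 1-not-prime p-prime }))
    where
    1-not-prime : ¬ Prime 1
    1-not-prime (prime {{()}} _)

  unit-≉0 : ∀ a b → a * b ≈ + 1 → a ≉ + 0
  unit-≉0 a b ab≈1 a≈0 = 1≉0 (c-trans (c-sym ab≈1) (c-* a≈0 (c-refl {a = b})))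

  inv-≉0 : ∀ {a} → a ≉ + 0 → inv a ≉ + 0
  inv-≉0 {a} a≉0 = unit-≉0 (inv a) a (c-trans (c-reflexive (ℤₚ.*-comm (inv a) a)) (inv-*ʳ a≉0))

  inv-unique : ∀ a b → a * b ≈ + 1 → b ≈ inv a
  inv-unique a b ab≈1 = cancel a b (inv a) a≉0 (c-trans ab≈1 (c-sym (inv-*ʳ a≉0)))
    where a≉0 = unit-≉0 a b ab≈1

  inv-galois : ∀ {y z} → z ≈ inv y → y ≈ inv z
  inv-galois {y} {z} z≈ with y ≈? + 0
  ... | yes y≈0 = c-trans y≈0 (c-sym (inv-0 z≈))
  ... | no y≉0  = inv-unique z y (c-trans (c-* z≈ (c-refl {a = y})) (c-trans (c-reflexive (ℤₚ.*-comm _ y)) (proj₂ (inverse y y≉0))))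

  Respects : (ℤ → ℤ) → Set
  Respects f = ∀ {a b} → a ≈ b → f a ≡ f b

  -- The possible values of `legendre` with evidence stated as congruences; `χ-view` alone unfolds
  -- the search over squares.
  data Quadratic (a : ℤ) : ℤ → Set where
    divisible  : a ≈ + 0 → Quadratic a (+ 0)
    residue    : ∀ x → a ≉ + 0 → x * x ≈ a → Quadratic a (+ 1)
    nonresidue : a ≉ + 0 → (∀ x → ¬ x * x ≈ a) → Quadratic a (- + 1)

  χ : ℤ → ℤ
  χ = legendre p

  χ-view : ∀ a → Quadratic a (χ a)
  χ-view a with modp p a in eq
  ... | zero  = divisible (c-trans (rep a) (c-reflexive (cong +_ eq)))
  ... | suc r with any (λ x → modp p (+ x * + x) ℕ.≡ᵇ suc r) (upTo p) in found
  ... | true  = let (x , _ , t) = find (any⁻ _ (upTo p) (subst Bool.T (sym found) tt)) in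
    residue (+ x) a≉0 (modp-reflect 0<p (trans (ℕₚ.≡ᵇ⇒≡ _ _ t) (sym eq)))
    where a≉0 = λ a≈0 → ℕₚ.1+n≢0 (trans (sym eq) (trans (modp-unique 0<p a≈0) (modp-small 0<p)))
  ... | false = nonresidue a≉0 (λ x x²≈a → subst Bool.T found (any⁺ _ (lose (∈-upTo⁺ (modp-< 0<p x))
      (ℕₚ.≡⇒≡ᵇ _ _ (trans (modp-unique 0<p (c-trans (c-* (c-sym (rep x)) (c-sym (rep x))) x²≈a)) eq)))))
    where a≉0 = λ a≈0 → ℕₚ.1+n≢0 (trans (sym eq) (trans (modp-unique 0<p a≈0) (modp-small 0<p)))

  Quadratic-unique : ∀ {a b c d} → a ≈ b → Quadratic a c → Quadratic b d → c ≡ d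
  Quadratic-unique a≈b (divisible _)      (divisible _)      = refl
  Quadratic-unique a≈b (divisible a≈0)    (residue _ b≉0 _)  = ⊥-elim (b≉0 (c-trans (c-sym a≈b) a≈0))
  Quadratic-unique a≈b (divisible a≈0)    (nonresidue b≉0 _) = ⊥-elim (b≉0 (c-trans (c-sym a≈b) a≈0))
  Quadratic-unique a≈b (residue _ a≉0 _)  (divisible b≈0)    = ⊥-elim (a≉0 (c-trans a≈b b≈0))
  Quadratic-unique a≈b (residue _ _ _)    (residue _ _ _)    = refl
  Quadratic-unique a≈b (residue x _ x²≈a) (nonresidue _ h)   = ⊥-elim (h x (c-trans x²≈a a≈b))
  Quadratic-unique a≈b (nonresidue a≉0 _) (divisible b≈0)    = ⊥-elim (a≉0 (c-trans a≈b b≈0))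
  Quadratic-unique a≈b (nonresidue _ h)   (residue x _ x²≈b) = ⊥-elim (h x (c-trans x²≈b (c-sym a≈b)))
  Quadratic-unique a≈b (nonresidue _ _)   (nonresidue _ _)   = refl

  χ-respects : Respects χ
  χ-respects {a} {b} a≈b = Quadratic-unique a≈b (χ-view a) (χ-view b)

  χ≡ : ∀ {a c} → Quadratic a c → χ a ≡ c
  χ≡ {a} = Quadratic-unique c-refl (χ-view a)

  0<n : 0 < n
  0<n = ℕₚ.n≢0⇒n>0 (λ n≡0 → 1≉0 (subst (λ m → Cong (+ m) (+ 1) (+ 0))
    (sym (trans p≡1+n+n (cong (λ k → suc (k ℕ.+ k)) n≡0))) (cong-by (+ 1) refl)))

  n<p : n < p
  n<p = subst (n <_) (sym p≡1+n+n) (s≤s (ℕₚ.m≤m+n n n))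

  2≉0 : + 2 ≉ + 0
  2≉0 = small≉0 (s≤s z≤n) (subst (2 <_) (sym p≡1+n+n) (s≤s (ℕₚ.+-mono-≤ 0<n 0<n)))

  -- Sums over all residues

  ∑F : (ℤ → ℤ) → ℤ
  ∑F f = ∑ p (λ k → f (+ k))

  ∑F-cong : ∀ {f g} → (∀ y → f y ≡ g y) → ∑F f ≡ ∑F g
  ∑F-cong h = ∑-cong p (λ i _ → h (+ i))

  ∑F-+ : ∀ f g → ∑F (λ y → f y + g y) ≡ ∑F f + ∑F g
  ∑F-+ f g = ∑-+ p _ _

  ∑F-neg : ∀ f → ∑F (λ y → - f y) ≡ - ∑F f
  ∑F-neg f = ∑-neg p _

  ∑F-* : ∀ c f → ∑F (λ y → c * f y) ≡ c * ∑F f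
  ∑F-* c f = ∑-* p c _

  ∑F-swap : ∀ (f : ℤ → ℤ → ℤ) → ∑F (λ y → ∑F (f y)) ≡ ∑F (λ z → ∑F (λ y → f y z))
  ∑F-swap f = ∑-swap p p (λ i j → f (+ i) (+ j))

  ∑F-point : ∀ {f} a → Respects f → (∀ y → y ≉ a → f y ≡ + 0) → ∑F f ≡ f a
  ∑F-point a resp h = trans
    (∑-single p (modp p a) (modp-< 0<p a) (λ i i<p i≢ → h (+ i) (λ i≈a →
      i≢ (residue-unique i<p (modp-< 0<p a) (c-trans i≈a (rep a))))))
    (resp (c-sym (rep a)))

  ≈?-respects : ∀ {a b c d} → a ≈ b → c ≈ d → ⟦ a ≈? c ⟧ ≡ ⟦ b ≈? d ⟧
  ≈?-respects {a} {b} {c} {d} a≈b c≈d = ⟦⟧-⇔ (a ≈? c) (b ≈? d)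
    (λ a≈c → c-trans (c-sym a≈b) (c-trans a≈c c≈d)) (λ b≈d → c-trans a≈b (c-trans b≈d (c-sym c≈d)))

  ∑F-δ : ∀ {f} a → Respects f → ∑F (λ y → ⟦ y ≈? a ⟧ * f y) ≡ f a
  ∑F-δ {f} a resp = begin
    ∑F (λ y → ⟦ y ≈? a ⟧ * f y)  ≡⟨ ∑F-point a (λ y≈z → cong₂ _*_ (≈?-respects y≈z c-refl) (resp y≈z))
                                     (λ y y≉a → cong (_* f y) (⟦⟧-no (y ≈? a) y≉a)) ⟩
    ⟦ a ≈? a ⟧ * f a             ≡⟨ cong (_* f a) (⟦⟧-yes (a ≈? a) c-refl) ⟩
    + 1 * f a                    ≡⟨ ℤₚ.*-identityˡ (f a) ⟩
    f a                          ∎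

  ∑F-⟦≈⟧ : ∀ a → ∑F (λ y → ⟦ y ≈? a ⟧) ≡ + 1
  ∑F-⟦≈⟧ a = trans (∑F-cong (λ y → sym (ℤₚ.*-identityʳ ⟦ y ≈? a ⟧))) (∑F-δ a (λ _ → refl))

  -- Each f (φ y) is a sum over z against the indicator of z ≈ φ y. After the two sums are
  -- exchanged, the inner one contains the single y ≈ ψ z.
  ∑F-reindex : ∀ {f} (φ ψ : ℤ → ℤ) → Respects f →
               (∀ y z → z ≈ φ y → y ≈ ψ z) → (∀ y z → y ≈ ψ z → z ≈ φ y) →
               ∑F (λ y → f (φ y)) ≡ ∑F f
  ∑F-reindex {f} φ ψ resp to from = begin
    ∑F (λ y → f (φ y))                            ≡⟨ ∑F-cong (λ y → ∑F-δ (φ y) resp) ⟨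
    ∑F (λ y → ∑F (λ z → ⟦ z ≈? φ y ⟧ * f z))      ≡⟨ ∑F-swap (λ y z → ⟦ z ≈? φ y ⟧ * f z) ⟩
    ∑F (λ z → ∑F (λ y → ⟦ z ≈? φ y ⟧ * f z))      ≡⟨ ∑F-cong (λ z → ∑F-cong (λ y →
                                                       cong (_* f z) (⟦⟧-⇔ (z ≈? φ y) (y ≈? ψ z) (to y z) (from y z)))) ⟩
    ∑F (λ z → ∑F (λ y → ⟦ y ≈? ψ z ⟧ * f z))      ≡⟨ ∑F-cong (λ z → ∑F-δ {λ _ → f z} (ψ z) (λ _ → refl)) ⟩
    ∑F f                                          ∎

  ∑F-scale : ∀ {f} a → Respects f → a ≉ + 0 → ∑F (λ y → f (a * y)) ≡ ∑F f
  ∑F-scale {f} a resp a≉0 = ∑F-reindex (a *_) (inv a *_) resp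
    (λ y z z≈ay → cancel a y (inv a * z) a≉0 (c-trans (c-sym z≈ay) (c-sym (expand z))))
    (λ y z y≈ → c-sym (c-trans (c-*ˡ a y≈) (expand z)))
    where
    expand : ∀ z → a * (inv a * z) ≈ z
    expand z = c-comb₁ z (c-diff (inv-*ʳ a≉0)) (assoc-unit a (inv a) z)
      where
      assoc-unit : ∀ a b z → a * (b * z) - z ≡ z * (a * b - + 1)
      assoc-unit = solve-∀

  ∑F-translate : ∀ {f} c → Respects f → ∑F (λ y → f (y + c)) ≡ ∑F f
  ∑F-translate {f} c resp = ∑F-reindex (_+ c) (_- c) resp
    (λ y z z≈ → c-comb₁ (- + 1) (c-diff z≈) (solve (y ∷ z ∷ c ∷ [])))
    (λ y z y≈ → c-comb₁ (- + 1) (c-diff y≈) (solve (y ∷ z ∷ c ∷ [])))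

  ∑F-inv : ∀ {f} → Respects f → ∑F (λ y → f (inv y)) ≡ ∑F f
  ∑F-inv resp = ∑F-reindex inv inv resp (λ y z → inv-galois) (λ y z → inv-galois)

  count-roots : ∀ a → ∑F (λ x → ⟦ x * x ≈? a ⟧) ≡ + 1 + χ a
  count-roots a with χ a | χ-view a
  ... | _ | divisible a≈0 = trans (∑F-cong (λ x → ⟦⟧-⇔ (x * x ≈? a) (x ≈? + 0)
      (λ x²≈a → Sum.reduce (domain x x (c-trans x²≈a a≈0))) (λ x≈0 → c-trans (c-* x≈0 x≈0) (c-sym a≈0)))) (∑F-⟦≈⟧ (+ 0))
  ... | _ | nonresidue _ none = ∑-zero p (λ i _ → ⟦⟧-no (+ i * + i ≈? a) (none (+ i)))
  ... | _ | residue r a≉0 r²≈a = begin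
    ∑F (λ x → ⟦ x * x ≈? a ⟧)                     ≡⟨ ∑F-cong two-roots ⟩
    ∑F (λ x → ⟦ x ≈? r ⟧ + ⟦ x ≈? - r ⟧)          ≡⟨ ∑F-+ (λ x → ⟦ x ≈? r ⟧) (λ x → ⟦ x ≈? - r ⟧) ⟩
    ∑F (λ x → ⟦ x ≈? r ⟧) + ∑F (λ x → ⟦ x ≈? - r ⟧) ≡⟨ cong₂ _+_ (∑F-⟦≈⟧ r) (∑F-⟦≈⟧ (- r)) ⟩
    + 2                                           ∎
    where
    double : ∀ r → + 2 * r - + 0 ≡ + 1 * (r - - r)
    double = solve-∀
    r≉-r : r ≉ - r
    r≉-r r≈-r = Sum.[ 2≉0 , (λ r≈0 → a≉0 (c-trans (c-sym r²≈a) (c-* r≈0 r≈0))) ]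
      (domain (+ 2) r (c-comb₁ (+ 1) (c-diff r≈-r) (double r)))
    plus : ∀ {x} → x ≈ r → x * x ≈ a
    plus x≈r = c-trans (c-* x≈r x≈r) r²≈a
    minus : ∀ {x} → x ≈ - r → x * x ≈ a
    minus x≈-r = c-trans (c-* x≈-r x≈-r) (c-respˡ r²≈a (solve (r ∷ [])))
    two-roots : ∀ x → ⟦ x * x ≈? a ⟧ ≡ ⟦ x ≈? r ⟧ + ⟦ x ≈? - r ⟧
    two-roots x with x ≈? r | x ≈? - r
    ... | yes x≈r | yes x≈-r = ⊥-elim (r≉-r (c-trans (c-sym x≈r) x≈-r))
    ... | yes x≈r | no _     = ⟦⟧-yes (x * x ≈? a) (plus x≈r)
    ... | no _    | yes x≈-r = ⟦⟧-yes (x * x ≈? a) (minus x≈-r)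
    ... | no x≉r  | no x≉-r  = ⟦⟧-no (x * x ≈? a) neither
      where
      factor : ∀ x r → (x - r) * (x + r) - + 0 ≡ + 1 * (x * x - r * r)
      factor = solve-∀
      minus-neg : ∀ x r → x - - r ≡ + 1 * (x + r)
      minus-neg = solve-∀
      neither : x * x ≉ a
      neither x²≈a = Sum.[ (λ h → x≉r (c-undiff h)) , (λ h → x≉-r (c-comb₁ (+ 1) h (minus-neg x r))) ]
        (domain (x - r) (x + r) (c-comb₁ (+ 1) (c-diff (c-trans x²≈a (c-sym r²≈a))) (factor x r)))

  -- The fibre of squaring over y has 1 + χ y elements. For constant f this already yields the
  -- vanishing of the sum of χ.
  ∑F-squares : ∀ {f} → Respects f → ∑F (λ x → f (x * x)) ≡ ∑F (λ y → (+ 1 + χ y) * f y)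
  ∑F-squares {f} resp = begin
    ∑F (λ x → f (x * x))                          ≡⟨ ∑F-cong (λ x → ∑F-δ (x * x) resp) ⟨
    ∑F (λ x → ∑F (λ y → ⟦ y ≈? x * x ⟧ * f y))    ≡⟨ ∑F-swap (λ x y → ⟦ y ≈? x * x ⟧ * f y) ⟩
    ∑F (λ y → ∑F (λ x → ⟦ y ≈? x * x ⟧ * f y))    ≡⟨ ∑F-cong (λ y → trans (∑F-cong (λ x →
        trans (cong (_* f y) (⟦⟧-⇔ (y ≈? x * x) (x * x ≈? y) c-sym c-sym)) (ℤₚ.*-comm ⟦ x * x ≈? y ⟧ (f y))))
        (trans (∑F-* (f y) (λ x → ⟦ x * x ≈? y ⟧)) (trans (cong (f y *_) (count-roots y)) (ℤₚ.*-comm (f y) (+ 1 + χ y))))) ⟩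
    ∑F (λ y → (+ 1 + χ y) * f y)                  ∎

  ∑F-χ : ∑F χ ≡ + 0
  ∑F-χ = ∙-cancelˡ ℤₚ.+-0-abelianGroup (∑F (λ _ → + 1)) _ _ (begin
    ∑F (λ _ → + 1) + ∑F χ               ≡⟨ ∑F-+ (λ _ → + 1) χ ⟨
    ∑F (λ y → + 1 + χ y)                ≡⟨ ∑F-cong (λ y → ℤₚ.*-identityʳ (+ 1 + χ y)) ⟨
    ∑F (λ y → (+ 1 + χ y) * + 1)        ≡⟨ ∑F-squares {λ _ → + 1} (λ _ → refl) ⟨
    ∑F (λ _ → + 1)                      ≡⟨ ℤₚ.+-identityʳ _ ⟨
    ∑F (λ _ → + 1) + + 0                ∎)

  -- Multiplicativity of the quadratic character

  χ-0 : ∀ {a} → a ≈ + 0 → χ a ≡ + 0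
  χ-0 a≈0 = χ≡ (divisible a≈0)

  χ-*-0ʳ : ∀ a {y} → y ≈ + 0 → χ (a * y) ≡ + 0
  χ-*-0ʳ a y≈0 = χ-0 (c-trans (c-*ˡ a y≈0) (c-reflexive (ℤₚ.*-zeroʳ a)))

  χ-square : ∀ r → r ≉ + 0 → χ (r * r) ≡ + 1
  χ-square r r≉0 = χ≡ (residue r (domain-≉ r≉0 r≉0) c-refl)

  χ-square-* : ∀ r a → r ≉ + 0 → χ (r * r * a) ≡ χ a
  χ-square-* r a r≉0 with χ a | χ-view a
  ... | _ | divisible a≈0    = χ-*-0ʳ (r * r) a≈0
  ... | _ | residue x a≉0 x²≈a = χ≡ (residue (r * x) (domain-≉ (domain-≉ r≉0 r≉0) a≉0)
        (c-respˡ (c-*ˡ (r * r) x²≈a) (solve (r ∷ x ∷ []))))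
  ... | _ | nonresidue a≉0 none = χ≡ (nonresidue (domain-≉ (domain-≉ r≉0 r≉0) a≉0)
        (λ x x²≈ → none (inv r * x) (cancel (r * r) (inv r * x * (inv r * x)) a (domain-≉ r≉0 r≉0)
          (c-trans (c-comb₁ (x * x * (r * inv r + + 1)) (c-diff (inv-*ʳ r≉0)) (expand r (inv r) x)) x²≈))))
    where
    expand : ∀ r s x → r * r * (s * x * (s * x)) - x * x ≡ x * x * (r * s + + 1) * (r * s - + 1)
    expand = solve-∀

  χ≤1 : ∀ a → χ a ℤ.≤ + 1
  χ≤1 a with χ a | χ-view a
  ... | _ | divisible _    = ℤ.+≤+ z≤n
  ... | _ | residue _ _ _  = ℤₚ.≤-refl
  ... | _ | nonresidue _ _ = ℤ.-≤+

  -- For a nonresidue a the map y ↦ χ (a y) + χ y has sum zero and no positive value.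
  χ-nonresidue-* : ∀ {a} → χ a ≡ - + 1 → a ≉ + 0 → ∀ y → χ (a * y) ≡ - χ y
  χ-nonresidue-* {a} χa a≉0 y = begin
    χ (a * y)                    ≡⟨ cancel-+ (χ (a * y)) (χ y) ⟩
    χ (a * y) + χ y - χ y        ≡⟨ cong (_- χ y) vanish ⟩
    + 0 - χ y                    ≡⟨ ℤₚ.+-identityˡ (- χ y) ⟩
    - χ y                        ∎
    where
    cancel-+ : ∀ u v → u ≡ u + v - v
    cancel-+ = solve-∀
    f : ℤ → ℤ
    f y = χ (a * y) + χ y
    f≤0 : ∀ y → f y ℤ.≤ + 0
    f≤0 y with χ y | χ-view y
    ... | _ | divisible y≈0   = ℤₚ.≤-reflexive (cong (_+ + 0) (χ-*-0ʳ a y≈0))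
    ... | _ | nonresidue _ _  = ℤₚ.+-monoˡ-≤ (- + 1) (χ≤1 (a * y))
    ... | _ | residue x y≉0 x²≈y = ℤₚ.≤-reflexive (cong (_+ + 1) (begin
      χ (a * y)        ≡⟨ χ-respects (c-trans (c-*ˡ a (c-sym x²≈y)) (c-reflexive (ℤₚ.*-comm a (x * x)))) ⟩
      χ (x * x * a)    ≡⟨ χ-square-* x a (λ x≈0 → y≉0 (c-trans (c-sym x²≈y) (c-* x≈0 x≈0))) ⟩
      χ a              ≡⟨ χa ⟩
      - + 1            ∎))
    total : ∑F f ≡ + 0
    total = trans (∑F-+ (λ y → χ (a * y)) χ) (cong₂ _+_ (trans (∑F-scale a χ-respects a≉0) ∑F-χ) ∑F-χ)
    vanish : f y ≡ + 0
    vanish = trans (cong₂ _+_ (χ-respects (c-*ˡ a (rep y))) (χ-respects (rep y)))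
      (∑-≤0-vanish p (λ i _ → f≤0 (+ i)) total (modp p y) (modp-< 0<p y))

  χ-* : ∀ a b → χ (a * b) ≡ χ a * χ b
  χ-* a b with χ a in χa | χ-view a
  ... | _ | divisible a≈0    = χ-0 (c-*ʳ b a≈0)
  ... | _ | residue x a≉0 x²≈a = trans (χ-respects (c-*ʳ b (c-sym x²≈a))) (trans
        (χ-square-* x b (λ x≈0 → a≉0 (c-trans (c-sym x²≈a) (c-* x≈0 x≈0)))) (sym (ℤₚ.*-identityˡ (χ b))))
  ... | _ | nonresidue a≉0 _ = trans (χ-nonresidue-* χa a≉0 b) (sym (ℤₚ.-1*i≡-i (χ b)))

  χ-neg : ∀ a → χ (- a) ≡ χ (- + 1) * χ a
  χ-neg a = trans (cong χ (sym (ℤₚ.-1*i≡-i a))) (χ-* (- + 1) a)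

  -- Gauss's lemma

  ∑S : (ℤ → ℤ) → ℤ
  ∑S f = ∑ n (λ k → f (+ suc k))

  Even : (ℤ → ℤ) → Set
  Even f = ∀ y → f (- y) ≡ f y

  S-<p : ∀ {k} → k < n → suc k < p
  S-<p k<n = ℕₚ.≤-<-trans k<n n<p

  S≉0 : ∀ {k} → k < n → + suc k ≉ + 0
  S≉0 k<n = small≉0 (s≤s z≤n) (S-<p k<n)

  ∑F-even : ∀ {f} → Respects f → Even f → ∑F f ≡ f (+ 0) + + 2 * ∑S f
  ∑F-even {f} resp even = begin
    ∑ p g                                                       ≡⟨ cong (λ m → ∑ m g) p≡1+n+n ⟩
    ∑ (suc (n ℕ.+ n)) g                                         ≡⟨ ∑-first (n ℕ.+ n) g ⟩
    f (+ 0) + ∑ (n ℕ.+ n) (λ k → f (+ suc k))                   ≡⟨ cong (_+_ (f (+ 0))) (∑-split n n (λ k → f (+ suc k))) ⟩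
    f (+ 0) + (∑S f + ∑ n (λ k → f (+ suc (n ℕ.+ k))))          ≡⟨ cong (λ z → f (+ 0) + (∑S f + z)) upper-half ⟩
    f (+ 0) + (∑S f + ∑S f)                                     ≡⟨ cong (_+_ (f (+ 0))) (double (∑S f)) ⟩
    f (+ 0) + + 2 * ∑S f                                        ∎
    where
    g : ℕ → ℤ
    g k = f (+ k)
    double : ∀ x → x + x ≡ + 2 * x
    double = solve-∀
    reflect : ∀ u v p → u + v ≡ p → u ≡ - v + + 1 * p
    reflect u v p refl = solve (u ∷ v ∷ [])
    index : ∀ i j → suc (i ℕ.+ j) ≡ n → suc (n ℕ.+ i) ℕ.+ suc j ≡ p
    index i j eq = begin
      suc (n ℕ.+ i) ℕ.+ suc j       ≡⟨ cong suc (ℕₚ.+-assoc n i (suc j)) ⟩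
      suc (n ℕ.+ (i ℕ.+ suc j))     ≡⟨ cong (λ k → suc (n ℕ.+ k)) (trans (ℕₚ.+-suc i j) eq) ⟩
      suc (n ℕ.+ n)                 ≡⟨ p≡1+n+n ⟨
      p                             ∎
    upper-half : ∑ n (λ k → f (+ suc (n ℕ.+ k))) ≡ ∑S f
    upper-half = ∑-reverse n _ _ (λ i j eq → trans
      (resp (cong-by (+ 1) (reflect (+ suc (n ℕ.+ i)) (+ suc j) (+ p) (cong +_ (index i j eq)))))
      (even (+ suc j)))

  2*-injective : ∀ {x y} → + 2 * x ≡ + 2 * y → x ≡ y
  2*-injective {x} {y} = ℤₚ.*-cancelˡ-≡ (+ 2) x y

  ∑S-half : ∀ {f} → Respects f → Even f → ∑F f - f (+ 0) ≡ + 2 * ∑S f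
  ∑S-half {f} resp even = trans (cong (_- f (+ 0)) (∑F-even resp even)) (drop (f (+ 0)) (∑S f))
    where
    drop : ∀ a b → a + + 2 * b - a ≡ + 2 * b
    drop = solve-∀

  -- For even f the full sum is f 0 plus twice the sum over S, so identities of full sums descend to
  -- S. Permutations of S up to sign are thereby obtained from permutations of the field.
  ∑S-transport : ∀ {f g} → Respects f → Even f → Respects g → Even g →
                 ∑F f ≡ ∑F g → f (+ 0) ≡ g (+ 0) → ∑S f ≡ ∑S g
  ∑S-transport {f} {g} rf ef rg eg total zero≡ = 2*-injective (begin
    + 2 * ∑S f        ≡⟨ ∑S-half rf ef ⟨
    ∑F f - f (+ 0)    ≡⟨ cong₂ _-_ total zero≡ ⟩
    ∑F g - g (+ 0)    ≡⟨ ∑S-half rg eg ⟩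
    + 2 * ∑S g        ∎)

  ∑S-scale : ∀ {f} a → Respects f → Even f → a ≉ + 0 → ∑S (λ s → f (a * s)) ≡ ∑S f
  ∑S-scale {f} a resp even a≉0 = ∑S-transport
    (λ y≈z → resp (c-*ˡ a y≈z)) (λ y → trans (cong f (sym (ℤₚ.neg-distribʳ-* a y))) (even (a * y)))
    resp even (∑F-scale a resp a≉0) (cong f (ℤₚ.*-zeroʳ a))

  inv-respects : ∀ {a b} → a ≈ b → inv a ≈ inv b
  inv-respects {a} {b} a≈b = inv-galois (c-trans (c-sym a≈b) (inv-galois c-refl))

  inv-neg : ∀ a → inv (- a) ≈ - inv a
  inv-neg a with a ≈? + 0
  ... | yes a≈0 = inv-0 (c-neg a≈0)
  ... | no a≉0  = c-sym (inv-unique (- a) _ (c-trans (c-reflexive (neg-*-neg a _)) (proj₂ (inverse a a≉0))))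
    where
    neg-*-neg : ∀ a b → - a * - b ≡ a * b
    neg-*-neg = solve-∀

  ∑S-inv : ∀ {f} → Respects f → Even f → ∑S (λ s → f (inv s)) ≡ ∑S f
  ∑S-inv {f} resp even = ∑S-transport
    (λ y≈z → resp (inv-respects y≈z)) (λ y → trans (resp (inv-neg y)) (even (inv y)))
    resp even (∑F-inv resp) (resp (inv-0 c-refl))

  -- neg a = 1 iff a is congruent to one of -1, …, -n, and abs a ∈ {0, …, n} is the least absolute residue.
  neg : ℤ → ℤ
  neg a = ⟦ n ℕ.<? modp p a ⟧

  abs : ℤ → ℤ
  abs a with n ℕ.<? modp p a
  ... | yes _ = + p - + modp p a
  ... | no _  = + modp p a

  data Signed (a : ℤ) : ℤ → ℤ → Set where
    null     : a ≈ + 0 → Signed a (+ 0) (+ 0)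
    positive : ∀ k → k < n → a ≈ + suc k → Signed a (+ 0) (+ suc k)
    negative : ∀ k → k < n → a ≈ - + suc k → Signed a (+ 1) (+ suc k)

  signed : ∀ a → Signed a (neg a) (abs a)
  signed a with n ℕ.<? modp p a
  ... | yes n<r = subst (Signed a (+ 1)) (sym k≡) (negative k k<n (c-respʳ (c-trans (rep a) p≈) (cong -_ k≡)))
    where
    r = modp p a
    k = ℕ.pred (p ℕ.∸ r)
    r<p : r < p
    r<p = modp-< 0<p a
    suc-k : suc k ≡ p ℕ.∸ r
    suc-k = ℕₚ.suc-pred (p ℕ.∸ r) {{ℕ.>-nonZero (ℕₚ.m<n⇒0<n∸m r<p)}}
    k≡ : + p - + r ≡ + suc k
    k≡ = trans (ℤₚ.m-n≡m⊖n p r) (trans (ℤₚ.⊖-≥ (ℕₚ.<⇒≤ r<p)) (cong +_ (sym suc-k)))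
    k<n : k < n
    k<n = subst (ℕ._≤ n) (sym suc-k) (subst (p ℕ.∸ r ℕ.≤_) (ℕₚ.m+n∸m≡n (suc n) n)
      (subst (λ z → p ℕ.∸ r ℕ.≤ z ℕ.∸ suc n) p≡1+n+n (ℕₚ.∸-monoʳ-≤ p n<r)))
    p≈ : + r ≈ - (+ p - + r)
    p≈ = cong-by (+ 1) (cycle (+ p) (+ r))
      where
      cycle : ∀ p r → r ≡ - (p - r) + + 1 * p
      cycle = solve-∀
  ... | no n≮r with modp p a in eq
  ... | zero  = null (c-respʳ (rep a) (cong +_ eq))
  ... | suc k = positive k (ℕₚ.≮⇒≥ n≮r) (c-respʳ (rep a) (cong +_ eq))

  opposite-≉ : ∀ {j k} → j < n → k < n → + suc j ≉ - + suc k
  opposite-≉ {j} {k} j<n k<n eq = small≉0 {suc j ℕ.+ suc k} (s≤s z≤n)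
    (subst (suc j ℕ.+ suc k <_) (sym p≡1+n+n) (s≤s (ℕₚ.+-mono-≤ j<n k<n)))
    (c-comb₁ (+ 1) (c-diff eq) (sum (+ suc j) (+ suc k)))
    where
    sum : ∀ u v → u + v - + 0 ≡ + 1 * (u - - v)
    sum = solve-∀

  S-injective : ∀ {j k} → j < n → k < n → + suc j ≈ + suc k → j ≡ k
  S-injective j<n k<n eq = ℕₚ.suc-injective (residue-unique (S-<p j<n) (S-<p k<n) eq)

  Signed-unique : ∀ {a b c d e f} → a ≈ b → Signed a c d → Signed b e f → c ≡ e × d ≡ f
  Signed-unique a≈b (null _) (null _) = refl , refl
  Signed-unique a≈b (null a≈0) (positive k k<n b≈) = ⊥-elim (S≉0 k<n (c-trans (c-sym b≈) (c-trans (c-sym a≈b) a≈0)))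
  Signed-unique a≈b (null a≈0) (negative k k<n b≈) = ⊥-elim (S≉0 k<n (c-respˡ (c-neg (c-trans (c-sym b≈) (c-trans (c-sym a≈b) a≈0))) (sym (ℤₚ.neg-involutive _))))
  Signed-unique a≈b (positive j j<n a≈) (null b≈0) = ⊥-elim (S≉0 j<n (c-trans (c-sym a≈) (c-trans a≈b b≈0)))
  Signed-unique a≈b (positive j j<n a≈) (positive k k<n b≈)
    with refl ← S-injective j<n k<n (c-trans (c-sym a≈) (c-trans a≈b b≈)) = refl , refl
  Signed-unique a≈b (positive j j<n a≈) (negative k k<n b≈) = ⊥-elim (opposite-≉ j<n k<n (c-trans (c-sym a≈) (c-trans a≈b b≈)))
  Signed-unique a≈b (negative j j<n a≈) (null b≈0) = ⊥-elim (S≉0 j<n (c-respˡ (c-neg (c-trans (c-sym a≈) (c-trans a≈b b≈0))) (sym (ℤₚ.neg-involutive _))))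
  Signed-unique a≈b (negative j j<n a≈) (positive k k<n b≈) = ⊥-elim (opposite-≉ k<n j<n (c-trans (c-sym b≈) (c-trans (c-sym a≈b) a≈)))
  Signed-unique a≈b (negative j j<n a≈) (negative k k<n b≈)
    with refl ← S-injective j<n k<n (c-respˡ (c-respʳ (c-neg (c-trans (c-sym a≈) (c-trans a≈b b≈))) (ℤₚ.neg-involutive _)) (sym (ℤₚ.neg-involutive _))) = refl , refl

  neg≡ : ∀ {a c d} → Signed a c d → neg a ≡ c
  neg≡ {a} s = proj₁ (Signed-unique c-refl (signed a) s)

  abs≡ : ∀ {a c d} → Signed a c d → abs a ≡ d
  abs≡ {a} s = proj₂ (Signed-unique c-refl (signed a) s)

  neg-respects : Respects neg
  neg-respects {a} {b} a≈b = proj₁ (Signed-unique a≈b (signed a) (signed b))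

  abs-respects : Respects abs
  abs-respects {a} {b} a≈b = proj₂ (Signed-unique a≈b (signed a) (signed b))

  Signed-neg : ∀ {a c d} → a ≉ + 0 → Signed a c d → Signed (- a) (+ 1 - c) d
  Signed-neg a≉0 (null a≈0)            = ⊥-elim (a≉0 a≈0)
  Signed-neg a≉0 (positive k k<n a≈)   = negative k k<n (c-neg a≈)
  Signed-neg a≉0 (negative k k<n a≈)   = positive k k<n (c-respʳ (c-neg a≈) (ℤₚ.neg-involutive _))

  neg-opposite : ∀ {a} → a ≉ + 0 → neg (- a) ≡ + 1 - neg a
  neg-opposite {a} a≉0 = neg≡ (Signed-neg a≉0 (signed a))

  abs-even : Even abs
  abs-even a with a ≈? + 0
  ... | yes a≈0 = trans (abs≡ (null (c-neg a≈0))) (sym (abs≡ (null a≈0)))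
  ... | no a≉0  = abs≡ (Signed-neg a≉0 (signed a))

  abs-S : ∀ {k} → k < n → abs (+ suc k) ≡ + suc k
  abs-S k<n = abs≡ (positive _ k<n c-refl)

  -- The product a b is a |b| or -a |b| according to `neg b`, and a change of sign switches the
  -- halves.
  neg-*-abs : ∀ {a} b → a ≉ + 0 → b ≉ + 0 → neg (a * b) ≈₂ neg b + neg (a * abs b)
  neg-*-abs {a} b a≉0 b≉0 with neg b | abs b | signed b
  ... | _ | _ | null b≈0          = ⊥-elim (b≉0 b≈0)
  ... | _ | _ | positive k k<n b≈ = c-reflexive (trans (neg-respects (c-*ˡ a b≈)) (sym (ℤₚ.+-identityˡ (neg (a * + suc k)))))
  ... | _ | _ | negative k k<n b≈ = c-respˡ (cong-by (- neg (a * + suc k)) (parity (neg (a * + suc k)))) (begin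
      neg (a * b)                ≡⟨ neg-respects (c-*ˡ a b≈) ⟩
      neg (a * - + suc k)        ≡⟨ cong neg (ℤₚ.neg-distribʳ-* a (+ suc k)) ⟨
      neg (- (a * + suc k))      ≡⟨ neg-opposite (domain-≉ a≉0 (S≉0 k<n)) ⟩
      + 1 - neg (a * + suc k)    ∎)
      where
      parity : ∀ x → + 1 - x ≡ + 1 + x + - x * + 2
      parity = solve-∀

  q b : ℤ → ℤ
  q a = is1 (χ a)
  b a = is-1 (χ a)

  q-respects : Respects q
  q-respects = cong is1 ∘ χ-respects

  b-respects : Respects b
  b-respects = cong is-1 ∘ χ-respects

  χ-unit : ∀ {a} → a ≉ + 0 → ±1 (χ a)
  χ-unit {a} a≉0 with χ a | χ-view a
  ... | _ | divisible a≈0  = ⊥-elim (a≉0 a≈0)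
  ... | _ | residue _ _ _  = +one
  ... | _ | nonresidue _ _ = -one

  -1≉0 : - + 1 ≉ + 0
  -1≉0 h = 1≉0 (c-neg h)

  b-0 : ∀ {a} → a ≈ + 0 → b a ≡ + 0
  b-0 a≈0 = cong is-1 (χ-0 a≈0)

  b-* : ∀ a c → a ≉ + 0 → c ≉ + 0 → b (a * c) ≈₂ b a + b c
  b-* a c a≉0 c≉0 = c-respˡ (cases (χ-unit a≉0) (χ-unit c≉0)) (cong is-1 (χ-* a c))
    where
    cases : ∀ {x y} → ±1 x → ±1 y → is-1 (x * y) ≈₂ is-1 x + is-1 y
    cases +one +one = c-refl
    cases +one -one = c-refl
    cases -one +one = c-refl
    cases -one -one = cong-by (- + 1) refl

  ∑S-square-roots : ∀ {c} → c ≉ + 0 → ∑S (λ s → ⟦ s * s ≈? c ⟧) ≡ q c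
  ∑S-square-roots {c} c≉0 = 2*-injective (begin
    + 2 * ∑S f              ≡⟨ ∑S-half f-respects (λ y → cong (λ z → ⟦ z ≈? c ⟧) (neg-square y)) ⟨
    ∑F f - f (+ 0)          ≡⟨ cong₂ _-_ (count-roots c) (⟦⟧-no (+ 0 ≈? c) (c≉0 ∘ c-sym)) ⟩
    + 1 + χ c - + 0         ≡⟨ cases (χ-unit c≉0) ⟩
    + 2 * q c               ∎)
    where
    f : ℤ → ℤ
    f s = ⟦ s * s ≈? c ⟧
    f-respects : Respects f
    f-respects y≈z = ≈?-respects (c-* y≈z y≈z) c-refl
    neg-square : ∀ y → - y * - y ≡ y * y
    neg-square = solve-∀
    cases : ∀ {x} → ±1 x → + 1 + x - + 0 ≡ + 2 * is1 x
    cases +one = refl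
    cases -one = refl

  ∑S-⟦≈-⟧ : ∀ {a} → a ≉ + 0 → ∑S (λ t → ⟦ t ≈? - a ⟧) ≡ neg a
  ∑S-⟦≈-⟧ {a} a≉0 with neg a | abs a | signed a
  ... | _ | _ | null a≈0 = ⊥-elim (a≉0 a≈0)
  ... | _ | _ | positive k k<n a≈ = ∑-zero n (λ t t<n → ⟦⟧-no (+ suc t ≈? - a)
      (λ t≈ → opposite-≉ t<n k<n (c-trans t≈ (c-neg a≈))))
  ... | _ | _ | negative k k<n a≈ = trans
      (∑-single n k k<n (λ t t<n t≢k → ⟦⟧-no (+ suc t ≈? - a) (λ t≈ → t≢k (S-injective t<n k<n (c-trans t≈ -a≈)))))
      (⟦⟧-yes (+ suc k ≈? - a) (c-sym -a≈))
    where
    -a≈ : - a ≈ + suc k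
    -a≈ = c-respʳ (c-neg a≈) (ℤₚ.neg-involutive (+ suc k))

  -- For s ∈ S, a t ∈ S with s t = -a exists exactly when a/s lies in the negative half. The
  -- relation s t = -a is symmetric, and its diagonal consists of the square roots of -a in S.
  ∑S-neg-quotients : ∀ {a} → a ≉ + 0 → ∑S (λ s → neg (a * inv s)) ≈₂ q (- a)
  ∑S-neg-quotients {a} a≉0 = c-respˡ
    (c-respʳ (∑-symmetric n G (λ i j → cong (λ z → ⟦ z ≈? - a ⟧) (ℤₚ.*-comm (+ suc i) (+ suc j))))
             (∑S-square-roots (λ h → a≉0 (c-respˡ (c-neg h) (sym (ℤₚ.neg-involutive a))))))
    (∑-cong n (λ i i<n → sym (row i i<n)))
    where
    G : ℕ → ℕ → ℤ
    G i j = ⟦ + suc i * + suc j ≈? - a ⟧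
    divide : ∀ s t v a → t - - (a * v) ≡ v * (s * t - - a) + - t * (s * v - + 1)
    divide = solve-∀
    multiply : ∀ s t v a → s * t - - a ≡ s * (t - - (a * v)) + - a * (s * v - + 1)
    multiply = solve-∀
    row : ∀ i → i < n → ∑ n (G i) ≡ neg (a * inv (+ suc i))
    row i i<n = trans (∑-cong n (λ j _ → ⟦⟧-⇔ (s * + suc j ≈? - a) (+ suc j ≈? - (a * v))
        (λ h → c-comb₂ v (- + suc j) (c-diff h) sv (divide s (+ suc j) v a))
        (λ h → c-comb₂ s (- a) (c-diff h) sv (multiply s (+ suc j) v a))))
      (∑S-⟦≈-⟧ (domain-≉ a≉0 (inv-≉0 (S≉0 i<n))))
      where
      s = + suc i
      v = inv s
      sv : s * v - + 1 ≈ + 0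
      sv = c-diff (inv-*ʳ (S≉0 i<n))

  -- By symmetry the number of (s, t) ∈ S × S with s t = - a has the parity of #{s ∈ S : s² = - a}, and it
  -- also counts the s with a/s in the negative half, where the sign of a/s is the product of the signs
  -- of 1/s and a |1/s|.
  gauss : ∀ {a} → a ≉ + 0 → ∑S (λ s → neg (a * s)) ≈₂ b a
  -- The signs of the 1/s are themselves the count for a = 1; subtracting it leaves μ ≡ q(-a) -
  -- q(-1).
  gauss {a} a≉0 = c-trans (c-comb₂ (+ 1) (- + 1) (c-diff quotients) (c-diff units) (difference μ (∑S (neg ∘ inv)) (q (- a)) (q (- + 1))))
                          (c-respˡ (cases (χ-unit a≉0) (χ-unit -1≉0)) (cong (λ z → is1 z - is1 (χ (- + 1))) (χ-neg a)))
    where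
    μ = ∑S (λ s → neg (a * s))
    units : ∑S (neg ∘ inv) ≈₂ q (- + 1)
    units = c-respˡ (∑S-neg-quotients 1≉0) (∑-cong n (λ i _ → cong neg (sym (ℤₚ.*-identityˡ (inv (+ suc i))))))
    shuffle : ∑S (λ s → neg (a * abs (inv s))) ≡ μ
    shuffle = trans (∑S-inv {λ y → neg (a * abs y)} (λ y≈z → cong (λ z → neg (a * z)) (abs-respects y≈z))
                            (λ y → cong (λ z → neg (a * z)) (abs-even y)))
                    (∑-cong n (λ i i<n → cong (λ z → neg (a * z)) (abs-S i<n)))
    quotients : ∑S (neg ∘ inv) + μ ≈₂ q (- a)
    quotients = c-trans (c-sym (c-respʳ (∑-cong-mod n (λ i i<n → neg-*-abs (inv (+ suc i)) a≉0 (inv-≉0 (S≉0 i<n))))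
                          (trans (∑-+ n (λ i → neg (inv (+ suc i))) (λ i → neg (a * abs (inv (+ suc i)))))
                                 (cong (_+_ (∑S (neg ∘ inv))) shuffle))))
                        (∑S-neg-quotients a≉0)
    difference : ∀ m u x y → m - (x - y) ≡ + 1 * (u + m - x) + - + 1 * (u - y)
    difference = solve-∀
    cases : ∀ {x ε} → ±1 x → ±1 ε → is1 (ε * x) - is1 ε ≈₂ is-1 x
    cases +one +one = c-refl
    cases +one -one = c-refl
    cases -one +one = cong-by (- + 1) refl
    cases -one -one = c-refl

  b-minus-one : b (- + 1) ≈₂ + n
  b-minus-one = c-trans (c-sym (gauss -1≉0)) (c-reflexive (trans
    (∑-cong n (λ i i<n → neg≡ (negative i i<n (c-reflexive (ℤₚ.-1*i≡-i (+ suc i))))))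
    (trans (∑-const n (+ 1)) (ℤₚ.*-identityʳ (+ n)))))

  pos-∸ : ∀ {u v} → v ℕ.≤ u → + u - + v ≡ + (u ℕ.∸ v)
  pos-∸ {u} {v} v≤u = trans (ℤₚ.m-n≡m⊖n u v) (ℤₚ.⊖-≥ v≤u)

  -- A difference of two members of S never wraps around p, so it keeps its sign, and its least
  -- absolute residue keeps its parity.
  difference-signed : ∀ {i m} → i < n → m < n → i ≢ m → ∃ λ d →
    Signed (+ suc i - + suc m) (+ 1 - ⟦ m ℕ.<? i ⟧) d × d ≈₂ + suc i - + suc m
  difference-signed {i} {m} i<n m<n i≢m with m ℕ.<? i
  ... | yes m<i = d , positive k k<n (c-reflexive d≡) , c-reflexive (sym d≡)
    where
    k = i ℕ.∸ suc m
    d = + suc k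
    suc-k : suc k ≡ suc i ℕ.∸ suc m
    suc-k = sym (ℕₚ.+-∸-assoc 1 m<i)
    d≡ : + suc i - + suc m ≡ d
    d≡ = trans (pos-∸ (s≤s (ℕₚ.<⇒≤ m<i))) (cong +_ (sym suc-k))
    k<n : k < n
    k<n = ℕₚ.≤-<-trans (ℕₚ.m∸n≤m i (suc m)) i<n
  ... | no m≮i = d , negative k k<n (c-reflexive (trans (flip (+ suc i) (+ suc m)) (cong -_ d≡)))
               , c-respˡ (cong-by (+ suc m - + suc i) (parity (+ suc i) (+ suc m))) (sym d≡)
    where
    i<m : i < m
    i<m = ℕₚ.≤∧≢⇒< (ℕₚ.≮⇒≥ m≮i) i≢m
    k = m ℕ.∸ suc i
    d = + suc k
    d≡ : + suc m - + suc i ≡ d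
    d≡ = trans (pos-∸ (s≤s (ℕₚ.<⇒≤ i<m))) (cong +_ (ℕₚ.+-∸-assoc 1 i<m))
    k<n : k < n
    k<n = ℕₚ.≤-<-trans (ℕₚ.m∸n≤m m (suc i)) m<n
    flip : ∀ u v → u - v ≡ - (v - u)
    flip = solve-∀
    parity : ∀ u v → v - u ≡ u - v + (v - u) * + 2
    parity = solve-∀

  -- A sum beyond n is replaced by p minus it. As p is odd, this wrap, recorded by c, changes the
  -- parity of the least absolute residue.
  sum-signed : ∀ {i m} → i < n → m < n → ∃ λ c → ∃ λ d →
    Signed (+ suc i + + suc m) c d × d ≈₂ + suc i + + suc m + c
  sum-signed {i} {m} i<n m<n with suc i ℕ.+ suc m ℕ.≤? n
  ... | yes ≤n = + 0 , + (suc i ℕ.+ suc m) , positive _ ≤n c-refl , c-reflexive (sym (ℤₚ.+-identityʳ _))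
  ... | no ≰n = + 1 , d , negative k k<n (cong-by (+ 1) (wrap u (+ p) d d≡)) , even-p
    where
    t = suc i ℕ.+ suc m
    u = + suc i + + suc m
    k = n ℕ.+ n ℕ.∸ t
    d = + suc k
    t≤2n : t ℕ.≤ n ℕ.+ n
    t≤2n = ℕₚ.+-mono-≤ i<n m<n
    d≡ : d ≡ + p - u
    d≡ = trans (cong +_ (sym (ℕₚ.+-∸-assoc 1 t≤2n)))
           (trans (sym (pos-∸ (ℕₚ.m≤n⇒m≤1+n t≤2n))) (cong (λ z → + z - u) (sym p≡1+n+n)))
    k<n : k < n
    k<n = subst (suc k ℕ.≤_) (ℕₚ.m+n∸n≡m n n)
      (subst (ℕ._≤ n ℕ.+ n ℕ.∸ n) (ℕₚ.+-∸-assoc 1 t≤2n) (ℕₚ.∸-monoʳ-≤ (suc (n ℕ.+ n)) (ℕₚ.≰⇒> ≰n)))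
    wrap : ∀ u p d → d ≡ p - u → u ≡ - d + + 1 * p
    wrap u p _ refl = solve (u ∷ p ∷ [])
    even-p : d ≈₂ u + + 1
    even-p = c-respˡ (cong-by (+ n - u) (parity (+ n) u)) (trans d≡ (cong (λ z → + z - u) p≡1+n+n))
      where
      parity : ∀ n u → + 1 + (n + n) - u ≡ u + + 1 + (n - u) * + 2
      parity = solve-∀

  -- The product over half of the residues

  -- If |x j| = e then (1 - x) j and (1 + x) j are j - e and j + e in some order.  By Gauss's lemma the
  -- symbol of 1 - x² is thus governed by the j with e > j and those with j + e > n; the number of the latter
  -- is even, because the least absolute residues of (1 ± x) j add up to 2 (1 + … + n).
  descents : ℤ → ℤ
  descents x = ∑S (λ j → ⟦ abs (x * j) ℤₚ.<? j ⟧)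

  split-at : ∀ {h} x j e → Respects h → x * j ≈ e → h ((+ 1 - x) * j) + h ((+ 1 + x) * j) ≡ h (j - e) + h (j + e)
  split-at x j e resp xj≈e = cong₂ _+_
    (resp (c-comb₁ (- + 1) (c-diff xj≈e) (minus x j e))) (resp (c-comb₁ (+ 1) (c-diff xj≈e) (plus x j e)))
    where
    minus : ∀ x j e → (+ 1 - x) * j - (j - e) ≡ - + 1 * (x * j - e)
    minus = solve-∀
    plus : ∀ x j e → (+ 1 + x) * j - (j + e) ≡ + 1 * (x * j - e)
    plus = solve-∀

  -- For x j ≡ -e the two terms merely trade places, so their sum sees only e = |x j|.
  split-signs : ∀ {h} x j → Respects h → h ((+ 1 - x) * j) + h ((+ 1 + x) * j) ≡ h (j - abs (x * j)) + h (j + abs (x * j))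
  split-signs {h} x j resp with neg (x * j) | abs (x * j) | signed (x * j)
  ... | _ | _ | null xj≈         = split-at x j (+ 0) resp xj≈
  ... | _ | _ | positive k _ xj≈ = split-at x j (+ suc k) resp xj≈
  ... | _ | _ | negative k _ xj≈ = trans (split-at x j (- + suc k) resp xj≈) (ℤₚ.+-comm (h (j - - + suc k)) (h (j - + suc k)))

  module _ (x : ℤ) (x≉0 : x ≉ + 0) (x≉1 : x ≉ + 1) (x≉-1 : x ≉ - + 1) where

    private
      1-x≉0 : + 1 - x ≉ + 0
      1-x≉0 h = x≉1 (c-sym (c-undiff h))

      1+x≉0 : + 1 + x ≉ + 0
      1+x≉0 h = x≉-1 (c-comb₁ (+ 1) h (shift x))
        where
        shift : ∀ x → x - - + 1 ≡ + 1 * (+ 1 + x)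
        shift = solve-∀

      overflow : ℤ → ℤ
      overflow j = neg (j + abs (x * j))

      residue-pair : ∀ i → i < n → ∃ λ m → m < n × i ≢ m × abs (x * + suc i) ≡ + suc m
      residue-pair i i<n with neg (x * + suc i) | abs (x * + suc i) | signed (x * + suc i)
      ... | _ | _ | null h = ⊥-elim (domain-≉ x≉0 (S≉0 i<n) h)
      ... | _ | _ | positive m m<n h = m , m<n , i≢m , refl
        where
        i≢m : i ≢ m
        i≢m refl = x≉1 (cancel (+ suc i) x (+ 1) (S≉0 i<n) (c-respˡ (c-respʳ h (sym (ℤₚ.*-identityʳ _))) (ℤₚ.*-comm (+ suc i) x)))
      ... | _ | _ | negative m m<n h = m , m<n , i≢m , refl
        where
        neg-one : ∀ j → - j ≡ j * - + 1
        neg-one = solve-∀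
        i≢m : i ≢ m
        i≢m refl = x≉-1 (cancel (+ suc i) x (- + 1) (S≉0 i<n) (c-respˡ (c-respʳ h (neg-one (+ suc i))) (ℤₚ.*-comm (+ suc i) x)))

      neg-terms : ∀ i → i < n → let j = + suc i in
        neg ((+ 1 - x) * j) + neg ((+ 1 + x) * j) ≡ + 1 - ⟦ abs (x * j) ℤₚ.<? j ⟧ + overflow j
      neg-terms i i<n = trans (split-signs x j neg-respects) (cong (_+ overflow j) (begin
          neg (j - abs (x * j))           ≡⟨ cong (λ e → neg (j - e)) e≡ ⟩
          neg (j - + suc m)               ≡⟨ neg≡ (proj₁ (proj₂ (difference-signed i<n m<n i≢m))) ⟩
          + 1 - ⟦ m ℕ.<? i ⟧              ≡⟨ cong (λ z → + 1 - z) (⟦⟧-⇔ (m ℕ.<? i) (+ suc m ℤₚ.<? j)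
                                               (λ m<i → ℤ.+<+ (s≤s m<i)) (λ { (ℤ.+<+ (s≤s m<i)) → m<i })) ⟩
          + 1 - ⟦ + suc m ℤₚ.<? j ⟧       ≡⟨ cong (λ e → + 1 - ⟦ e ℤₚ.<? j ⟧) e≡ ⟨
          + 1 - ⟦ abs (x * j) ℤₚ.<? j ⟧   ∎))
        where
        j = + suc i
        m = proj₁ (residue-pair i i<n)
        m<n = proj₁ (proj₂ (residue-pair i i<n))
        i≢m = proj₁ (proj₂ (proj₂ (residue-pair i i<n)))
        e≡ = proj₂ (proj₂ (proj₂ (residue-pair i i<n)))

      -- With e = |x j| the numbers j - e and j + e have even sum; modulo 2 only the wrap of j + e
      -- past n is left.
      abs-terms : ∀ i → i < n → let j = + suc i in
        abs ((+ 1 - x) * j) + abs ((+ 1 + x) * j) ≈₂ overflow j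
      abs-terms i i<n with residue-pair i i<n
      ... | m , m<n , i≢m , e≡ with difference-signed i<n m<n i≢m | sum-signed i<n m<n
      ... | d , s , d≈ | c , d′ , s′ , d′≈ = c-respˡ (c-respʳ
        (c-trans (c-+ d≈ d′≈) (cong-by (+ suc i) (parity (+ suc i) (+ suc m) c)))
        (trans (sym (neg≡ s′)) (cong (λ e → neg (+ suc i + e)) (sym e≡))))
        (trans (split-signs x (+ suc i) abs-respects) (cong₂ _+_
          (trans (cong (λ e → abs (+ suc i - e)) e≡) (abs≡ s))
          (trans (cong (λ e → abs (+ suc i + e)) e≡) (abs≡ s′))))
        where
        parity : ∀ j e c → j - e + (j + e + c) ≡ c + j * + 2
        parity = solve-∀

      overflow-even : ∑S overflow ≈₂ + 0
      overflow-even = c-trans (c-sym (∑-cong-mod n abs-terms)) (cong-by (∑S abs) (begin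
        ∑ n (λ i → abs ((+ 1 - x) * + suc i) + abs ((+ 1 + x) * + suc i))  ≡⟨ ∑-+ n _ _ ⟩
        ∑S (λ j → abs ((+ 1 - x) * j)) + ∑S (λ j → abs ((+ 1 + x) * j))
          ≡⟨ cong₂ _+_ (∑S-scale (+ 1 - x) abs-respects abs-even 1-x≉0) (∑S-scale (+ 1 + x) abs-respects abs-even 1+x≉0) ⟩
        ∑S abs + ∑S abs                                                   ≡⟨ double (∑S abs) ⟩
        + 0 + ∑S abs * + 2                                                ∎))
        where
        double : ∀ a → a + a ≡ + 0 + a * + 2
        double = solve-∀

    descents-parity : descents x ≈₂ b (x * x - + 1)
    -- The descents and the other j together number n, which has the parity of `b (- + 1)`. The
    -- three contributions belong to the factors -1, 1 - x and 1 + x of x² - 1.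
    descents-parity = c-trans (cong-by (descents x - + n) (complement (descents x) (+ n)))
      (c-trans (c-+ (c-sym b-minus-one) (c-sym ascents))
      (c-sym (c-respˡ (c-trans (b-* (- + 1) ((+ 1 - x) * (+ 1 + x)) -1≉0 (domain-≉ 1-x≉0 1+x≉0))
                               (c-+ (c-refl {a = b (- + 1)}) (b-* (+ 1 - x) (+ 1 + x) 1-x≉0 1+x≉0)))
                      (cong b (factor x)))))
      where
      complement : ∀ d n → d ≡ n + (n - d) + (d - n) * + 2
      complement = solve-∀
      factor : ∀ x → x * x - + 1 ≡ - + 1 * ((+ 1 - x) * (+ 1 + x))
      factor = solve-∀
      is-descent : ℕ → ℤ
      is-descent i = ⟦ abs (x * + suc i) ℤₚ.<? + suc i ⟧
      count : ∑S (λ j → neg ((+ 1 - x) * j)) + ∑S (λ j → neg ((+ 1 + x) * j)) ≡ + n - descents x + ∑S overflow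
      count = begin
        ∑S (λ j → neg ((+ 1 - x) * j)) + ∑S (λ j → neg ((+ 1 + x) * j))  ≡⟨ ∑-+ n _ _ ⟨
        ∑S (λ j → neg ((+ 1 - x) * j) + neg ((+ 1 + x) * j))             ≡⟨ ∑-cong n neg-terms ⟩
        ∑ n (λ i → + 1 - is-descent i + overflow (+ suc i))              ≡⟨ ∑-+ n (λ i → + 1 - is-descent i) (λ i → overflow (+ suc i)) ⟩
        ∑ n (λ i → + 1 - is-descent i) + ∑S overflow                     ≡⟨ cong (_+ ∑S overflow) (∑-+ n (λ _ → + 1) (λ i → - is-descent i)) ⟩
        ∑ n (λ _ → + 1) + ∑ n (λ i → - is-descent i) + ∑S overflow
          ≡⟨ cong (_+ ∑S overflow) (cong₂ _+_ (trans (∑-const n (+ 1)) (ℤₚ.*-identityʳ (+ n))) (∑-neg n is-descent)) ⟩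
        + n - descents x + ∑S overflow                                   ∎
      ascents : b (+ 1 - x) + b (+ 1 + x) ≈₂ + n - descents x
      ascents = c-trans (c-sym (c-+ (gauss 1-x≉0) (gauss 1+x≉0)))
        (c-respˡ (c-respʳ (c-+ (c-refl {a = + n - descents x}) overflow-even) (ℤₚ.+-identityʳ _)) count)

  descents-one : descents (+ 1) ≡ + 0
  descents-one = ∑-zero n (λ i i<n → ⟦⟧-no (abs (+ 1 * + suc i) ℤₚ.<? + suc i)
    (ℤₚ.<-irrefl (trans (cong abs (ℤₚ.*-identityˡ (+ suc i))) (abs-S i<n))))

  half-triangle : ∀ a → ∑S (λ j → ∑S (λ i → ⟦ i ℤₚ.<? j ⟧ * b (a * i * i - j * j)))
                     ≈₂ ∑S (λ x → b (a * x * x - + 1) * b (x * x - + 1))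
  half-triangle a = c-respˡ (∑-cong-mod n column) (begin
    ∑S (λ j → ∑S (λ i → ⟦ i ℤₚ.<? j ⟧ * b (a * i * i - j * j)))          ≡⟨ ∑-cong n (λ k k<n → row k k<n) ⟩
    ∑S (λ j → ∑S (λ x → w x * ⟦ abs (x * j) ℤₚ.<? j ⟧))                  ≡⟨ ∑-swap n n _ ⟩
    ∑S (λ x → ∑S (λ j → w x * ⟦ abs (x * j) ℤₚ.<? j ⟧))                  ≡⟨ ∑-cong n (λ k _ → ∑-* n (w (+ suc k)) _) ⟩
    ∑S (λ x → w x * descents x)                                          ∎)
    where
    w : ℤ → ℤ
    w x = b (a * x * x - + 1)
    row : ∀ k → k < n → let j = + suc k in
      ∑S (λ i → ⟦ i ℤₚ.<? j ⟧ * b (a * i * i - j * j)) ≡ ∑S (λ x → w x * ⟦ abs (x * j) ℤₚ.<? j ⟧)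
    row k k<n = begin
      -- Replacing i by |i|, which changes nothing on S, makes the summand even, so that `∑S-scale`
      -- applies.
      ∑S (λ i → ⟦ i ℤₚ.<? j ⟧ * b (a * i * i - j * j))   ≡⟨ ∑-cong n (λ i i<n → cong (λ z → ⟦ z ℤₚ.<? j ⟧ * b (a * + suc i * + suc i - j * j)) (abs-S i<n)) ⟨
      ∑S H                                               ≡⟨ ∑S-scale j H-respects H-even (S≉0 k<n) ⟨
      ∑S (λ x → H (j * x))                               ≡⟨ ∑-cong n (λ i _ → rescale (+ suc i)) ⟩
      ∑S (λ x → w x * ⟦ abs (x * j) ℤₚ.<? j ⟧)           ∎
      where
      j = + suc k
      H : ℤ → ℤ
      H y = ⟦ abs y ℤₚ.<? j ⟧ * b (a * y * y - j * j)
      H-respects : Respects H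
      H-respects y≈z = cong₂ _*_ (cong (λ e → ⟦ e ℤₚ.<? j ⟧) (abs-respects y≈z))
        (b-respects (c-- (c-* (c-*ˡ a y≈z) y≈z) c-refl))
      neg-square : ∀ a y → a * - y * - y ≡ a * y * y
      neg-square = solve-∀
      H-even : Even H
      H-even y = cong₂ _*_ (cong (λ e → ⟦ e ℤₚ.<? j ⟧) (abs-even y)) (cong (λ z → b (z - j * j)) (neg-square a y))
      homogeneous : ∀ a j x → a * (j * x) * (j * x) - j * j ≡ j * j * (a * x * x - + 1)
      homogeneous = solve-∀
      rescale : ∀ x → H (j * x) ≡ w x * ⟦ abs (x * j) ℤₚ.<? j ⟧
      rescale x = trans (cong₂ _*_ (cong (λ z → ⟦ abs z ℤₚ.<? j ⟧) (ℤₚ.*-comm j x))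
        (trans (cong b (homogeneous a j x)) (cong is-1 (χ-square-* j (a * x * x - + 1) (S≉0 k<n)))))
        (ℤₚ.*-comm ⟦ abs (x * j) ℤₚ.<? j ⟧ (w x))
    column : ∀ k → k < n → let x = + suc k in w x * descents x ≈₂ w x * b (x * x - + 1)
    -- The value x = 1 is outside `descents-parity`, but both sides vanish there: |j| < j fails for
    -- every j ∈ S, and x² - 1 = 0.
    column zero    _   = c-*ˡ (w (+ 1)) (c-respˡ (c-reflexive (sym (b-0 c-refl))) descents-one)
    column (suc k) k<n = c-*ˡ (w (+ suc (suc k))) (descents-parity (+ suc (suc k)) (S≉0 k<n)
      (λ h → ℕₚ.1+n≢0 (S-injective k<n 0<n h)) (opposite-≉ k<n 0<n))

  -- Reduction to the count `N`, and linear and quadratic character sums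

  ∑F-two : ∀ {f} r s → Respects f → r ≉ s → (∀ y → y ≉ r → y ≉ s → f y ≡ + 0) → ∑F f ≡ f r + f s
  ∑F-two {f} r s resp r≉s vanish = begin
    ∑F f                                                    ≡⟨ ∑F-cong split ⟩
    ∑F (λ y → ⟦ y ≈? r ⟧ * f y + ⟦ y ≈? s ⟧ * f y)          ≡⟨ ∑F-+ (λ y → ⟦ y ≈? r ⟧ * f y) (λ y → ⟦ y ≈? s ⟧ * f y) ⟩
    ∑F (λ y → ⟦ y ≈? r ⟧ * f y) + ∑F (λ y → ⟦ y ≈? s ⟧ * f y)  ≡⟨ cong₂ _+_ (∑F-δ r resp) (∑F-δ s resp) ⟩
    f r + f s                                               ∎
    where
    one-zero : ∀ z → z ≡ + 1 * z + + 0 * z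
    one-zero = solve-∀
    zero-one : ∀ z → z ≡ + 0 * z + + 1 * z
    zero-one = solve-∀
    split : ∀ y → f y ≡ ⟦ y ≈? r ⟧ * f y + ⟦ y ≈? s ⟧ * f y
    split y with y ≈? r | y ≈? s
    ... | yes y≈r | yes y≈s = ⊥-elim (r≉s (c-trans (c-sym y≈r) y≈s))
    ... | yes _   | no _    = one-zero (f y)
    ... | no _    | yes _   = zero-one (f y)
    ... | no y≉r  | no y≉s  = vanish y y≉r y≉s

  ∑F-three : ∀ {f} r s t → Respects f → r ≉ s → r ≉ t → s ≉ t →
             (∀ y → y ≉ r → y ≉ s → y ≉ t → f y ≡ + 0) → ∑F f ≡ f r + f s + f t
  ∑F-three {f} r s t resp r≉s r≉t s≉t vanish = begin
    ∑F f                                                       ≡⟨ ∑F-cong split ⟩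
    ∑F (λ y → f′ y + ⟦ y ≈? t ⟧ * f y)                         ≡⟨ ∑F-+ f′ (λ y → ⟦ y ≈? t ⟧ * f y) ⟩
    ∑F f′ + ∑F (λ y → ⟦ y ≈? t ⟧ * f y)                        ≡⟨ cong₂ _+_ (∑F-two r s f′-respects r≉s f′-vanish) (∑F-δ t resp) ⟩
    f′ r + f′ s + f t                                          ≡⟨ cong (_+ f t) (cong₂ _+_ (off r≉t) (off s≉t)) ⟩
    f r + f s + f t                                            ∎
    where
    f′ : ℤ → ℤ
    f′ y = f y - ⟦ y ≈? t ⟧ * f y
    f′-respects : Respects f′
    f′-respects y≈z = cong₂ _-_ (resp y≈z) (cong₂ _*_ (≈?-respects y≈z c-refl) (resp y≈z))
    split : ∀ y → f y ≡ f′ y + ⟦ y ≈? t ⟧ * f y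
    split y = add-back (f y) (⟦ y ≈? t ⟧ * f y)
      where
      add-back : ∀ u v → u ≡ u - v + v
      add-back = solve-∀
    off : ∀ {y} → y ≉ t → f′ y ≡ f y
    off {y} y≉t = trans (cong (λ z → f y - z * f y) (⟦⟧-no (y ≈? t) y≉t)) (ℤₚ.+-identityʳ (f y))
    f′-vanish : ∀ y → y ≉ r → y ≉ s → f′ y ≡ + 0
    f′-vanish y y≉r y≉s with y ≈? t
    ... | yes _  = self-cancel (f y)
      where
      self-cancel : ∀ z → z - + 1 * z ≡ + 0
      self-cancel = solve-∀
    ... | no y≉t = trans (ℤₚ.+-identityʳ (f y)) (vanish y y≉r y≉s y≉t)

  -- Squaring maps S bijectively onto the nonzero squares.
  ∑S-squares : ∀ {f} → Respects f → ∑S (λ x → f (x * x)) ≡ ∑F (λ y → q y * f y)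
  ∑S-squares {f} resp = 2*-injective (begin
    + 2 * ∑S (λ x → f (x * x))                              ≡⟨ ∑S-half (λ y≈z → resp (c-* y≈z y≈z)) (λ y → cong f (neg-square y)) ⟨
    ∑F (λ x → f (x * x)) - f (+ 0)                          ≡⟨ cong (_- f (+ 0)) (∑F-squares resp) ⟩
    ∑F (λ y → (+ 1 + χ y) * f y) - f (+ 0)                  ≡⟨ cong (_- f (+ 0)) (trans (∑F-cong split)
                                                                 (∑F-+ (λ y → ⟦ y ≈? + 0 ⟧ * f y) (λ y → + 2 * (q y * f y)))) ⟩
    ∑F (λ y → ⟦ y ≈? + 0 ⟧ * f y) + ∑F (λ y → + 2 * (q y * f y)) - f (+ 0)
      ≡⟨ cong (_- f (+ 0)) (cong₂ _+_ (∑F-δ (+ 0) resp) (∑F-* (+ 2) (λ y → q y * f y))) ⟩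
    f (+ 0) + + 2 * ∑F (λ y → q y * f y) - f (+ 0)          ≡⟨ drop (f (+ 0)) (∑F (λ y → q y * f y)) ⟩
    + 2 * ∑F (λ y → q y * f y)                              ∎)
    where
    neg-square : ∀ y → - y * - y ≡ y * y
    neg-square = solve-∀
    drop : ∀ u v → u + + 2 * v - u ≡ + 2 * v
    drop = solve-∀
    at-zero : ∀ z → (+ 1 + + 0) * z ≡ + 1 * z + + 2 * (+ 0 * z)
    at-zero = solve-∀
    at-one : ∀ z → (+ 1 + + 1) * z ≡ + 0 * z + + 2 * (+ 1 * z)
    at-one = solve-∀
    split : ∀ y → (+ 1 + χ y) * f y ≡ ⟦ y ≈? + 0 ⟧ * f y + + 2 * (q y * f y)
    split y with y ≈? + 0
    ... | yes y≈0 rewrite χ-0 y≈0 = at-zero (f y)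
    ... | no y≉0 with χ y | χ-unit y≉0
    ... | _ | +one = at-one (f y)
    ... | _ | -one = refl

  bb : ℤ → ℤ → ℤ
  bb a y = b (a * y - + 1) * b (y - + 1)

  -- The indicator of the set counted by `N`; a stands for s², or for 1/s² after passing to the
  -- reciprocal.
  g : ℤ → ℤ → ℤ
  g a y = q y * bb a y

  N : ℤ → ℤ
  N a = ∑F (g a)

  bb-respects : ∀ a → Respects (bb a)
  bb-respects a y≈z = cong₂ _*_ (b-respects (c-- (c-*ˡ a y≈z) c-refl)) (b-respects (c-- y≈z c-refl))

  g-respects : ∀ a → Respects (g a)
  g-respects a y≈z = cong₂ _*_ (q-respects y≈z) (bb-respects a y≈z)

  half-triangle-N : ∀ a → ∑S (λ j → ∑S (λ i → ⟦ i ℤₚ.<? j ⟧ * b (a * i * i - j * j))) ≈₂ N a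
  half-triangle-N a = c-respʳ (half-triangle a) (trans
    (∑-cong n (λ i _ → cong (λ z → b (z - + 1) * b (+ suc i * + suc i - + 1)) (ℤₚ.*-assoc a (+ suc i) (+ suc i))))
    (∑S-squares (bb-respects a)))

  ∑F-χ-affine : ∀ a c → a ≉ + 0 → ∑F (λ y → χ (a * y + c)) ≡ + 0
  ∑F-χ-affine a c a≉0 = trans (∑F-scale {λ y → χ (y + c)} a (λ y≈z → χ-respects (c-+ y≈z c-refl)) a≉0)
    (trans (∑F-translate {χ} c χ-respects) ∑F-χ)

  -- For y ≠ 0 one has y(ay + c) = y²(a + c/y), so y ↦ 1/y reduces to a linear argument. The term -χ
  -- a corrects y = 0, where the transformed summand is χ a instead of 0.
  ∑F-χ-quadratic : ∀ a c → c ≉ + 0 → ∑F (λ y → χ (y * (a * y + c))) ≡ - χ a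
  ∑F-χ-quadratic a c c≉0 = begin
    ∑F (λ y → χ (y * (a * y + c)))                            ≡⟨ ∑F-cong invert ⟩
    ∑F (λ y → h (inv y) + ⟦ y ≈? + 0 ⟧ * - χ a)               ≡⟨ ∑F-+ (λ y → h (inv y)) (λ y → ⟦ y ≈? + 0 ⟧ * - χ a) ⟩
    ∑F (λ y → h (inv y)) + ∑F (λ y → ⟦ y ≈? + 0 ⟧ * - χ a)    ≡⟨ cong₂ _+_
        (trans (∑F-inv {h} (λ y≈z → χ-respects (c-+ (c-*ˡ c y≈z) c-refl))) (∑F-χ-affine c a c≉0))
        (∑F-δ {λ _ → - χ a} (+ 0) (λ _ → refl)) ⟩
    + 0 + - χ a                                               ≡⟨ ℤₚ.+-identityˡ (- χ a) ⟩
    - χ a                                                     ∎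
    where
    h : ℤ → ℤ
    h y = χ (c * y + a)
    expand : ∀ a c y v → y * (a * y + c) - y * y * (c * v + a) ≡ (- c * y) * (y * v - + 1)
    expand = solve-∀
    self-cancel : ∀ z → + 0 ≡ z + + 1 * - z
    self-cancel = solve-∀
    zero-coefficient : ∀ c a → c * + 0 + a ≡ a
    zero-coefficient = solve-∀
    invert : ∀ y → χ (y * (a * y + c)) ≡ h (inv y) + ⟦ y ≈? + 0 ⟧ * - χ a
    invert y with y ≈? + 0
    ... | yes y≈0 = trans (χ-0 (c-*ʳ (a * y + c) y≈0)) (trans (self-cancel (χ a))
            (cong (_+ + 1 * - χ a) (χ-respects (c-respˡ (c-refl {a = c * + 0 + a}) (sym (zero-coefficient c a))))))
    ... | no y≉0 = trans (χ-respects (c-comb₁ (- c * y) (c-diff (proj₂ (inverse y y≉0))) (expand a c y v)))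
            (trans (χ-square-* y (c * v + a) y≉0) (sym (ℤₚ.+-identityʳ (χ (c * v + a)))))
      where v = proj₁ (inverse y y≉0)

  χ-1 : χ (+ 1) ≡ + 1
  χ-1 = χ-square (+ 1) 1≉0

  -- The parity of N

  -- In effect χ(v/u) = χ(v) for a residue u; fractions are handled as solutions x of u x ≈ v.
  χ-cancel : ∀ u x v → χ u ≡ + 1 → u * x ≈ v → χ x ≡ χ v
  χ-cancel u x v χu ux≈v = begin
    χ x          ≡⟨ ℤₚ.*-identityˡ (χ x) ⟨
    + 1 * χ x    ≡⟨ cong (_* χ x) χu ⟨
    χ u * χ x    ≡⟨ χ-* u x ⟨
    χ (u * x)    ≡⟨ χ-respects ux≈v ⟩
    χ v          ∎

  χ-inverse : ∀ a v → a * v ≈ + 1 → χ v ≡ χ a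
  χ-inverse a v av≈1 = trans (sym (χ-square-* a v (unit-≉0 a v av≈1)))
    (χ-respects (c-comb₁ a (c-diff av≈1) (absorb a v)))
    where
    absorb : ∀ a v → a * a * v - a ≡ a * (a * v - + 1)
    absorb = solve-∀

  unit-value : ∀ {a x} → ±1 x → χ a ≡ x → a ≉ + 0
  unit-value +one χa a≈0 with () ← trans (sym (χ-0 a≈0)) χa
  unit-value -one χa a≈0 with () ← trans (sym (χ-0 a≈0)) χa

  χ-*-≉0 : ∀ {a c} → a * c ≉ + 0 → a ≉ + 0 × c ≉ + 0
  χ-*-≉0 {a} {c} ac≉0 = (λ a≈0 → ac≉0 (c-*ʳ c a≈0))
                      , (λ c≈0 → ac≉0 (c-respʳ (c-*ˡ a c≈0) (ℤₚ.*-zeroʳ a)))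

  sqrt : ∀ {a} → χ a ≡ + 1 → ∃ λ x → x * x ≈ a
  sqrt {a} χa with χ a | χ-view a
  sqrt refl | _ | residue x _ x²≈a = x , x²≈a

  -- The involution is given by the symmetric relation T y z ≈ 0, which spares separate proofs that
  -- a partner's partner is the original point. The matrix `G` restricts it to the set with
  -- indicator f and has f as row sums; its trace counts those of r and s that lie in the set.
  involution-parity : ∀ {f} (T : ℤ → ℤ → ℤ) → Respects f → (∀ y → f y ≡ + 0 ⊎ f y ≡ + 1) →
    (∀ {y y′ z z′} → y ≈ y′ → z ≈ z′ → T y z ≈ T y′ z′) → (∀ y z → T y z ≡ T z y) →
    (∀ y → f y ≡ + 1 → ∃ λ z → f z ≡ + 1 × T y z ≈ + 0 × (∀ z′ → T y z′ ≈ + 0 → z′ ≈ z)) →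
    ∀ r s → r ≉ s → T r r ≈ + 0 → T s s ≈ + 0 → (∀ y → T y y ≈ + 0 → y ≈ r ⊎ y ≈ s) →
    ∑F f ≈₂ f r + f s
  involution-parity {f} T f-respects f-bit T-respects T-sym partner r s r≉s r-fixed s-fixed fixed =
    c-respˡ (c-respʳ (∑-symmetric p (λ i j → G (+ i) (+ j)) (λ i j → G-sym (+ i) (+ j))) trace)
            (∑F-cong (λ y → sym (row y)))
    where
    G : ℤ → ℤ → ℤ
    G y z = f y * f z * ⟦ T y z ≈? + 0 ⟧
    G-respects : ∀ {y y′ z z′} → y ≈ y′ → z ≈ z′ → G y z ≡ G y′ z′
    G-respects y≈ z≈ = cong₂ _*_ (cong₂ _*_ (f-respects y≈) (f-respects z≈)) (≈?-respects (T-respects y≈ z≈) c-refl)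
    G-sym : ∀ y z → G y z ≡ G z y
    G-sym y z = cong₂ _*_ (ℤₚ.*-comm (f y) (f z)) (cong (λ t → ⟦ t ≈? + 0 ⟧) (T-sym y z))
    row : ∀ y → ∑F (G y) ≡ f y
    row y with f-bit y
    ... | inj₁ fy≡0 = trans (∑-zero p (λ i _ → cong (λ c → c * f (+ i) * ⟦ T y (+ i) ≈? + 0 ⟧) fy≡0)) (sym fy≡0)
    ... | inj₂ fy≡1 with partner y fy≡1
    ... | z , fz≡1 , Tyz≈0 , unique = begin
      ∑F (G y)                         ≡⟨ ∑F-point z (G-respects c-refl) (λ z′ z′≉z → trans
                                            (cong (f y * f z′ *_) (⟦⟧-no (T y z′ ≈? + 0) (z′≉z ∘ unique z′)))
                                            (ℤₚ.*-zeroʳ (f y * f z′))) ⟩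
      f y * f z * ⟦ T y z ≈? + 0 ⟧     ≡⟨ cong₂ (λ c d → f y * c * d) fz≡1 (⟦⟧-yes (T y z ≈? + 0) Tyz≈0) ⟩
      f y * + 1 * + 1                  ≡⟨ trans (ℤₚ.*-identityʳ (f y * + 1)) (ℤₚ.*-identityʳ (f y)) ⟩
      f y                              ∎
    diagonal : ∀ y → T y y ≈ + 0 → G y y ≡ f y
    diagonal y h with f-bit y
    ... | inj₁ e = trans (cong (λ c → c * c * ⟦ T y y ≈? + 0 ⟧) e) (sym e)
    ... | inj₂ e = trans (cong₂ (λ c d → c * c * d) e (⟦⟧-yes (T y y ≈? + 0) h)) (sym e)
    off-diagonal : ∀ y → y ≉ r → y ≉ s → G y y ≡ + 0
    off-diagonal y y≉r y≉s = trans (cong (f y * f y *_) (⟦⟧-no (T y y ≈? + 0) neither)) (ℤₚ.*-zeroʳ (f y * f y))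
      where
      neither : T y y ≉ + 0
      neither h with fixed y h
      ... | inj₁ y≈r = y≉r y≈r
      ... | inj₂ y≈s = y≉s y≈s
    trace : ∑F (λ y → G y y) ≡ f r + f s
    trace = trans (∑F-two r s (λ y≈z → G-respects y≈z y≈z) r≉s off-diagonal)
                  (cong₂ _+_ (diagonal r r-fixed) (diagonal s s-fixed))

  g-bit : ∀ a y → g a y ≡ + 0 ⊎ g a y ≡ + 1
  g-bit a y with ⟦⟧-bit (χ y ℤₚ.≟ + 1) | ⟦⟧-bit (χ (a * y - + 1) ℤₚ.≟ - + 1) | ⟦⟧-bit (χ (y - + 1) ℤₚ.≟ - + 1)
  ... | inj₁ u | _      | _      = inj₁ (cong (_* bb a y) u)
  ... | inj₂ u | inj₁ v | _      = inj₁ (cong₂ (λ c d → c * (d * b (y - + 1))) u v)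
  ... | inj₂ u | inj₂ v | inj₁ w = inj₁ (trans (cong₂ (λ c d → c * (d * b (y - + 1))) u v) (cong (λ c → + 1 * (+ 1 * c)) w))
  ... | inj₂ u | inj₂ v | inj₂ w = inj₂ (trans (cong₂ (λ c d → c * (d * b (y - + 1))) u v) (cong (λ c → + 1 * (+ 1 * c)) w))

  g-intro : ∀ a y → χ y ≡ + 1 → χ (a * y - + 1) ≡ - + 1 → χ (y - + 1) ≡ - + 1 → g a y ≡ + 1
  g-intro a y u v w rewrite u | v | w = refl

  g-elim : ∀ a y → g a y ≡ + 1 → χ y ≡ + 1 × χ (a * y - + 1) ≡ - + 1 × χ (y - + 1) ≡ - + 1
  g-elim a y h with χ y ℤₚ.≟ + 1 | χ (a * y - + 1) ℤₚ.≟ - + 1 | χ (y - + 1) ℤₚ.≟ - + 1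
  ... | yes u | yes v | yes w = u , v , w
  g-elim _ _ () | no _  | _     | _
  g-elim _ _ () | yes _ | no _  | _
  g-elim _ _ () | yes _ | yes _ | no _

  module _ (χ-1≡1 : χ (- + 1) ≡ + 1) where

    private
      χ-even : ∀ a → χ (- a) ≡ χ a
      χ-even a = trans (χ-neg a) (trans (cong (_* χ a) χ-1≡1) (ℤₚ.*-identityˡ (χ a)))

      χ-swap : ∀ u v → χ (u - v) ≡ χ (v - u)
      χ-swap u v = trans (cong χ (flip u v)) (χ-even (v - u))
        where
        flip : ∀ u v → u - v ≡ - (v - u)
        flip = solve-∀

      -- At v = 1/s the quantities are s²v - 1 = s - 1 and v - 1 = (1 - s)/s. If s is a residue, so
      -- is -1, and the two nonresidue conditions merge into one.
      g-fixed : ∀ s v → s * v ≈ + 1 → g (s * s) v ≡ q s * b (s - + 1)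
      g-fixed s v sv≈1 = trans (cong (λ c → is1 c * bb (s * s) v) (χ-inverse s v sv≈1)) step
        where
        at-fixed : ∀ s v → s * s * v - + 1 - (s - + 1) ≡ s * (s * v - + 1)
        at-fixed = solve-∀
        reciprocal : ∀ s v → s * (v - + 1) - (+ 1 - s) ≡ + 1 * (s * v - + 1)
        reciprocal = solve-∀
        bb≡ : χ s ≡ + 1 → bb (s * s) v ≡ b (s - + 1)
        bb≡ χs = trans (cong₂ _*_ (b-respects (c-comb₁ s (c-diff sv≈1) (at-fixed s v)))
          (cong is-1 (trans (χ-cancel s (v - + 1) (+ 1 - s) χs (c-comb₁ (+ 1) (c-diff sv≈1) (reciprocal s v))) (χ-swap (+ 1) s))))
          (⟦⟧-idem (χ (s - + 1) ℤₚ.≟ - + 1))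
        step : q s * bb (s * s) v ≡ q s * b (s - + 1)
        step with χ s ℤₚ.≟ + 1
        ... | yes χs = cong (+ 1 *_) (bb≡ χs)
        ... | no _   = refl

    -- For z = 1/(s²y) one has s²z - 1 = (1 - y)/y and z - 1 = (1 - s²y)/(s²y). With y and -1
    -- residues, the two nonresidue conditions on y pass to those on z in exchanged order. The fixed
    -- points are 1/s and -1/s.
    N-parity-1mod4 : ∀ s → s ≉ + 0 → N (s * s) ≈₂ q s * (b (s - + 1) + b (s + + 1))
    N-parity-1mod4 s s≉0 = c-respʳ
      (involution-parity T (g-respects a) (g-bit a) (λ y≈ z≈ → c-- (c-* (c-*ˡ a y≈) z≈) c-refl) T-sym partner
        v (- v) v≉-v (c-comb₁ (s * v + + 1) sv (root s v)) (c-comb₁ (s * v + + 1) sv (root′ s v)) fixed)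
      (begin
        g a v + g a (- v)                               ≡⟨ cong₂ _+_ (g-fixed s v (inv-*ʳ s≉0)) opposite ⟩
        q s * b (s - + 1) + q s * b (s + + 1)           ≡⟨ ℤₚ.*-distribˡ-+ (q s) _ _ ⟨
        q s * (b (s - + 1) + b (s + + 1))               ∎)
      where
      a = s * s
      v = inv s
      T : ℤ → ℤ → ℤ
      T y z = a * y * z - + 1
      T-sym : ∀ y z → T y z ≡ T z y
      T-sym = swap (s * s)
        where
        swap : ∀ a y z → a * y * z - + 1 ≡ a * z * y - + 1
        swap = solve-∀
      sv : s * v - + 1 ≈ + 0
      sv = c-diff (inv-*ʳ s≉0)
      v≉0 : v ≉ + 0
      v≉0 = inv-≉0 s≉0
      v≉-v : v ≉ - v
      v≉-v h = domain-≉ 2≉0 v≉0 (c-comb₁ (+ 1) (c-diff h) (double v))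
        where
        double : ∀ v → + 2 * v - + 0 ≡ + 1 * (v - - v)
        double = solve-∀
      root : ∀ s v → s * s * v * v - + 1 - + 0 ≡ (s * v + + 1) * (s * v - + 1)
      root = solve-∀
      root′ : ∀ s v → s * s * - v * - v - + 1 - + 0 ≡ (s * v + + 1) * (s * v - + 1)
      root′ = solve-∀
      fixed : ∀ y → T y y ≈ + 0 → y ≈ v ⊎ y ≈ - v
      fixed y h = Sum.map (λ e → inv-unique s y (c-undiff e))
          (λ e → c-respˡ (c-neg (inv-unique s (- y) (c-comb₁ (- + 1) e (opposite-sign s y)))) (sym (ℤₚ.neg-involutive y)))
          (domain (s * y - + 1) (s * y + + 1) (c-respˡ h (factor s y)))
        where
        factor : ∀ s y → (s * y - + 1) * (s * y + + 1) ≡ s * s * y * y - + 1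
        factor = solve-∀
        opposite-sign : ∀ s y → s * - y - + 1 ≡ - + 1 * (s * y + + 1)
        opposite-sign = solve-∀
      partner : ∀ y → g a y ≡ + 1 → ∃ λ z → g a z ≡ + 1 × T y z ≈ + 0 × (∀ z′ → T y z′ ≈ + 0 → z′ ≈ z)
      partner y gy with g-elim a y gy
      ... | χy , χay-1 , χy-1 = z
          , g-intro a z (trans (χ-inverse (a * y) z ayz≈1) χay)
              (trans (χ-cancel y (a * z - + 1) (+ 1 - y) χy (c-comb₁ (+ 1) (c-diff ayz≈1) (first a y z)))
                     (trans (χ-swap (+ 1) y) χy-1))
              (trans (χ-cancel (a * y) (z - + 1) (+ 1 - a * y) χay (c-comb₁ (+ 1) (c-diff ayz≈1) (second a y z)))
                     (trans (χ-swap (+ 1) (a * y)) χay-1))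
          , c-diff ayz≈1
          , (λ z′ h → inv-unique (a * y) z′ (c-undiff h))
        where
        χay : χ (a * y) ≡ + 1
        χay = trans (χ-square-* s y s≉0) χy
        z = inv (a * y)
        ayz≈1 : a * y * z ≈ + 1
        ayz≈1 = inv-*ʳ (unit-value +one χay)
        first : ∀ a y z → y * (a * z - + 1) - (+ 1 - y) ≡ + 1 * (a * y * z - + 1)
        first = solve-∀
        second : ∀ a y z → a * y * (z - + 1) - (+ 1 - a * y) ≡ + 1 * (a * y * z - + 1)
        second = solve-∀
      opposite : g a (- v) ≡ q s * b (s + + 1)
      opposite = begin
        -- The fixed point -1/s is treated as the first fixed point for -s, which has the same
        -- square.
        g a (- v)                                ≡⟨ cong (λ c → g c (- v)) (neg-square s) ⟨
        g (- s * - s) (- v)                      ≡⟨ g-fixed (- s) (- v) (c-respˡ (inv-*ʳ s≉0) (neg-*-neg s v)) ⟩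
        q (- s) * b (- s - + 1)                  ≡⟨ cong₂ (λ c d → is1 c * is-1 d) (χ-even s) (trans (cong χ (flip s)) (χ-even (s + + 1))) ⟩
        q s * b (s + + 1)                        ∎
        where
        neg-square : ∀ s → - s * - s ≡ s * s
        neg-square = solve-∀
        neg-*-neg : ∀ s v → - s * - v ≡ s * v
        neg-*-neg = solve-∀
        flip : ∀ s → - s - + 1 ≡ - (s + + 1)
        flip = solve-∀

  -- With x² = σ (1 + s), e² = σ (1 - s) and c = σ x e one has (x + e)² = 2 σ (1 + c).
  half-angle : ∀ {σ} s → ±1 σ → χ σ ≡ σ → χ (+ 1 + s) ≡ σ → χ (+ 1 - s) ≡ σ → s ≉ + 0 →
               ∃ λ c → c * c ≈ + 1 - s * s × χ (+ 1 + c) ≡ χ (+ 2) * σ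
  half-angle {σ} s σ-unit χσ χ+ χ- s≉0 = c , c²≈ , (begin
      χ (+ 1 + c)      ≡⟨ unit-solve (χ-unit 2≉0) (subst ±1 (sym χσ) σ-unit) (χ-unit 1+c≉0) product ⟩
      χ (+ 2) * χ σ    ≡⟨ cong (χ (+ 2) *_) χσ ⟩
      χ (+ 2) * σ      ∎)
    where
    scaled : ∀ u → χ u ≡ σ → χ (σ * u) ≡ + 1
    scaled u χu = trans (χ-* σ u) (trans (cong₂ _*_ χσ χu) (unit-square σ-unit))
    x = proj₁ (sqrt (scaled (+ 1 + s) χ+))
    e = proj₁ (sqrt (scaled (+ 1 - s) χ-))
    x² : x * x ≈ σ * (+ 1 + s)
    x² = proj₂ (sqrt (scaled (+ 1 + s) χ+))
    e² : e * e ≈ σ * (+ 1 - s)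
    e² = proj₂ (sqrt (scaled (+ 1 - s) χ-))
    σ² : σ * σ - + 1 ≈ + 0
    σ² = c-diff (c-reflexive (unit-square σ-unit))
    c = σ * x * e
    c²≈ : c * c ≈ + 1 - s * s
    c²≈ = c-respˡ (c-respʳ (c-*ˡ (σ * σ) (c-* x² e²))
        (trans (collect σ s) (trans (cong (λ t → t * t * (+ 1 - s * s)) (unit-square σ-unit)) (ℤₚ.*-identityˡ (+ 1 - s * s)))))
      (regroup σ x e)
      where
      regroup : ∀ σ x e → σ * x * e * (σ * x * e) ≡ σ * σ * (x * x * (e * e))
      regroup = solve-∀
      collect : ∀ σ s → σ * σ * (σ * (+ 1 + s) * (σ * (+ 1 - s))) ≡ σ * σ * (σ * σ) * (+ 1 - s * s)
      collect = solve-∀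
    1+c≉0 : + 1 + c ≉ + 0
    1+c≉0 h = domain-≉ s≉0 s≉0 (c-comb₂ (+ 1 - c) (+ 1) h (c-diff c²≈) (factor c s))
      where
      factor : ∀ c s → s * s - + 0 ≡ (+ 1 - c) * (+ 1 + c) + + 1 * (c * c - (+ 1 - s * s))
      factor = solve-∀
    -- The half-angle formula: for real s = sin θ, c = cos θ and σ = 1 both sides would be (2
    -- cos(θ/2))².
    2σ[1+c]≈ : + 2 * σ * (+ 1 + c) ≈ (x + e) * (x + e)
    2σ[1+c]≈ = c-comb₂ (- + 1) (+ 2 * x * e) (c-+ (c-diff x²) (c-diff e²)) σ² (expand σ s x e)
      where
      expand : ∀ σ s x e → + 2 * σ * (+ 1 + σ * x * e) - (x + e) * (x + e) ≡
        - + 1 * (x * x - σ * (+ 1 + s) + (e * e - σ * (+ 1 - s))) + + 2 * x * e * (σ * σ - + 1)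
      expand = solve-∀
    x+e≉0 : x + e ≉ + 0
    x+e≉0 h = domain-≉ (domain-≉ 2≉0 (unit-value σ-unit χσ)) 1+c≉0 (c-trans 2σ[1+c]≈ (c-* h h))
    product : χ (+ 2) * χ σ * χ (+ 1 + c) ≡ + 1
    product = begin
      χ (+ 2) * χ σ * χ (+ 1 + c)      ≡⟨ cong (_* χ (+ 1 + c)) (χ-* (+ 2) σ) ⟨
      χ (+ 2 * σ) * χ (+ 1 + c)        ≡⟨ χ-* (+ 2 * σ) (+ 1 + c) ⟨
      χ (+ 2 * σ * (+ 1 + c))          ≡⟨ χ-respects 2σ[1+c]≈ ⟩
      χ ((x + e) * (x + e))            ≡⟨ χ-square (x + e) x+e≉0 ⟩
      + 1                              ∎

  module _ (χ-1≡-1 : χ (- + 1) ≡ - + 1) where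

    private
      χ-odd : ∀ a → χ (- a) ≡ - χ a
      χ-odd a = trans (χ-neg a) (trans (cong (_* χ a) χ-1≡-1) (ℤₚ.-1*i≡-i (χ a)))

      χ-odd-swap : ∀ u v → χ (u - v) ≡ - χ (v - u)
      χ-odd-swap u v = trans (cong χ (flip u v)) (χ-odd (v - u))
        where
        flip : ∀ u v → u - v ≡ - (v - u)
        flip = solve-∀

      is-1-neg : ∀ x → is-1 (- x) ≡ is1 x
      is-1-neg (+ 0)             = refl
      is-1-neg (+ 1)             = refl
      is-1-neg (+ suc (suc _))   = refl
      is-1-neg -[1+ 0 ]          = refl
      is-1-neg -[1+ suc _ ]      = refl

      b-neg : ∀ a → b (- a) ≡ q a
      b-neg a = trans (cong is-1 (χ-odd a)) (is-1-neg (χ a))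

      complementary : ∀ {x} → ±1 x → is1 x + is1 (- x) ≡ + 1
      complementary +one = refl
      complementary -one = refl

      -- As a = (1 + c)(1 - c), one has a u - 1 = -c and u - 1 = -c u. If 1 + c is a residue, both
      -- are nonresidues exactly when c is a residue, since -1 is a nonresidue.
      g-fixed : ∀ a c u → c * c ≈ + 1 - a → (+ 1 + c) * u ≈ + 1 → g a u ≡ q (+ 1 + c) * q c
      g-fixed a c u c²≈ cu≈1 = trans (cong (λ z → is1 z * bb a u) (χ-inverse (+ 1 + c) u cu≈1)) step
        where
        first : ∀ a c u → a * u - + 1 - - c ≡ (+ 1 - c) * ((+ 1 + c) * u - + 1) + u * (c * c - (+ 1 - a))
        first = solve-∀
        second : ∀ c u → (+ 1 + c) * (u - + 1) - - c ≡ + 1 * ((+ 1 + c) * u - + 1)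
        second = solve-∀
        bb≡ : χ (+ 1 + c) ≡ + 1 → bb a u ≡ q c
        bb≡ χ1+c = trans (cong₂ _*_
          (trans (b-respects (c-comb₂ (+ 1 - c) u (c-diff cu≈1) (c-diff c²≈) (first a c u))) (b-neg c))
          (trans (cong is-1 (χ-cancel (+ 1 + c) (u - + 1) (- c) χ1+c (c-comb₁ (+ 1) (c-diff cu≈1) (second c u)))) (b-neg c)))
          (⟦⟧-idem (χ c ℤₚ.≟ + 1))
        step : q (+ 1 + c) * bb a u ≡ q (+ 1 + c) * q c
        step with χ (+ 1 + c) ℤₚ.≟ + 1
        ... | yes χ1+c = cong (+ 1 *_) (bb≡ χ1+c)
        ... | no _     = refl

      -- T y z = 0 means z = (1 - y)/(1 - ay), and then 1 - z = y(1 - a)/(1 - ay) and 1 - az = (1 -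
      -- a)/(1 - ay). Since -1 is a nonresidue, membership of y says that y, 1 - y and 1 - ay are
      -- residues; z inherits this because 1 - a is a residue. The fixed points are 1/(1 + c) and
      -- 1/(1 - c). Their symbols agree because (1 + c)(1 - c) = s², and exactly one of c, -c is a
      -- residue, so together they contribute `q (+ 1 + c)`.
      N-involution : ∀ s c → s ≉ + 0 → χ (+ 1 - s * s) ≡ + 1 → c * c ≈ + 1 - s * s → N (s * s) ≈₂ q (+ 1 + c)
      N-involution s c s≉0 χ1-a c²≈ = c-respʳ
        (involution-parity T (g-respects a) (g-bit a)
          (λ y≈ z≈ → c-+ (c-- (c-- (c-* (c-*ˡ a y≈) z≈) y≈) z≈) c-refl) T-sym partner
          u u′ u≉u′ (c-comb₂ ((+ 1 - c) * u - + 1) (u * u) (c-diff cu) c² (root a c u))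
          (c-comb₂ ((+ 1 + c) * u′ - + 1) (u′ * u′) (c-diff cu′) c² (root′ a c u′)) fixed)
        (begin
          g a u + g a u′                                    ≡⟨ cong₂ _+_ (g-fixed a c u c²≈ cu)
                                                                 (g-fixed a (- c) u′ (c-respˡ c²≈ (neg-square c)) cu′) ⟩
          q (+ 1 + c) * q c + q (+ 1 - c) * q (- c)         ≡⟨ cong (λ z → q (+ 1 + c) * q c + z * q (- c)) q1-c ⟩
          q (+ 1 + c) * q c + q (+ 1 + c) * q (- c)         ≡⟨ ℤₚ.*-distribˡ-+ (q (+ 1 + c)) (q c) (q (- c)) ⟨
          q (+ 1 + c) * (q c + q (- c))                     ≡⟨ cong (q (+ 1 + c) *_) (trans (cong (λ z → q c + is1 z) (χ-odd c)) (complementary (χ-unit c≉0))) ⟩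
          q (+ 1 + c) * + 1                                 ≡⟨ ℤₚ.*-identityʳ (q (+ 1 + c)) ⟩
          q (+ 1 + c)                                       ∎)
        where
        a = s * s
        T : ℤ → ℤ → ℤ
        T y z = a * y * z - y - z + + 1
        T-sym : ∀ y z → T y z ≡ T z y
        T-sym = swap (s * s)
          where
          swap : ∀ a y z → a * y * z - y - z + + 1 ≡ a * z * y - z - y + + 1
          swap = solve-∀
        neg-square : ∀ c → - c * - c ≡ c * c
        neg-square = solve-∀
        c² : c * c - (+ 1 - a) ≈ + 0
        c² = c-diff c²≈
        conjugates : (+ 1 + c) * (+ 1 - c) ≈ s * s
        conjugates = c-comb₁ (- + 1) c² (expand s c)
          where
          expand : ∀ s c → (+ 1 + c) * (+ 1 - c) - s * s ≡ - + 1 * (c * c - (+ 1 - s * s))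
          expand = solve-∀
        conjugates≉0 = χ-*-≉0 {+ 1 + c} {+ 1 - c} (λ h → domain-≉ s≉0 s≉0 (c-trans (c-sym conjugates) h))
        1+c≉0 = proj₁ conjugates≉0
        1-c≉0 = proj₂ conjugates≉0
        c≉0 : c ≉ + 0
        c≉0 h = unit-value +one χ1-a (c-trans (c-sym c²≈) (c-* h h))
        q1-c : q (+ 1 - c) ≡ q (+ 1 + c)
        q1-c = cong is1 (unit-*≡1 (χ-unit 1+c≉0) (χ-unit 1-c≉0)
          (trans (sym (χ-* (+ 1 + c) (+ 1 - c))) (trans (χ-respects conjugates) (χ-square s s≉0))))
        u  = inv (+ 1 + c)
        u′ = inv (+ 1 - c)
        cu : (+ 1 + c) * u ≈ + 1
        cu = inv-*ʳ 1+c≉0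
        cu′ : (+ 1 - c) * u′ ≈ + 1
        cu′ = inv-*ʳ 1-c≉0
        u≉u′ : u ≉ u′
        u≉u′ h = domain-≉ (domain-≉ 2≉0 c≉0) (inv-≉0 1+c≉0)
          (c-comb₂ (+ 1) (+ 1 - c) (c-+ (c-diff cu) (c-neg (c-diff cu′))) (c-neg (c-diff h)) (separate c u u′))
          where
          separate : ∀ c u u′ → + 2 * c * u - + 0 ≡
            + 1 * ((+ 1 + c) * u - + 1 + - ((+ 1 - c) * u′ - + 1)) + (+ 1 - c) * - (u - u′)
          separate = solve-∀
        root : ∀ a c u → a * u * u - u - u + + 1 - + 0 ≡ ((+ 1 - c) * u - + 1) * ((+ 1 + c) * u - + 1) + u * u * (c * c - (+ 1 - a))
        root = solve-∀
        root′ : ∀ a c u → a * u * u - u - u + + 1 - + 0 ≡ ((+ 1 + c) * u - + 1) * ((+ 1 - c) * u - + 1) + u * u * (c * c - (+ 1 - a))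
        root′ = solve-∀
        fixed : ∀ y → T y y ≈ + 0 → y ≈ u ⊎ y ≈ u′
        fixed y h = Sum.map (λ e → inv-unique (+ 1 + c) y (c-undiff e)) (λ e → inv-unique (+ 1 - c) y (c-undiff e))
          (domain ((+ 1 + c) * y - + 1) ((+ 1 - c) * y - + 1) (c-comb₂ (+ 1) (- (y * y)) h c² (factor a c y)))
          where
          factor : ∀ a c y → ((+ 1 + c) * y - + 1) * ((+ 1 - c) * y - + 1) - + 0 ≡
            + 1 * (a * y * y - y - y + + 1) + - (y * y) * (c * c - (+ 1 - a))
          factor = solve-∀
        partner : ∀ y → g a y ≡ + 1 → ∃ λ z → g a z ≡ + 1 × T y z ≈ + 0 × (∀ z′ → T y z′ ≈ + 0 → z′ ≈ z)
        partner y gy with g-elim a y gy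
        ... | χy , χay-1 , χy-1 = z
            , g-intro a z χz
                (trans (χ-odd-swap (a * z) (+ 1)) (cong -_ (trans (χ-cancel D (+ 1 - a * z) (+ 1 - a) χD (c-comb₁ (- a) Dz (third a y z))) χ1-a)))
                (trans (χ-odd-swap z (+ 1)) (cong -_ (trans (χ-cancel D (+ 1 - z) (y * (+ 1 - a)) χD (c-comb₁ (- + 1) Dz (second a y z)))
                   (trans (χ-* y (+ 1 - a)) (cong₂ _*_ χy χ1-a)))))
            , c-comb₁ (- + 1) Dz (relation a y z)
            , (λ z′ h → cancel D z′ z (unit-value +one χD) (c-comb₂ (- + 1) (- + 1) h Dz (solution a y z z′)))
          where
          D = + 1 - a * y
          χD : χ D ≡ + 1
          χD = trans (χ-odd-swap (+ 1) (a * y)) (cong -_ χay-1)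
          z = (+ 1 - y) * inv D
          Dz : D * z - (+ 1 - y) ≈ + 0
          Dz = c-comb₁ (+ 1 - y) (c-diff (inv-*ʳ (unit-value +one χD))) (regroup D y (inv D))
            where
            regroup : ∀ D y v → D * ((+ 1 - y) * v) - (+ 1 - y) - + 0 ≡ (+ 1 - y) * (D * v - + 1)
            regroup = solve-∀
          χz : χ z ≡ + 1
          χz = trans (χ-cancel D z (+ 1 - y) χD (c-undiff Dz)) (trans (χ-odd-swap (+ 1) y) (cong -_ χy-1))
          second : ∀ a y z → (+ 1 - a * y) * (+ 1 - z) - y * (+ 1 - a) ≡ - + 1 * ((+ 1 - a * y) * z - (+ 1 - y))
          second = solve-∀
          third : ∀ a y z → (+ 1 - a * y) * (+ 1 - a * z) - (+ 1 - a) ≡ - a * ((+ 1 - a * y) * z - (+ 1 - y))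
          third = solve-∀
          relation : ∀ a y z → a * y * z - y - z + + 1 - + 0 ≡ - + 1 * ((+ 1 - a * y) * z - (+ 1 - y))
          relation = solve-∀
          solution : ∀ a y z z′ → (+ 1 - a * y) * z′ - (+ 1 - a * y) * z ≡
            - + 1 * (a * y * z′ - y - z′ + + 1) + - + 1 * ((+ 1 - a * y) * z - (+ 1 - y))
          solution = solve-∀

    -- Any root c of 1 - s² would give the parity; `half-angle` supplies one for which the symbol of
    -- 1 + c is explicit. It applies because 1 + s and 1 - s have a residue as product and so share
    -- a symbol σ, and because χ(-1) = -1 makes either sign σ its own symbol.
    N-parity-3mod4 : ∀ s → s ≉ + 0 → χ (+ 1 - s * s) ≡ + 1 → N (s * s) ≈₂ is1 (χ (+ 2) * χ (+ 1 + s))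
    N-parity-3mod4 s s≉0 χ1-s² = c-respʳ
      (N-involution s (proj₁ angle) s≉0 χ1-s² (proj₁ (proj₂ angle))) (cong is1 (proj₂ (proj₂ angle)))
      where
      factor : ∀ s → (+ 1 + s) * (+ 1 - s) ≡ + 1 - s * s
      factor = solve-∀
      factors≉0 = χ-*-≉0 {+ 1 + s} {+ 1 - s} (λ h → unit-value +one χ1-s² (c-respˡ h (sym (factor s))))
      unit-χ : ∀ {σ} → ±1 σ → χ σ ≡ σ
      unit-χ +one = χ-1
      unit-χ -one = χ-1≡-1
      χ1-s : χ (+ 1 - s) ≡ χ (+ 1 + s)
      χ1-s = unit-*≡1 (χ-unit (proj₁ factors≉0)) (χ-unit (proj₂ factors≉0))
        (trans (sym (χ-* (+ 1 + s) (+ 1 - s))) (trans (cong χ (factor s)) χ1-s²))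
      angle = half-angle s (χ-unit (proj₁ factors≉0)) (unit-χ (χ-unit (proj₁ factors≉0))) refl χ1-s s≉0

  -- The substitution y ↦ s²y interchanges the two nonresidue conditions. Since 1 - 1/s² = (s² -
  -- 1)/s², for p ≡ 3 mod 4 and s² ≢ 1 exactly one of s and 1/s meets the condition of
  -- `N-parity-3mod4`.
  N-inverse : ∀ s → s ≉ + 0 → N (s * s) ≡ N (inv s * inv s)
  N-inverse s s≉0 = begin
    ∑F (g a)                    ≡⟨ ∑F-cong (λ y → sym (rescale y)) ⟩
    ∑F (λ y → g a′ (a * y))     ≡⟨ ∑F-scale a (g-respects a′) (domain-≉ s≉0 s≉0) ⟩
    ∑F (g a′)                   ∎
    where
    a = s * s
    v = inv s
    a′ = v * v
    unscale : ∀ s v y → v * v * (s * s * y) - + 1 - (y - + 1) ≡ y * (s * v + + 1) * (s * v - + 1)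
    unscale = solve-∀
    rescale : ∀ y → g a′ (a * y) ≡ g a y
    rescale y = cong₂ _*_ (cong is1 (χ-square-* s y s≉0)) (trans
      (cong (_* b (a * y - + 1)) (b-respects (c-comb₁ (y * (s * v + + 1)) (c-diff (inv-*ʳ s≉0)) (unscale s v y))))
      (ℤₚ.*-comm (b (y - + 1)) (b (a * y - + 1))))

  ∑F-- : ∀ f h → ∑F (λ y → f y - h y) ≡ ∑F f - ∑F h
  ∑F-- f h = trans (∑F-+ f (λ y → - h y)) (cong (_+_ (∑F f)) (∑F-neg h))

  -- Character sums

  cubic : ℤ → ℤ
  cubic a = ∑F (λ y → χ (y * (y - + 1) * (a * y - + 1)))

  -- Equal to 8 `g a y` wherever none of the three symbols vanishes.
  weights : ℤ → ℤ → ℤ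
  weights a y = (+ 1 + χ y) * (+ 1 - χ (y - + 1)) * (+ 1 - χ (a * y - + 1))

  weights-respects : ∀ a → Respects (weights a)
  weights-respects a y≈z = cong₂ _*_ (cong₂ (λ u v → (+ 1 + u) * (+ 1 - v)) (χ-respects y≈z) (χ-respects (c-- y≈z c-refl)))
    (cong (_-_ (+ 1)) (χ-respects (c-- (c-*ˡ a y≈z) c-refl)))

  ∑F-one : ∑F (λ _ → + 1) ≡ + p
  ∑F-one = trans (∑-const p (+ 1)) (ℤₚ.*-identityʳ (+ p))

  ∑F-χ-shift : ∑F (λ y → χ (y - + 1)) ≡ + 0
  ∑F-χ-shift = trans (∑F-translate {χ} (- + 1) χ-respects) ∑F-χ

  ∑F-χ-y[y-1] : ∑F (λ y → χ (y * (y - + 1))) ≡ - + 1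
  ∑F-χ-y[y-1] = trans (∑F-cong (λ y → cong (λ z → χ (y * (z - + 1))) (sym (ℤₚ.*-identityˡ y))))
    (trans (∑F-χ-quadratic (+ 1) (- + 1) -1≉0) (cong -_ χ-1))

  -- Expanding gives eight sums. The three linear ones vanish. The three quadratic ones have
  -- distinct roots and a residue as leading coefficient, so each is -1; with signs -, -, + they
  -- contribute the + 1.
  ∑F-weights : ∀ a → a ≉ + 0 → a ≉ + 1 → χ a ≡ + 1 → ∑F (weights a) ≡ + p + + 1 + cubic a
  ∑F-weights a a≉0 a≉1 χa = begin
    ∑F (weights a)   ≡⟨ ∑F-cong (λ y → trans (expand (χ y) (χ (y - + 1)) (χ (a * y - + 1)))
                          (cong₂ _+_ (cong₂ _+_ (cong₂ _+_ (cong₂ _+_ (refl {x = + 1 + χ y - χ (y - + 1) - χ (a * y - + 1)}) (cong -_ (sym (χ-* y (y - + 1)))))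
                              (cong -_ (sym (χ-* y (a * y - + 1))))) (sym (χ-* (y - + 1) (a * y - + 1))))
                            (sym (trans (χ-* (y * (y - + 1)) (a * y - + 1)) (cong (_* χ (a * y - + 1)) (χ-* y (y - + 1))))))) ⟩
    ∑F (λ y → + 1 + A y - C y - D y - AC y - AD y + CD y + ACD y)
      ≡⟨ linear ⟩
    ∑F (λ _ → + 1) + ∑F A - ∑F C - ∑F D - ∑F AC - ∑F AD + ∑F CD + ∑F ACD
      ≡⟨ cong (_+ ∑F ACD) (cong₂ _+_ (cong₂ _-_ (cong₂ _-_ (cong₂ _-_ (cong₂ _-_ (cong₂ _+_ ∑F-one ∑F-χ) ∑F-χ-shift)
           (∑F-χ-affine a (- + 1) a≉0)) ∑F-χ-y[y-1]) sum-AD) sum-CD) ⟩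
    + p + + 0 - + 0 - + 0 - - + 1 - - + 1 + - + 1 + cubic a
      ≡⟨ simplify (+ p) (cubic a) ⟩
    + p + + 1 + cubic a   ∎
    where
    A C D AC AD CD ACD : ℤ → ℤ
    A y = χ y
    C y = χ (y - + 1)
    D y = χ (a * y - + 1)
    AC y = χ (y * (y - + 1))
    AD y = χ (y * (a * y - + 1))
    CD y = χ ((y - + 1) * (a * y - + 1))
    ACD y = χ (y * (y - + 1) * (a * y - + 1))
    expand : ∀ u v w → (+ 1 + u) * (+ 1 - v) * (+ 1 - w) ≡ + 1 + u - v - w - u * v - u * w + v * w + u * v * w
    expand = solve-∀
    simplify : ∀ p k → p + + 0 - + 0 - + 0 - - + 1 - - + 1 + - + 1 + k ≡ p + + 1 + k
    simplify = solve-∀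
    linear : ∑F (λ y → + 1 + A y - C y - D y - AC y - AD y + CD y + ACD y)
           ≡ ∑F (λ _ → + 1) + ∑F A - ∑F C - ∑F D - ∑F AC - ∑F AD + ∑F CD + ∑F ACD
    linear =
      trans (∑F-+ (λ y → + 1 + A y - C y - D y - AC y - AD y + CD y) ACD) (cong (_+ ∑F ACD)
      (trans (∑F-+ (λ y → + 1 + A y - C y - D y - AC y - AD y) CD) (cong (_+ ∑F CD)
      (trans (∑F-- (λ y → + 1 + A y - C y - D y - AC y) AD) (cong (_- ∑F AD)
      (trans (∑F-- (λ y → + 1 + A y - C y - D y) AC) (cong (_- ∑F AC)
      (trans (∑F-- (λ y → + 1 + A y - C y) D) (cong (_- ∑F D)
      (trans (∑F-- (λ y → + 1 + A y) C) (cong (_- ∑F C) (∑F-+ (λ _ → + 1) A))))))))))))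
    sum-AD : ∑F AD ≡ - + 1
    sum-AD = trans (∑F-χ-quadratic a (- + 1) -1≉0) (cong -_ χa)
    a-1≉0 : a - + 1 ≉ + 0
    a-1≉0 h = a≉1 (c-undiff h)
    shift : ∀ a y → (y - + 1) * (a * y - + 1) ≡ (y + - + 1) * (a * (y + - + 1) + (a - + 1))
    shift = solve-∀
    sum-CD : ∑F CD ≡ - + 1
    sum-CD = begin
      ∑F CD                                                            ≡⟨ ∑F-cong (λ y → cong χ (shift a y)) ⟩
      ∑F (λ y → χ ((y + - + 1) * (a * (y + - + 1) + (a - + 1))))       ≡⟨ ∑F-translate {λ y → χ (y * (a * y + (a - + 1)))} (- + 1)
                                                                           (λ y≈z → χ-respects (c-* y≈z (c-+ (c-*ˡ a y≈z) c-refl))) ⟩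
      ∑F (λ y → χ (y * (a * y + (a - + 1))))                           ≡⟨ ∑F-χ-quadratic a (a - + 1) a-1≉0 ⟩
      - χ a                                                            ≡⟨ cong -_ χa ⟩
      - + 1                                                            ∎

  -- The points 0, 1 and 1/a, where one of the three characters vanishes, have to be counted separately.
  eight-N : ∀ a → a ≉ + 0 → a ≉ + 1 → χ a ≡ + 1 → let ε = χ (- + 1); τ = χ (a - + 1) in
    + p + + 1 + cubic a - + 8 * N a ≡ (+ 1 - ε) * (+ 1 - ε) + + 2 * (+ 1 - τ) + + 2 * (+ 1 - ε * τ)
  eight-N a a≉0 a≉1 χa = begin
    + p + + 1 + cubic a - + 8 * N a       ≡⟨ cong₂ _-_ (∑F-weights a a≉0 a≉1 χa) (∑F-* (+ 8) (g a)) ⟨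
    ∑F (weights a) - ∑F (λ y → + 8 * g a y)   ≡⟨ ∑F-- (weights a) (λ y → + 8 * g a y) ⟨
    ∑F R                                  ≡⟨ ∑F-three (+ 0) (+ 1) w R-respects (1≉0 ∘ c-sym) (w≉0 ∘ c-sym) 1≉w R-vanish ⟩
    R (+ 0) + R (+ 1) + R w               ≡⟨ cong₂ _+_ (cong₂ _+_ R-0 R-1) R-w ⟩
    (+ 1 - ε) * (+ 1 - ε) + + 2 * (+ 1 - τ) + + 2 * (+ 1 - ε * τ)   ∎
    where
    ε = χ (- + 1)
    τ = χ (a - + 1)
    w = inv a
    aw≈1 : a * w ≈ + 1
    aw≈1 = inv-*ʳ a≉0
    w≉0 : w ≉ + 0
    w≉0 = inv-≉0 a≉0
    1≉w : + 1 ≉ w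
    1≉w 1≈w = a≉1 (c-trans (c-respˡ (c-*ˡ a 1≈w) (sym (ℤₚ.*-identityʳ a))) aw≈1)
    R : ℤ → ℤ
    R y = weights a y - + 8 * g a y
    R-respects : Respects R
    R-respects y≈z = cong₂ (λ u v → u - + 8 * v) (weights-respects a y≈z) (g-respects a y≈z)
    R-vanish : ∀ y → y ≉ + 0 → y ≉ + 1 → y ≉ w → R y ≡ + 0
    R-vanish y y≉0 y≉1 y≉w = eight-products (χ-unit y≉0) (χ-unit (λ h → y≉1 (c-undiff h)))
      (χ-unit (λ h → y≉w (inv-unique a y (c-undiff h))))
    R-form : ∀ {y u v x} → χ y ≡ u → χ (y - + 1) ≡ v → χ (a * y - + 1) ≡ x →
             R y ≡ (+ 1 + u) * (+ 1 - v) * (+ 1 - x) - + 8 * (is1 u * (is-1 x * is-1 v))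
    R-form refl refl refl = refl
    R-0 : R (+ 0) ≡ (+ 1 - ε) * (+ 1 - ε)
    R-0 = trans (R-form {+ 0} (χ-0 c-refl) refl (cong (λ z → χ (z - + 1)) (ℤₚ.*-zeroʳ a))) (simplify ε)
      where
      simplify : ∀ e → (+ 1 + + 0) * (+ 1 - e) * (+ 1 - e) - + 8 * + 0 ≡ (+ 1 - e) * (+ 1 - e)
      simplify = solve-∀
    R-1 : R (+ 1) ≡ + 2 * (+ 1 - τ)
    R-1 = trans (R-form {+ 1} χ-1 (χ-0 c-refl) (cong (λ z → χ (z - + 1)) (ℤₚ.*-identityʳ a))) (simplify τ (is-1 τ))
      where
      simplify : ∀ t s → (+ 1 + + 1) * (+ 1 - + 0) * (+ 1 - t) - + 8 * (+ 1 * (s * + 0)) ≡ + 2 * (+ 1 - t)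
      simplify = solve-∀
    R-w : R w ≡ + 2 * (+ 1 - ε * τ)
    R-w = trans (R-form {w} (trans (χ-inverse a w aw≈1) χa) χw-1 (χ-0 (c-diff aw≈1))) (simplify (ε * τ) (is-1 (ε * τ)))
      where
      expand : ∀ a w → a * (w - + 1) - - (a - + 1) ≡ + 1 * (a * w - + 1)
      expand = solve-∀
      χw-1 : χ (w - + 1) ≡ ε * τ
      χw-1 = trans (χ-cancel a (w - + 1) (- (a - + 1)) χa (c-comb₁ (+ 1) (c-diff aw≈1) (expand a w))) (χ-neg (a - + 1))
      simplify : ∀ t s → (+ 1 + + 1) * (+ 1 - t) * (+ 1 - + 0) - + 8 * (+ 1 * (+ 0 * s)) ≡ + 2 * (+ 1 - t)
      simplify = solve-∀

  -- The scaling y ↦ -s²y carries the roots 0, 1, 1/s² to 0, -s², -1 and pulls out the factor -s⁴,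
  -- whose symbol is χ(-1).
  legendre-curve : ∀ s → s ≉ + 0 →
    ∑F (λ y → χ (y * (y + + 1) * (y + s * s))) ≡ χ (- + 1) * cubic (s * s)
  legendre-curve s s≉0 = begin
    ∑F f                                                   ≡⟨ ∑F-scale (- (s * s)) f-respects -s²≉0 ⟨
    ∑F (λ y → f (- (s * s) * y))                           ≡⟨ ∑F-cong (λ y → trans (cong χ (substitute s y))
        (trans (χ-square-* (s * s) (- + 1 * (y * (y - + 1) * (s * s * y - + 1))) (domain-≉ s≉0 s≉0)) (χ-* (- + 1) (y * (y - + 1) * (s * s * y - + 1))))) ⟩
    ∑F (λ y → χ (- + 1) * χ (y * (y - + 1) * (s * s * y - + 1)))   ≡⟨ ∑F-* (χ (- + 1)) (λ y → χ (y * (y - + 1) * (s * s * y - + 1))) ⟩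
    χ (- + 1) * cubic (s * s)                              ∎
    where
    f : ℤ → ℤ
    f y = χ (y * (y + + 1) * (y + s * s))
    f-respects : Respects f
    f-respects y≈z = χ-respects (c-* (c-* y≈z (c-+ y≈z c-refl)) (c-+ y≈z c-refl))
    -s²≉0 : - (s * s) ≉ + 0
    -s²≉0 h = domain-≉ s≉0 s≉0 (c-respˡ (c-neg h) (sym (ℤₚ.neg-involutive (s * s))))
    substitute : ∀ s y → - (s * s) * y * (- (s * s) * y + + 1) * (- (s * s) * y + s * s)
               ≡ s * s * (s * s) * (- + 1 * (y * (y - + 1) * (s * s * y - + 1)))
    substitute = solve-∀

  -- The square (y + 1)² drops out of the symbol except at y = -1, so the sum is that of χ with the
  -- one term χ(-1) missing.
  legendre-curve-degenerate : ∑F (λ y → χ (y * (y + + 1) * (y + + 1))) ≡ - χ (- + 1)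
  legendre-curve-degenerate = begin
    ∑F (λ y → χ (y * (y + + 1) * (y + + 1)))              ≡⟨ ∑F-cong split ⟩
    ∑F (λ y → χ y - ⟦ y ≈? - + 1 ⟧ * χ y)                 ≡⟨ ∑F-- χ (λ y → ⟦ y ≈? - + 1 ⟧ * χ y) ⟩
    ∑F χ - ∑F (λ y → ⟦ y ≈? - + 1 ⟧ * χ y)                ≡⟨ cong₂ _-_ ∑F-χ (∑F-δ (- + 1) χ-respects) ⟩
    + 0 - χ (- + 1)                                       ≡⟨ ℤₚ.+-identityˡ (- χ (- + 1)) ⟩
    - χ (- + 1)                                           ∎
    where
    regroup : ∀ y → y * (y + + 1) * (y + + 1) ≡ (y + + 1) * (y + + 1) * y
    regroup = solve-∀
    shift : ∀ y → y - - + 1 ≡ + 1 * (y + + 1)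
    shift = solve-∀
    self-cancel : ∀ z → + 0 ≡ z - + 1 * z
    self-cancel = solve-∀
    split : ∀ y → χ (y * (y + + 1) * (y + + 1)) ≡ χ y - ⟦ y ≈? - + 1 ⟧ * χ y
    split y with y ≈? - + 1
    ... | yes y≈-1 = trans (χ-*-0ʳ (y * (y + + 1)) (c-+ y≈-1 (c-refl {a = + 1}))) (self-cancel (χ y))
    ... | no y≉-1  = trans (cong χ (regroup y)) (trans
          (χ-square-* (y + + 1) y (λ h → y≉-1 (c-comb₁ (+ 1) h (shift y)))) (sym (ℤₚ.+-identityʳ (χ y))))

  -- The analogue of `eight-N` for s² = 1, where the two nonresidue conditions coincide and only the
  -- points 0 and 1 are exceptional.
  four-N : + p + + 1 - + 4 * N (+ 1) ≡ + 1 - χ (- + 1) + + 2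
  four-N = begin
    + p + + 1 - + 4 * N (+ 1)                       ≡⟨ cong₂ _-_ total (∑F-* (+ 4) (g (+ 1))) ⟨
    ∑F W - ∑F (λ y → + 4 * g (+ 1) y)               ≡⟨ ∑F-- W (λ y → + 4 * g (+ 1) y) ⟨
    ∑F R                                            ≡⟨ ∑F-two (+ 0) (+ 1) R-respects (1≉0 ∘ c-sym) R-vanish ⟩
    R (+ 0) + R (+ 1)                               ≡⟨ cong₂ _+_ (trans (R-form {+ 0} (χ-0 c-refl) refl refl) (simplify (χ (- + 1))))
                                                         (R-form {+ 1} χ-1 (χ-0 c-refl) (χ-0 c-refl)) ⟩
    + 1 - χ (- + 1) + + 2                           ∎
    where
    W R : ℤ → ℤ
    W y = (+ 1 + χ y) * (+ 1 - χ (y - + 1))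
    R y = W y - + 4 * g (+ 1) y
    R-respects : Respects R
    R-respects y≈z = cong₂ (λ u v → u - + 4 * v)
      (cong₂ (λ u v → (+ 1 + u) * (+ 1 - v)) (χ-respects y≈z) (χ-respects (c-- y≈z c-refl))) (g-respects (+ 1) y≈z)
    R-form : ∀ {y u v x} → χ y ≡ u → χ (y - + 1) ≡ v → χ (+ 1 * y - + 1) ≡ x →
             R y ≡ (+ 1 + u) * (+ 1 - v) - + 4 * (is1 u * (is-1 x * is-1 v))
    R-form refl refl refl = refl
    R-vanish : ∀ y → y ≉ + 0 → y ≉ + 1 → R y ≡ + 0
    R-vanish y y≉0 y≉1 = trans (R-form {y} refl refl (cong (λ z → χ (z - + 1)) (ℤₚ.*-identityˡ y)))
      (four-products (χ-unit y≉0) (χ-unit (λ h → y≉1 (c-undiff h))))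
    simplify : ∀ e → (+ 1 + + 0) * (+ 1 - e) - + 4 * + 0 ≡ + 1 - e
    simplify = solve-∀
    drop-zeros : ∀ p → p + + 0 - + 0 - - + 1 ≡ p + + 1
    drop-zeros = solve-∀
    expand : ∀ u v → (+ 1 + u) * (+ 1 - v) ≡ + 1 + u - v - u * v
    expand = solve-∀
    total : ∑F W ≡ + p + + 1
    total = begin
      ∑F W                                                    ≡⟨ ∑F-cong (λ y → trans (expand (χ y) (χ (y - + 1))) (cong (λ z → + 1 + χ y - χ (y - + 1) - z) (sym (χ-* y (y - + 1))))) ⟩
      ∑F (λ y → + 1 + χ y - χ (y - + 1) - χ (y * (y - + 1)))  ≡⟨ trans (∑F-- (λ y → + 1 + χ y - χ (y - + 1)) (λ y → χ (y * (y - + 1))))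
          (cong (_- ∑F (λ y → χ (y * (y - + 1)))) (trans (∑F-- (λ y → + 1 + χ y) (λ y → χ (y - + 1)))
            (cong (_- ∑F (λ y → χ (y - + 1))) (∑F-+ (λ _ → + 1) χ)))) ⟩
      ∑F (λ _ → + 1) + ∑F χ - ∑F (λ y → χ (y - + 1)) - ∑F (λ y → χ (y * (y - + 1)))
        ≡⟨ cong₂ _-_ (cong₂ _-_ (cong₂ _+_ ∑F-one ∑F-χ) ∑F-χ-shift) ∑F-χ-y[y-1] ⟩
      + p + + 0 - + 0 - - + 1                                 ≡⟨ drop-zeros (+ p) ⟩
      + p + + 1                                               ∎

  -- The residue of a j modulo p exceeds p/2 iff ⌊2 a j / p⌋ is odd.
  neg-floor : ∀ c j → j < n → let a = suc c in
    neg (+ a * + suc j) ≈₂ ∑ c (λ l → ⟦ suc l ℕ.* p ℕ.≤? (a ℕ.+ a) ℕ.* suc j ⟧)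
  neg-floor c j j<n = c-respˡ (cases (n ℕ.<? ρ)) neg≡⟦n<ρ⟧
    where
    instance p≢0 = ℕ.>-nonZero 0<p
    a = suc c
    m = (a ℕ.+ a) ℕ.* suc j
    t = a ℕ.* suc j
    k = t ℕ./ p
    ρ = t ℕ.% p
    ρ<p : ρ < p
    ρ<p = m%n<n t p
    t≡ : t ≡ ρ ℕ.+ k ℕ.* p
    t≡ = m≡m%n+[m/n]*n t p
    m≡ : m ≡ (k ℕ.+ k) ℕ.* p ℕ.+ (ρ ℕ.+ ρ)
    m≡ = trans (ℕₚ.*-distribʳ-+ (suc j) a a) (trans (cong₂ ℕ._+_ t≡ t≡) (regroup ρ k p))
      where
      regroup : ∀ ρ k p → ρ ℕ.+ k ℕ.* p ℕ.+ (ρ ℕ.+ k ℕ.* p) ≡ (k ℕ.+ k) ℕ.* p ℕ.+ (ρ ℕ.+ ρ)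
      regroup = ℕ-Ring.solve-∀
    neg≡⟦n<ρ⟧ : neg (+ a * + suc j) ≡ ⟦ n ℕ.<? ρ ⟧
    neg≡⟦n<ρ⟧ = cong (λ r → ⟦ n ℕ.<? r ⟧) (trans
      (modp-unique 0<p (cong-by (+ k) (trans (sym (ℤₚ.pos-* a (suc j))) (trans (cong +_ t≡)
        (trans (ℤₚ.pos-+ ρ (k ℕ.* p)) (cong (_+_ (+ ρ)) (ℤₚ.pos-* k p)))))))
      (modp-small ρ<p))
    -- Since 2j < p on S, the floor ⌊2aj/p⌋ stays below a, and c = a - 1 thresholds suffice.
    m<ap : m < a ℕ.* p
    m<ap = ℕₚ.≤-<-trans
      (ℕₚ.≤-trans (ℕₚ.≤-reflexive (trans (ℕₚ.*-distribʳ-+ (suc j) a a) (sym (ℕₚ.*-distribˡ-+ a (suc j) (suc j)))))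
                  (ℕₚ.*-monoʳ-≤ a (ℕₚ.+-mono-≤ j<n j<n)))
      (ℕₚ.*-monoʳ-< a (subst (n ℕ.+ n <_) (sym p≡1+n+n) ℕₚ.≤-refl))
    count : ∀ K → K ℕ.* p ℕ.≤ m → m < suc K ℕ.* p → ∑ c (λ l → ⟦ suc l ℕ.* p ℕ.≤? m ⟧) ≡ + K
    count K lo hi = count-multiples c K p m (ℕₚ.≤-pred (ℕₚ.*-cancelʳ-< p K a (ℕₚ.≤-<-trans lo m<ap))) lo hi
    double : ∀ k → k + k ≡ + 0 + k * + 2
    double = solve-∀
    double-suc : ∀ k → + 1 + (k + k) ≡ + 1 + k * + 2
    double-suc = solve-∀
    cases : (d : Dec (n < ρ)) → ⟦ d ⟧ ≈₂ ∑ c (λ l → ⟦ suc l ℕ.* p ℕ.≤? m ⟧)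
    cases (no n≮ρ) = c-sym (c-respˡ (cong-by (+ k) (double (+ k)))
      (count (k ℕ.+ k) (subst ((k ℕ.+ k) ℕ.* p ℕ.≤_) (sym m≡) (ℕₚ.m≤m+n ((k ℕ.+ k) ℕ.* p) (ρ ℕ.+ ρ)))
        (subst (_< suc (k ℕ.+ k) ℕ.* p) (sym m≡) (subst (((k ℕ.+ k) ℕ.* p ℕ.+ (ρ ℕ.+ ρ)) <_) (ℕₚ.+-comm ((k ℕ.+ k) ℕ.* p) p)
          (ℕₚ.+-monoʳ-< ((k ℕ.+ k) ℕ.* p) (subst (ρ ℕ.+ ρ <_) (sym p≡1+n+n) (s≤s (ℕₚ.+-mono-≤ ρ≤n ρ≤n))))))))
      where ρ≤n = ℕₚ.≮⇒≥ n≮ρ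
    cases (yes n<ρ) = c-sym (c-respˡ (cong-by (+ k) (double-suc (+ k)))
      (count (suc (k ℕ.+ k))
        (subst (suc (k ℕ.+ k) ℕ.* p ℕ.≤_) (sym m≡) (subst (ℕ._≤ (k ℕ.+ k) ℕ.* p ℕ.+ (ρ ℕ.+ ρ)) (ℕₚ.+-comm ((k ℕ.+ k) ℕ.* p) p)
          (ℕₚ.+-monoʳ-≤ ((k ℕ.+ k) ℕ.* p) (subst (ℕ._≤ ρ ℕ.+ ρ) (sym p≡1+n+n) (ℕₚ.+-mono-≤ n<ρ (ℕₚ.<⇒≤ n<ρ))))))
        (subst (_< suc (suc (k ℕ.+ k)) ℕ.* p) (sym m≡) (subst (((k ℕ.+ k) ℕ.* p ℕ.+ (ρ ℕ.+ ρ)) <_) (regroup k p)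
          (ℕₚ.+-monoʳ-< ((k ℕ.+ k) ℕ.* p) (ℕₚ.+-mono-< ρ<p ρ<p))))))
      where
      regroup : ∀ k p → (k ℕ.+ k) ℕ.* p ℕ.+ (p ℕ.+ p) ≡ suc (suc (k ℕ.+ k)) ℕ.* p
      regroup = ℕ-Ring.solve-∀

  -- Exchanging the sums groups the j by threshold; in this form the dependence on p can be
  -- followed.
  b-crossings : ∀ c → + suc c ≉ + 0 → b (+ suc c) ≈₂ ∑ c (crossings p n (suc c))
  b-crossings c a≉0 = c-trans (c-sym (gauss a≉0))
    (c-respʳ (∑-cong-mod n (neg-floor c)) (∑-swap n c (λ j l → ⟦ suc l ℕ.* p ℕ.≤? (suc c ℕ.+ suc c) ℕ.* suc j ⟧)))

-- Replacing p by p + 4aq and n by n + 2aq moves the threshold (l + 1) p / 2a for suc j by the even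
-- number 2q (l + 1), so the count grows by 2q (a - l - 1).
crossings-periodic : ∀ a p n q l → 0 < p → suc l ℕ.≤ a → p ≡ suc (n ℕ.+ n) →
  crossings (p ℕ.+ q ℕ.* (4 ℕ.* a)) (n ℕ.+ (q ℕ.+ q) ℕ.* a) a l ≈₂ crossings p n a l
crossings-periodic a p n q l 0<p l<a p≡ = c-respˡ (cong-by (+ (q ℕ.* e)) (begin
    ∑ n F₁ + + ((q ℕ.+ q) ℕ.* e)                    ≡⟨ cong (λ z → ∑ n F₁ + + z) (ℕₚ.*-distribʳ-+ e q q) ⟩
    ∑ n F₁ + (+ (q ℕ.* e) + + (q ℕ.* e))            ≡⟨ double (∑ n F₁) (+ (q ℕ.* e)) ⟩
    ∑ n F₁ + + (q ℕ.* e) * + 2                      ∎)) (begin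
    ∑ (n ℕ.+ Q ℕ.* a) F₂                            ≡⟨ cong (λ m → ∑ m F₂) n₂≡ ⟩
    ∑ (sh ℕ.+ (n ℕ.+ Q ℕ.* e)) F₂                   ≡⟨ ∑-split sh (n ℕ.+ Q ℕ.* e) F₂ ⟩
    ∑ sh F₂ + ∑ (n ℕ.+ Q ℕ.* e) (λ i → F₂ (sh ℕ.+ i))  ≡⟨ cong₂ _+_ (∑-zero sh below) (∑-cong (n ℕ.+ Q ℕ.* e) (λ i _ → shifted i)) ⟩
    + 0 + ∑ (n ℕ.+ Q ℕ.* e) F₁                      ≡⟨ ℤₚ.+-identityˡ _ ⟩
    ∑ (n ℕ.+ Q ℕ.* e) F₁                            ≡⟨ ∑-split n (Q ℕ.* e) F₁ ⟩
    ∑ n F₁ + ∑ (Q ℕ.* e) (λ i → F₁ (n ℕ.+ i))       ≡⟨ cong (_+_ (∑ n F₁)) (∑-cong (Q ℕ.* e) (λ i _ → above i)) ⟩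
    ∑ n F₁ + ∑ (Q ℕ.* e) (λ _ → + 1)                ≡⟨ cong (_+_ (∑ n F₁)) (trans (∑-const (Q ℕ.* e) (+ 1)) (ℤₚ.*-identityʳ (+ (Q ℕ.* e)))) ⟩
    ∑ n F₁ + + (Q ℕ.* e)                            ∎)
  where
  Q = q ℕ.+ q
  A = a ℕ.+ a
  L = suc l
  e = a ℕ.∸ L
  sh = Q ℕ.* L
  p₂ = p ℕ.+ q ℕ.* (4 ℕ.* a)
  F₁ F₂ : ℕ → ℤ
  F₁ j = ⟦ L ℕ.* p ℕ.≤? A ℕ.* suc j ⟧
  F₂ j = ⟦ L ℕ.* p₂ ℕ.≤? A ℕ.* suc j ⟧
  double : ∀ x y → x + (y + y) ≡ x + y * + 2
  double = solve-∀
  n₂≡ : n ℕ.+ Q ℕ.* a ≡ sh ℕ.+ (n ℕ.+ Q ℕ.* e)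
  n₂≡ = trans (cong (λ z → n ℕ.+ Q ℕ.* z) (sym (ℕₚ.m+[n∸m]≡n l<a))) (regroup n Q L e)
    where
    regroup : ∀ n Q L e → n ℕ.+ Q ℕ.* (L ℕ.+ e) ≡ Q ℕ.* L ℕ.+ (n ℕ.+ Q ℕ.* e)
    regroup = ℕ-Ring.solve-∀
  Lp₂≡ : L ℕ.* p₂ ≡ A ℕ.* sh ℕ.+ L ℕ.* p
  Lp₂≡ = regroup L p q a
    where
    regroup : ∀ L p q a → L ℕ.* (p ℕ.+ q ℕ.* (4 ℕ.* a)) ≡ (a ℕ.+ a) ℕ.* ((q ℕ.+ q) ℕ.* L) ℕ.+ L ℕ.* p
    regroup = ℕ-Ring.solve-∀
  below : ∀ j → j < sh → F₂ j ≡ + 0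
  below j j<sh = ⟦⟧-no (L ℕ.* p₂ ℕ.≤? A ℕ.* suc j) (ℕₚ.<⇒≱ (subst (A ℕ.* suc j <_) (sym Lp₂≡)
    (ℕₚ.≤-<-trans (ℕₚ.*-monoʳ-≤ A j<sh) (ℕₚ.m<m+n (A ℕ.* sh) (ℕₚ.≤-trans 0<p (ℕₚ.m≤m+n p (l ℕ.* p)))))))
  shifted : ∀ i → F₂ (sh ℕ.+ i) ≡ F₁ i
  shifted i = ⟦⟧-⇔ (L ℕ.* p₂ ℕ.≤? A ℕ.* suc (sh ℕ.+ i)) (L ℕ.* p ℕ.≤? A ℕ.* suc i)
    (λ h → ℕₚ.+-cancelˡ-≤ (A ℕ.* sh) _ _ (subst (ℕ._≤ A ℕ.* sh ℕ.+ A ℕ.* suc i) Lp₂≡ (subst (L ℕ.* p₂ ℕ.≤_) rhs≡ h)))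
    (λ h → subst (L ℕ.* p₂ ℕ.≤_) (sym rhs≡) (subst (ℕ._≤ A ℕ.* sh ℕ.+ A ℕ.* suc i) (sym Lp₂≡) (ℕₚ.+-monoʳ-≤ (A ℕ.* sh) h)))
    where
    rhs≡ : A ℕ.* suc (sh ℕ.+ i) ≡ A ℕ.* sh ℕ.+ A ℕ.* suc i
    rhs≡ = trans (cong (A ℕ.*_) (sym (ℕₚ.+-suc sh i))) (ℕₚ.*-distribˡ-+ A sh (suc i))
  -- Numbers j > n satisfy 2j ≥ p and so lie past every threshold with l + 1 ≤ a.
  above : ∀ i → F₁ (n ℕ.+ i) ≡ + 1
  above i = ⟦⟧-yes (L ℕ.* p ℕ.≤? A ℕ.* suc (n ℕ.+ i)) (ℕₚ.≤-trans (ℕₚ.*-mono-≤ l<a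
      (ℕₚ.≤-trans (ℕₚ.≤-reflexive p≡) (ℕₚ.+-mono-≤ (s≤s (ℕₚ.m≤m+n n i)) (ℕₚ.≤-trans (ℕₚ.m≤m+n n i) (ℕₚ.n≤1+n _)))))
    (ℕₚ.≤-reflexive (regroup a (suc (n ℕ.+ i)))))
    where
    regroup : ∀ a j → a ℕ.* (j ℕ.+ j) ≡ (a ℕ.+ a) ℕ.* j
    regroup = ℕ-Ring.solve-∀

bit-parity : ∀ {P Q : Set} (d : Dec P) (e : Dec Q) → ⟦ d ⟧ ≈₂ ⟦ e ⟧ → ⟦ d ⟧ ≡ ⟦ e ⟧
bit-parity (yes _) (yes _) _ = refl
bit-parity (no _)  (no _)  _ = refl
bit-parity (yes _) (no _) h with () ← modp-unique {2} (s≤s z≤n) h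
bit-parity (no _) (yes _) h with () ← modp-unique {2} (s≤s z≤n) h

crossings-sum-periodic : ∀ c p n q → 0 < p → p ≡ suc (n ℕ.+ n) → let a = suc c in
  ∑ c (crossings (p ℕ.+ q ℕ.* (4 ℕ.* a)) (n ℕ.+ (q ℕ.+ q) ℕ.* a) a) ≈₂ ∑ c (crossings p n a)
crossings-sum-periodic c p n q 0<p p≡ =
  ∑-cong-mod c (λ l l<c → crossings-periodic (suc c) p n q l 0<p (ℕₚ.m<n⇒m<1+n l<c) p≡)

is-1-injective : ∀ {x y} → ±1 x → ±1 y → is-1 x ≡ is-1 y → x ≡ y
is-1-injective +one +one _ = refl
is-1-injective -one -one _ = refl

record OddPrime (p : ℕ) : Set where
  constructor odd-prime
  field
    half    : ℕ
    p≡      : p ≡ suc (half ℕ.+ half)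
    isPrime : Prime p

module Field {p} (o : OddPrime p) where
  open OddPrime o public
  open Residues p half p≡ isPrime public

open Field using (χ; N; b)

half-shift : ∀ {p₁ p₂} (o₁ : OddPrime p₁) (o₂ : OddPrime p₂) q c → p₂ ≡ p₁ ℕ.+ q ℕ.* (4 ℕ.* c) →
  OddPrime.half o₂ ≡ OddPrime.half o₁ ℕ.+ (q ℕ.+ q) ℕ.* c
half-shift (odd-prime n₁ refl _) (odd-prime n₂ refl _) q c eq = ℕₚ.*-cancelˡ-≡ n₂ _ 2
  (trans (double n₂) (trans (ℕₚ.suc-injective eq) (regroup n₁ q c)))
  where
  double : ∀ n → 2 ℕ.* n ≡ n ℕ.+ n
  double = ℕ-Ring.solve-∀
  regroup : ∀ n q c → n ℕ.+ n ℕ.+ q ℕ.* (4 ℕ.* c) ≡ 2 ℕ.* (n ℕ.+ (q ℕ.+ q) ℕ.* c)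
  regroup = ℕ-Ring.solve-∀

χ-periodic-pos : ∀ {p₁ p₂} (o₁ : OddPrime p₁) (o₂ : OddPrime p₂) q c → p₂ ≡ p₁ ℕ.+ q ℕ.* (4 ℕ.* suc c) →
  Field._≉_ o₁ (+ suc c) (+ 0) → Field._≉_ o₂ (+ suc c) (+ 0) → χ o₁ (+ suc c) ≡ χ o₂ (+ suc c)
χ-periodic-pos {p₁} {p₂} o₁ o₂ q c p₂≡ a≉₁0 a≉₂0 =
  is-1-injective (Field.χ-unit o₁ a≉₁0) (Field.χ-unit o₂ a≉₂0)
    (bit-parity (χ o₁ (+ suc c) ℤₚ.≟ - + 1) (χ o₂ (+ suc c) ℤₚ.≟ - + 1)
      (c-trans (Field.b-crossings o₁ c a≉₁0) (c-trans (c-sym shifted) (c-sym (Field.b-crossings o₂ c a≉₂0)))))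
  where
  shifted : ∑ c (crossings p₂ (OddPrime.half o₂) (suc c)) ≈₂ ∑ c (crossings p₁ (OddPrime.half o₁) (suc c))
  shifted = c-respˡ (crossings-sum-periodic c p₁ (OddPrime.half o₁) q (Field.0<p o₁) (OddPrime.p≡ o₁))
    (cong₂ (λ p n → ∑ c (crossings p n (suc c))) p₂≡ (half-shift o₁ o₂ q (suc c) p₂≡))

-- Periodicity of the Legendre symbol in the prime

pos-shift : ∀ {u v} q m → + u ≡ + v + + q * + m → u ≡ v ℕ.+ q ℕ.* m
pos-shift {v = v} q m eq = ℤₚ.+-injective
  (trans eq (trans (cong (_+_ (+ v)) (sym (ℤₚ.pos-* q m))) (sym (ℤₚ.pos-+ v (q ℕ.* m)))))

Cong⇒shift : ∀ {m p₁ p₂} → Cong (+ m) (+ p₁) (+ p₂) → (∃ λ q → p₁ ≡ p₂ ℕ.+ q ℕ.* m) ⊎ (∃ λ q → p₂ ≡ p₁ ℕ.+ q ℕ.* m)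
Cong⇒shift {m} (cong-by (+ q) eq)   = inj₁ (q , pos-shift q m eq)
Cong⇒shift {m} (cong-by -[1+ j ] eq) = inj₂ (suc j , pos-shift (suc j) m (swap (+ suc j) (+ m) eq))
  where
  swap : ∀ {r s} k m → r ≡ s + (- k) * m → s ≡ r + k * m
  swap {s = s} k m refl = solve (s ∷ k ∷ m ∷ [])

Cong-∣ : ∀ {d m a b} → d ℕᵈ.∣ m → Cong (+ m) a b → Cong (+ d) a b
Cong-∣ {d} {b = v} (ℕᵈ.divides k refl) (cong-by l refl) = cong-by (l * + k) (cong (_+_ v) (trans (cong (l *_) (ℤₚ.pos-* k d)) (sym (ℤₚ.*-assoc l (+ k) (+ d)))))

χ-1-periodic : ∀ {p₁ p₂} (o₁ : OddPrime p₁) (o₂ : OddPrime p₂) → Cong (+ 4) (+ p₁) (+ p₂) → χ o₁ (- + 1) ≡ χ o₂ (- + 1)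
χ-1-periodic o₁@(odd-prime n₁ refl _) o₂@(odd-prime n₂ refl _) p₁≡p₂ =
  is-1-injective (Field.χ-unit o₁ (Field.-1≉0 o₁)) (Field.χ-unit o₂ (Field.-1≉0 o₂))
    (bit-parity (χ o₁ (- + 1) ℤₚ.≟ - + 1) (χ o₂ (- + 1) ℤₚ.≟ - + 1)
      (c-trans (Field.b-minus-one o₁) (c-trans halves (c-sym (Field.b-minus-one o₂)))))
  where
  strip : ∀ n m → + 2 * n - + 2 * m ≡ + 1 * (+ 1 + (n + n) - (+ 1 + (m + m)))
  strip = solve-∀
  halves : + n₁ ≈₂ + n₂
  halves = c-cancel (+ 2) (+ 2) (c-comb₁ (+ 1) (c-diff p₁≡p₂) (strip (+ n₁) (+ n₂)))

-- For positive c one prime is a shift of the other by a multiple of 4c. For negative c the extra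
-- factor χ(-1) depends only on p modulo 4, which the period 4|c| determines.
χ-periodic : ∀ {p₁ p₂} (o₁ : OddPrime p₁) (o₂ : OddPrime p₂) c → c ≢ + 0 → Cong (+ (4 ℕ.* ℤ.∣ c ∣)) (+ p₁) (+ p₂) →
  Field._≉_ o₁ c (+ 0) → Field._≉_ o₂ c (+ 0) → χ o₁ c ≡ χ o₂ c
χ-periodic o₁ o₂ (+ 0) c≢0 _ _ _ = ⊥-elim (c≢0 refl)
χ-periodic o₁ o₂ (+ suc c) _ p₁≡p₂ c≉₁0 c≉₂0 with Cong⇒shift p₁≡p₂
... | inj₁ (q , eq) = sym (χ-periodic-pos o₂ o₁ q c eq c≉₂0 c≉₁0)
... | inj₂ (q , eq) = χ-periodic-pos o₁ o₂ q c eq c≉₁0 c≉₂0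
χ-periodic o₁ o₂ -[1+ c ] _ p₁≡p₂ c≉₁0 c≉₂0 = begin
  χ o₁ (- + suc c)                    ≡⟨ Field.χ-neg o₁ (+ suc c) ⟩
  χ o₁ (- + 1) * χ o₁ (+ suc c)       ≡⟨ cong₂ _*_ (χ-1-periodic o₁ o₂ (Cong-∣ (ℕᵈ.divides (suc c) (ℕₚ.*-comm 4 (suc c))) p₁≡p₂))
                                           (χ-periodic o₁ o₂ (+ suc c) (λ ()) p₁≡p₂ (c≉₁0 ∘ c-neg) (c≉₂0 ∘ c-neg)) ⟩
  χ o₂ (- + 1) * χ o₂ (+ suc c)       ≡⟨ Field.χ-neg o₂ (+ suc c) ⟨
  χ o₂ (- + suc c)                    ∎

-- Products over pairs and the two formulas

-- The relation x = (-1)^e. It sees e only modulo 2, so a product of symbols is found from a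
-- congruence for the sum of its exponents.
data SignOf : ℤ → ℤ → Set where
  even : ∀ {e} → e ≈₂ + 0 → SignOf (+ 1) e
  odd  : ∀ {e} → e ≈₂ + 1 → SignOf (- + 1) e

SignOf-* : ∀ {x y e f} → SignOf x e → SignOf y f → SignOf (x * y) (e + f)
SignOf-* (even h) (even k) = even (c-+ h k)
SignOf-* (even h) (odd k)  = odd (c-+ h k)
SignOf-* (odd h) (even k)  = odd (c-+ h k)
SignOf-* (odd h) (odd k)   = even (c-trans (c-+ h k) (cong-by (+ 1) refl))

SignOf-resp : ∀ {x e f} → f ≈₂ e → SignOf x e → SignOf x f
SignOf-resp h (even k) = even (c-trans h k)
SignOf-resp h (odd k)  = odd (c-trans h k)

1≉₂0 : ¬ + 1 ≈₂ + 0
1≉₂0 h with () ← modp-unique {2} (s≤s z≤n) h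

SignOf-unique : ∀ {x y e} → SignOf x e → SignOf y e → x ≡ y
SignOf-unique (even _) (even _) = refl
SignOf-unique (even h) (odd k)  = ⊥-elim (1≉₂0 (c-trans (c-sym k) h))
SignOf-unique (odd h) (even k)  = ⊥-elim (1≉₂0 (c-trans (c-sym h) k))
SignOf-unique (odd _) (odd _)   = refl

module _ {A : Set} where

  listSum : (A → ℤ) → List A → ℤ
  listSum h xs = foldr _+_ (+ 0) (map h xs)

  listSum-++ : ∀ h xs ys → listSum h (xs ++ ys) ≡ listSum h xs + listSum h ys
  listSum-++ h []       ys = sym (ℤₚ.+-identityˡ _)
  listSum-++ h (x ∷ xs) ys = trans (cong (_+_ (h x)) (listSum-++ h xs ys)) (sym (ℤₚ.+-assoc (h x) _ _))

  listSum-applyUpTo : ∀ h (f : ℕ → A) n → listSum h (applyUpTo f n) ≡ ∑ n (h ∘ f)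
  listSum-applyUpTo h f zero    = refl
  listSum-applyUpTo h f (suc n) = trans (cong (_+_ (h (f 0))) (listSum-applyUpTo h (f ∘ suc) n)) (sym (∑-first n (h ∘ f)))

listSum-map : ∀ {A B : Set} h (f : A → B) xs → listSum h (map f xs) ≡ listSum (h ∘ f) xs
listSum-map h f []       = refl
listSum-map h f (x ∷ xs) = cong (_+_ (h (f x))) (listSum-map h f xs)

listSum-concatMap : ∀ {A B : Set} h (f : A → List B) xs → listSum h (concatMap f xs) ≡ listSum (listSum h ∘ f) xs
listSum-concatMap h f []       = refl
listSum-concatMap h f (x ∷ xs) = trans (listSum-++ h (f x) (concatMap f xs)) (cong (_+_ (listSum h (f x))) (listSum-concatMap h f xs))

listSum-halfPairs : ∀ p h → listSum h (halfPairs p) ≡ ∑ (p ℕ./ 2) (λ k → ∑ k (λ i → h (suc i ,, suc k)))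
listSum-halfPairs p h = trans (listSum-concatMap h row (applyUpTo suc (p ℕ./ 2))) (trans
  (listSum-applyUpTo (listSum h ∘ row) suc (p ℕ./ 2))
  (∑-cong (p ℕ./ 2) (λ k _ → trans (listSum-map h (_,, suc k) (applyUpTo suc k)) (listSum-applyUpTo (h ∘ (_,, suc k)) suc k))))
  where
  row : ℕ → List Pair
  row j = map (λ i → i ,, j) (applyUpTo suc (ℕ.pred j))

-- A removed entry has even exponent, so the exponents may be summed over the unfiltered list.
prodℤ-filter : ∀ {A : Set} {P : A → Set} {c e : A → ℤ} (P? : ∀ x → Dec (P x)) →
  (∀ x → P x → SignOf (c x) (e x)) → (∀ x → ¬ P x → e x ≈₂ + 0) →
  ∀ xs → SignOf (prodℤ (map c (filter P? xs))) (listSum e xs)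
prodℤ-filter P? kept dropped [] = even c-refl
prodℤ-filter {e = e} P? kept dropped (x ∷ xs) with P? x
... | yes px = SignOf-* (kept x px) (prodℤ-filter P? kept dropped xs)
... | no ¬px = SignOf-resp (c-respʳ (c-+ (dropped x ¬px) (c-refl {a = listSum e xs})) (ℤₚ.+-identityˡ _))
                           (prodℤ-filter P? kept dropped xs)

half-floor : ∀ n → suc (n ℕ.+ n) ℕ./ 2 ≡ n
half-floor n = trans (cong (λ m → suc m ℕ./ 2) (regroup n)) (trans (+-distrib-/-∣ʳ 1 {n ℕ.* 2} {2} (ℕᵈ.divides n refl)) (m*n/n≡m n 2))
  where
  regroup : ∀ n → n ℕ.+ n ≡ n ℕ.* 2
  regroup = ℕ-Ring.solve-∀

module _ {p} (o : OddPrime p) where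
  open Field o using (χ-unit; _≉_; _≈_; 0<p; p≡; half; ∑S)

  prodLeg-list : ∀ (f : Pair → ℤ) xs →
    SignOf (prodℤ (map (λ x → legendre p (f x)) (filter (λ x → ¬? (modp p (f x) ℕ.≟ 0)) xs))) (listSum (λ x → b o (f x)) xs)
  prodLeg-list f = prodℤ-filter (λ x → ¬? (modp p (f x) ℕ.≟ 0))
    (λ x f≢0 → unit-sign (χ-unit (λ h → f≢0 (trans (modp-unique 0<p h) (modp-small 0<p)))))
    (λ x f≡0 → c-reflexive (Field.b-0 o (modp-reflect 0<p
      (trans (decidable-stable (modp p (f x) ℕ.≟ 0) f≡0) (sym (modp-small 0<p))))))
    where
    unit-sign : ∀ {c} → ±1 c → SignOf c (is-1 c)
    unit-sign +one = even c-refl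
    unit-sign -one = odd c-refl

  prodLeg-sign : ∀ f → SignOf (prodLeg p f) (∑ half (λ k → ∑ k (λ i → b o (f (suc i) (suc k)))))
  prodLeg-sign f = SignOf-resp (c-reflexive (sym (trans
    (listSum-halfPairs p (λ x → b o (f (Pair.fst x) (Pair.snd x))))
    (cong (λ m → ∑ m (λ k → ∑ k (λ i → b o (f (suc i) (suc k))))) (trans (cong (ℕ._/ 2) p≡) (half-floor half))))))
    (prodLeg-list (λ x → f (Pair.fst x) (Pair.snd x)) (halfPairs p))

  -- The definition of F_p sums over 1, ..., p and `∑F` over 0, ..., p - 1; a translation by 1
  -- reconciles them.
  Fp01-sum : ∀ m → Fp01 p m ≡ Field.∑F o (λ y → χ o (y * (y + + 1) * (y + m)))
  Fp01-sum m = begin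
    Fp01 p m                                          ≡⟨ listSum-applyUpTo (h ∘ +_) suc p ⟩
    ∑ p (λ k → h (+ suc k))                           ≡⟨ ∑-cong p (λ k _ → cong (h ∘ +_) (ℕₚ.+-comm 1 k)) ⟩
    Field.∑F o (λ y → h (y + + 1))                    ≡⟨ Field.∑F-translate o {h} (+ 1)
      (λ y≈z → Field.χ-respects o (c-* (c-* y≈z (c-+ y≈z c-refl)) (c-+ y≈z c-refl))) ⟩
    Field.∑F o h                                      ∎
    where
    h : ℤ → ℤ
    h y = χ o (y * (y + + 1) * (y + m))

∑-restrict : ∀ k m f → k ℕ.≤ m → ∑ m (λ i → ⟦ + suc i ℤₚ.<? + suc k ⟧ * f i) ≡ ∑ k f
∑-restrict k m f k≤m = begin
  ∑ m F                                                    ≡⟨ cong (λ z → ∑ z F) (ℕₚ.m+[n∸m]≡n k≤m) ⟨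
  ∑ (k ℕ.+ (m ℕ.∸ k)) F                                    ≡⟨ ∑-split k (m ℕ.∸ k) F ⟩
  ∑ k F + ∑ (m ℕ.∸ k) (λ i → F (k ℕ.+ i))                  ≡⟨ cong₂ _+_ (∑-cong k inside) (∑-zero (m ℕ.∸ k) (λ i _ → outside i)) ⟩
  ∑ k f + + 0                                              ≡⟨ ℤₚ.+-identityʳ _ ⟩
  ∑ k f                                                    ∎
  where
  F : ℕ → ℤ
  F i = ⟦ + suc i ℤₚ.<? + suc k ⟧ * f i
  inside : ∀ i → i < k → F i ≡ f i
  inside i i<k = trans (cong (_* f i) (⟦⟧-yes (+ suc i ℤₚ.<? + suc k) (ℤ.+<+ (s≤s i<k)))) (ℤₚ.*-identityˡ (f i))
  outside : ∀ i → F (k ℕ.+ i) ≡ + 0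
  outside i = cong (_* f (k ℕ.+ i)) (⟦⟧-no (+ suc (k ℕ.+ i) ℤₚ.<? + suc k)
    (λ { (ℤ.+<+ (s≤s h)) → ℕₚ.<⇒≱ h (ℕₚ.m≤m+n k i) }))

prodLeg-N : ∀ {p} (o : OddPrime p) a → SignOf (prodLeg p (λ i j → a * + i * + i - + j * + j)) (N o a)
prodLeg-N o a = SignOf-resp (c-trans (c-sym (Field.half-triangle-N o a)) (c-reflexive (∑-cong (OddPrime.half o)
    (λ k k<n → ∑-restrict k (OddPrime.half o) (λ i → b o (a * + suc i * + suc i - + suc k * + suc k)) (ℕₚ.<⇒≤ k<n)))))
  (prodLeg-sign o (λ i j → a * + i * + i - + j * + j))

-- Part (i): reflection i ↦ j - i in each column

∑-palindrome-even : ∀ m {f} → (∀ i j → suc (i ℕ.+ j) ≡ m ℕ.+ m → f i ≡ f j) → ∑ (m ℕ.+ m) f ≈₂ + 0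
∑-palindrome-odd  : ∀ m {f} → (∀ i j → suc (i ℕ.+ j) ≡ suc (m ℕ.+ m) → f i ≡ f j) → ∑ (suc (m ℕ.+ m)) f ≈₂ f m

-- Equal ends cancel modulo 2; iterated, this leaves nothing or the middle term, according to the
-- parity of the length.
∑-peel : ∀ k {f} → f 0 ≡ f (suc k) → ∑ (suc (suc k)) f ≈₂ ∑ k (f ∘ suc)
∑-peel k {f} ends = cong-by (f 0) (trans (cong₂ _+_ (∑-first k f) (sym ends)) (double (f 0) (∑ k (f ∘ suc))))
  where
  double : ∀ a s → a + s + a ≡ s + a * + 2
  double = solve-∀

∑-palindrome-even zero    h = c-refl
∑-palindrome-even (suc m) {f} h = c-respˡ
  (c-trans (∑-peel (m ℕ.+ m) {f} (h 0 (suc (m ℕ.+ m)) (cong suc (sym (ℕₚ.+-suc m m)))))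
    (∑-palindrome-even m (λ i j eq → h (suc i) (suc j) (cong suc (trans (cong suc (ℕₚ.+-suc i j)) (trans (cong suc eq) (sym (ℕₚ.+-suc m m))))))))
  (cong (λ z → ∑ (suc z) f) (ℕₚ.+-suc m m))

∑-palindrome-odd zero    {f} h = c-reflexive (ℤₚ.+-identityˡ (f 0))
∑-palindrome-odd (suc m) {f} h = c-respˡ
  (c-trans (∑-peel (suc (m ℕ.+ m)) {f} (h 0 (suc (suc (m ℕ.+ m))) (cong (suc ∘ suc) (sym (ℕₚ.+-suc m m)))))
    (∑-palindrome-odd m (λ i j eq → h (suc i) (suc j) (cong suc (trans (cong suc (ℕₚ.+-suc i j)) (trans (cong suc eq) (cong suc (sym (ℕₚ.+-suc m m)))))))))
  (cong (λ z → ∑ (suc (suc z)) f) (ℕₚ.+-suc m m))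

data Parity : ℕ → Set where
  twice     : ∀ m → Parity (m ℕ.+ m)
  suc-twice : ∀ m → Parity (suc (m ℕ.+ m))

parity : ∀ n → Parity n
parity zero    = twice 0
parity (suc n) with parity n
... | twice m     = suc-twice m
... | suc-twice m = subst Parity (cong suc (ℕₚ.+-suc m m)) (twice (suc m))

module _ {p} (o : OddPrime p) (r : ℤ) where
  open OddPrime o

  private
    f : ℕ → ℕ → ℤ
    f i j = + i * + i - + i * + j + r * + j * + j

    β : ℤ
    β = b o (+ 4 * r - + 1)

    reflect : ∀ k i j → suc (i ℕ.+ j) ≡ k → f (suc i) (suc k) ≡ f (suc j) (suc k)
    reflect _ i j refl = trans (cong (λ z → + suc i * + suc i - + suc i * z + r * z * z) sum)
      (trans (swap (+ suc i) (+ suc j) r) (cong (λ z → + suc j * + suc j - + suc j * z + r * z * z) (sym sum)))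
      where
      sum : + suc (suc (i ℕ.+ j)) ≡ + suc i + + suc j
      sum = cong +_ (cong suc (sym (ℕₚ.+-suc i j)))
      swap : ∀ i j r → i * i - i * (i + j) + r * (i + j) * (i + j) ≡ j * j - j * (i + j) + r * (i + j) * (i + j)
      swap = solve-∀

    -- The exponent collected at j = k + 1, so an even index k belongs to an odd j.
    column : ℕ → ℤ
    column k = ∑ k (λ i → b o (f (suc i) (suc k)))

    column-even : ∀ m → column (m ℕ.+ m) ≈₂ + 0
    column-even m = ∑-palindrome-even m (λ i j eq → cong (b o) (reflect (m ℕ.+ m) i j eq))

    -- Here j = 2(m + 1), and the unpaired term i = m + 1 has the value i²(4r - 1).
    column-odd : ∀ m → m < half → column (suc (m ℕ.+ m)) ≈₂ β
    column-odd m m<n = c-respʳ (∑-palindrome-odd m (λ i j eq → cong (b o) (reflect (suc (m ℕ.+ m)) i j eq)))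
      (trans (cong (b o) centre) (cong is-1 (Field.χ-square-* o (+ suc m) (+ 4 * r - + 1) (Field.S≉0 o m<n))))
      where
      factor : ∀ i r → i * i - i * (i + i) + r * (i + i) * (i + i) ≡ i * i * (+ 4 * r - + 1)
      factor = solve-∀
      centre : f (suc m) (suc (suc (m ℕ.+ m))) ≡ + suc m * + suc m * (+ 4 * r - + 1)
      centre = trans (cong (λ z → + suc m * + suc m - + suc m * z + r * z * z) (cong +_ (cong suc (sym (ℕₚ.+-suc m m)))))
        (factor (+ suc m) r)

    columns : ∀ m → m ℕ.≤ half → ∑ (m ℕ.+ m) column ≈₂ + m * β
    columns zero    _ = c-refl
    columns (suc m) m<n = c-respˡ (c-respʳ
      (c-+ (c-+ (columns m (ℕₚ.<⇒≤ m<n)) (column-even m)) (column-odd m m<n)) (step (+ m) β))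
      (cong (λ z → ∑ (suc z) column) (ℕₚ.+-suc m m))
      where
      step : ∀ m β → m * β + + 0 + β ≡ (+ 1 + m) * β
      step = solve-∀

    exponent : ∀ m → half ≡ m ℕ.+ m ⊎ half ≡ suc (m ℕ.+ m) → ∑ half column ≈₂ + m * β
    exponent m (inj₁ eq) = c-respˡ (columns m (subst (m ℕ.≤_) (sym eq) (ℕₚ.m≤m+n m m))) (cong (λ z → ∑ z column) eq)
    exponent m (inj₂ eq) = c-respˡ (c-respʳ (c-+ (columns m (subst (m ℕ.≤_) (sym eq) (ℕₚ.m≤n⇒m≤1+n (ℕₚ.m≤m+n m m)))) (column-even m))
      (ℤₚ.+-identityʳ _)) (cong (λ z → ∑ z column) eq)

  prodLeg-symmetric : ∀ m → half ≡ m ℕ.+ m ⊎ half ≡ suc (m ℕ.+ m) → SignOf (prodLeg p f) (+ m * β)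
  prodLeg-symmetric m h = SignOf-resp (c-sym (exponent m h)) (prodLeg-sign o f)

oddPrime : ∀ {p} → Prime p → 3 < p → OddPrime p
oddPrime {p} p-prime 3<p = go (parity p) p-prime 3<p
  where
  go : ∀ {p} → Parity p → Prime p → 3 < p → OddPrime p
  go (suc-twice m) p-prime _   = odd-prime m refl p-prime
  go (twice m)     p-prime 3<p with prime⇒irreducible p-prime (ℕᵈ.divides m (regroup m))
    where
    regroup : ∀ m → m ℕ.+ m ≡ m ℕ.* 2
    regroup = ℕ-Ring.solve-∀
  ... | inj₁ ()
  ... | inj₂ 2≡p = ⊥-elim (ℕₚ.<⇒≱ 3<p (subst (ℕ._≤ 3) 2≡p (s≤s (s≤s z≤n))))

-- The symbol of 4r - 1 occurs ⌊(p - 1)/4⌋ times, a number that is odd exactly for p ≡ 5, 7 mod 8.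
-- The four odd classes modulo 8 are the parity patterns of n and ⌊n/2⌋.
prodLeg-quadratic-form : ∀ p → Prime p → 3 < p → ∀ r →
  let P = prodLeg p (λ i j → + i * + i - + i * + j + r * + j * + j)
      C = (p % 8 ≡ 5 ⊎ p % 8 ≡ 7) × legendre p (+ 4 * r - + 1) ≡ - (+ 1)
  in (C → P ≡ - (+ 1)) × (¬ C → P ≡ + 1)
prodLeg-quadratic-form p p-prime 3<p r with oddPrime p-prime 3<p
... | o@(odd-prime n refl _) = by-parity (parity n) refl
  where
  P = prodLeg p (λ i j → + i * + i - + i * + j + r * + j * + j)
  c = legendre p (+ 4 * r - + 1)
  C = (p % 8 ≡ 5 ⊎ p % 8 ≡ 7) × c ≡ - (+ 1)
  four-cases : ∀ k t → p ≡ k ℕ.+ t ℕ.* 8 → p % 8 ≡ k % 8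
  four-cases k t eq = trans (cong (_% 8) eq) ([m+kn]%n≡m%n k t 8)
  even-exponent : ∀ t k → SignOf P (+ (t ℕ.+ t) * is-1 c) → p % 8 ≡ k → k ≢ 5 → k ≢ 7 → (C → P ≡ - (+ 1)) × (¬ C → P ≡ + 1)
  even-exponent t k sign p%8 k≢5 k≢7 =
      (λ { (inj₁ e , _) → ⊥-elim (k≢5 (trans (sym p%8) e)) ; (inj₂ e , _) → ⊥-elim (k≢7 (trans (sym p%8) e)) })
    , (λ _ → SignOf-unique (SignOf-resp (cong-by (- (+ t * is-1 c)) (double (+ t) (is-1 c))) sign) (even c-refl))
    where
    double : ∀ t x → + 0 ≡ (t + t) * x + - (t * x) * + 2
    double = solve-∀
  odd-exponent : ∀ t → SignOf P (+ suc (t ℕ.+ t) * is-1 c) → p % 8 ≡ 5 ⊎ p % 8 ≡ 7 → (C → P ≡ - (+ 1)) × (¬ C → P ≡ + 1)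
  odd-exponent t sign p%8 with c ℤₚ.≟ - + 1
  ... | yes c≡-1 = (λ _ → SignOf-unique (SignOf-resp (cong-by (- + t) (single (+ t))) sign) (odd c-refl))
                 , (λ ¬C → ⊥-elim (¬C (p%8 , c≡-1)))
    where
    single : ∀ t → + 1 ≡ (+ 1 + (t + t)) * + 1 + - t * + 2
    single = solve-∀
  ... | no c≢-1 = (λ { (_ , c≡-1) → ⊥-elim (c≢-1 c≡-1) })
                , (λ _ → SignOf-unique (SignOf-resp (c-reflexive (sym (ℤₚ.*-zeroʳ (+ suc (t ℕ.+ t))))) sign) (even c-refl))
  by-parity : ∀ {n′} → Parity n′ → n ≡ n′ → (C → P ≡ - (+ 1)) × (¬ C → P ≡ + 1)
  by-parity (twice m) n≡ with parity m
  ... | twice t     = even-exponent t 1 (prodLeg-symmetric o r (t ℕ.+ t) (inj₁ n≡))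
        (four-cases 1 t (trans (cong (λ z → suc (z ℕ.+ z)) n≡) (eight t))) (λ ()) (λ ())
    where
    eight : ∀ t → suc (t ℕ.+ t ℕ.+ (t ℕ.+ t) ℕ.+ (t ℕ.+ t ℕ.+ (t ℕ.+ t))) ≡ 1 ℕ.+ t ℕ.* 8
    eight = ℕ-Ring.solve-∀
  ... | suc-twice t = odd-exponent t (prodLeg-symmetric o r (suc (t ℕ.+ t)) (inj₁ n≡))
        (inj₁ (four-cases 5 t (trans (cong (λ z → suc (z ℕ.+ z)) n≡) (eight t))))
    where
    eight : ∀ t → suc (suc (t ℕ.+ t) ℕ.+ suc (t ℕ.+ t) ℕ.+ (suc (t ℕ.+ t) ℕ.+ suc (t ℕ.+ t))) ≡ 5 ℕ.+ t ℕ.* 8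
    eight = ℕ-Ring.solve-∀
  by-parity (suc-twice m) n≡ with parity m
  ... | twice t     = even-exponent t 3 (prodLeg-symmetric o r (t ℕ.+ t) (inj₂ n≡))
        (four-cases 3 t (trans (cong (λ z → suc (z ℕ.+ z)) n≡) (eight t))) (λ ()) (λ ())
    where
    eight : ∀ t → suc (suc (t ℕ.+ t ℕ.+ (t ℕ.+ t)) ℕ.+ suc (t ℕ.+ t ℕ.+ (t ℕ.+ t))) ≡ 3 ℕ.+ t ℕ.* 8
    eight = ℕ-Ring.solve-∀
  ... | suc-twice t = odd-exponent t (prodLeg-symmetric o r (suc (t ℕ.+ t)) (inj₂ n≡))
        (inj₂ (four-cases 7 t (trans (cong (λ z → suc (z ℕ.+ z)) n≡) (eight t))))
    where
    eight : ∀ t → suc (suc (suc (t ℕ.+ t) ℕ.+ suc (t ℕ.+ t)) ℕ.+ suc (suc (t ℕ.+ t) ℕ.+ suc (t ℕ.+ t))) ≡ 7 ℕ.+ t ℕ.* 8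
    eight = ℕ-Ring.solve-∀

-- Part (ii): the parity of `N` from the symbols of -1, 2, s, s + 1, s - 1, and the periods

N-class : ℤ → ℤ → ℤ → ℤ → ℤ → ℤ
N-class ε t u v w with ε ℤₚ.≟ + 1
... | yes _ = is1 u * (is-1 w + is-1 v)
-- For ε = -1, v w = -1 says that 1 - s² is a residue. Otherwise 1/s takes the place of s, and 1 +
-- 1/s = (s + 1)/s brings in u.
... | no _ with v * w ℤₚ.≟ - + 1
... | yes _ = is1 (t * v)
... | no _  = is1 (t * (u * v))

module _ {p} (o : OddPrime p) (s : ℤ) where
  open Field o using (_≈_; _≉_)

  module _ (s≉0 : s ≉ + 0) (s+1≉0 : s + + 1 ≉ + 0) (s-1≉0 : s - + 1 ≉ + 0) where

    private
      ε t u v w : ℤ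
      ε = χ o (- + 1)
      t = χ o (+ 2)
      u = χ o s
      v = χ o (s + + 1)
      w = χ o (s - + 1)
      factor : ∀ s → s * s - + 1 ≡ (s + + 1) * (s - + 1)
      factor = solve-∀

    χ-s²-1 : χ o (s * s - + 1) ≡ v * w
    χ-s²-1 = trans (cong (χ o) (factor s)) (Field.χ-* o (s + + 1) (s - + 1))

    private
      units : ∀ {ε x} → ±1 ε → ε ≢ + 1 → ±1 x → x ≢ - + 1 → ε ≡ - + 1 × x ≡ + 1
      units +one ε≢1 _    _    = ⊥-elim (ε≢1 refl)
      units -one _   -one x≢-1 = ⊥-elim (x≢-1 refl)
      units -one _   +one _    = refl , refl
      ε-unit = Field.χ-unit o (Field.-1≉0 o)
      vw-unit : ±1 (v * w)
      vw-unit = subst ±1 χ-s²-1 (Field.χ-unit o (λ h → Field.domain-≉ o s+1≉0 s-1≉0 (c-respˡ h (sym (factor s)))))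
      flip : ∀ s → + 1 - s * s ≡ - (s * s - + 1)
      flip = solve-∀
      χ-1-s² : χ o (+ 1 - s * s) ≡ ε * (v * w)
      χ-1-s² = trans (cong (χ o) (flip s)) (trans (Field.χ-neg o (s * s - + 1)) (cong (ε *_) χ-s²-1))
      ε-minus : ε ≢ + 1 → ε ≡ - + 1
      ε-minus ε≢1 = proj₁ (units ε-unit ε≢1 +one (λ ()))
      s⁻¹ = Field.inv o s
      ss⁻¹≈1 : s * s⁻¹ ≈ + 1
      ss⁻¹≈1 = Field.inv-*ʳ o s≉0
      s⁻¹≉0 = Field.inv-≉0 o s≉0
      χ-1-s⁻² : χ o (+ 1 - s⁻¹ * s⁻¹) ≡ v * w
      χ-1-s⁻² = trans (Field.χ-cancel o (s * s) (+ 1 - s⁻¹ * s⁻¹) (s * s - + 1) (Field.χ-square o s s≉0)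
        (c-comb₁ (- (s * s⁻¹ + + 1)) (c-diff ss⁻¹≈1) (expand s s⁻¹))) χ-s²-1
        where
        expand : ∀ s i → s * s * (+ 1 - i * i) - (s * s - + 1) ≡ - (s * i + + 1) * (s * i - + 1)
        expand = solve-∀
      χ-1+s⁻¹ : χ o (+ 1 + s⁻¹) ≡ u * v
      χ-1+s⁻¹ = begin
        χ o (+ 1 + s⁻¹)               ≡⟨ ℤₚ.*-identityˡ _ ⟨
        + 1 * χ o (+ 1 + s⁻¹)         ≡⟨ cong (_* χ o (+ 1 + s⁻¹)) (unit-square (Field.χ-unit o s≉0)) ⟨
        u * u * χ o (+ 1 + s⁻¹)       ≡⟨ ℤₚ.*-assoc u u _ ⟩
        u * (u * χ o (+ 1 + s⁻¹))     ≡⟨ cong (u *_) (Field.χ-* o s (+ 1 + s⁻¹)) ⟨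
        u * χ o (s * (+ 1 + s⁻¹))     ≡⟨ cong (u *_) (Field.χ-respects o (c-comb₁ (+ 1) (c-diff ss⁻¹≈1) (expand s s⁻¹))) ⟩
        u * v                         ∎
        where
        expand : ∀ s i → s * (+ 1 + i) - (s + + 1) ≡ + 1 * (s * i - + 1)
        expand = solve-∀

    N-classified : N o (s * s) ≈₂ N-class ε t u v w
    N-classified with ε ℤₚ.≟ + 1
    ... | yes ε≡1 = Field.N-parity-1mod4 o ε≡1 s s≉0
    ... | no ε≢1 with v * w ℤₚ.≟ - + 1
    ... | yes vw≡-1 = c-respʳ (Field.N-parity-3mod4 o (ε-minus ε≢1) s s≉0 (trans χ-1-s² (cong₂ _*_ (ε-minus ε≢1) vw≡-1)))
          (cong (λ z → is1 (t * χ o z)) (ℤₚ.+-comm (+ 1) s))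
    ... | no vw≢-1 = c-respˡ (c-respʳ (Field.N-parity-3mod4 o (ε-minus ε≢1) s⁻¹ s⁻¹≉0
            (trans χ-1-s⁻² (proj₂ (units ε-unit ε≢1 vw-unit vw≢-1)))) (cong (λ z → is1 (t * z)) χ-1+s⁻¹))
          (Field.N-inverse o s s≉0)

    Fp01-N : Fp01 p (s * s) ≡ ε * (+ 8 * N o (s * s) - (+ p + + 1) + ((+ 1 - ε) * (+ 1 - ε) + + 2 * (+ 1 - v * w) + + 2 * (+ 1 - ε * (v * w))))
    Fp01-N = trans (Fp01-sum o (s * s)) (trans (Field.legendre-curve o s s≉0) (cong (ε *_)
      (trans (isolate (+ p) (Field.cubic o (s * s)) (N o (s * s))) (cong (λ z → + 8 * N o (s * s) - (+ p + + 1) + z) (trans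
        (Field.eight-N o (s * s) (Field.domain-≉ o s≉0 s≉0) s²≉1 (Field.χ-square o s s≉0))
        (cong (λ τ → (+ 1 - ε) * (+ 1 - ε) + + 2 * (+ 1 - τ) + + 2 * (+ 1 - ε * τ)) χ-s²-1))))))
      where
      s²≉1 : s * s ≉ + 1
      s²≉1 h = Field.domain-≉ o s+1≉0 s-1≉0 (c-respˡ (c-diff h) (sym (factor s)))
      isolate : ∀ p k n → k ≡ + 8 * n - (p + + 1) + (p + + 1 + k - + 8 * n)
      isolate = solve-∀

c-scale : ∀ {m a b} k → Cong m a b → Cong (k * m) (k * a) (k * b)
c-scale {m} {b = v} k (cong-by l refl) = cong-by l (expand k l m v)
  where
  expand : ∀ k l m v → k * (v + l * m) ≡ k * v + l * (k * m)
  expand = solve-∀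

-- For s = 1 or s = -1 both quantities are explicit: the curve sum is -χ(-1), and `four-N`
-- determines 4N modulo 8, hence the parity of N, from p modulo 8 and χ(-1).
residue-periodic : ∀ {p₁ p₂} (o₁ : OddPrime p₁) (o₂ : OddPrime p₂) s → s * s ≡ + 1 → Cong (+ 16) (+ p₁) (+ p₂) →
  Fp01 p₁ (s * s) ≡ Fp01 p₂ (s * s) × N o₁ (s * s) ≈₂ N o₂ (s * s)
residue-periodic {p₁} {p₂} o₁ o₂ s s²≡1 p₁≡p₂ =
    trans (curve o₁) (trans (cong -_ ε≡) (sym (curve o₂)))
  , c-respˡ (c-respʳ (c-cancel (+ 4) (+ 2) (c-respˡ (c-respʳ counts (sym (four o₂))) (four o₁))) (cong (N o₂) (sym s²≡1))) (cong (N o₁) s²≡1)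
  where
  ε≡ : χ o₁ (- + 1) ≡ χ o₂ (- + 1)
  ε≡ = χ-1-periodic o₁ o₂ (Cong-∣ (ℕᵈ.divides 4 refl) p₁≡p₂)
  curve : ∀ {p} (o : OddPrime p) → Fp01 p (s * s) ≡ - χ o (- + 1)
  curve {p} o = trans (cong (Fp01 p) s²≡1) (trans (Fp01-sum o (+ 1)) (Field.legendre-curve-degenerate o))
  isolate : ∀ p k → + 4 * k ≡ p + + 1 - (p + + 1 - + 4 * k)
  isolate = solve-∀
  four : ∀ {p} (o : OddPrime p) → + 4 * N o (+ 1) ≡ + p + + 1 - (+ 1 - χ o (- + 1) + + 2)
  four {p} o = trans (isolate (+ p) (N o (+ 1))) (cong (λ z → + p + + 1 - z) (Field.four-N o))
  counts : Cong (+ 4 * + 2) (+ p₁ + + 1 - (+ 1 - χ o₁ (- + 1) + + 2)) (+ p₂ + + 1 - (+ 1 - χ o₂ (- + 1) + + 2))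
  counts = c-- (c-+ (Cong-∣ (ℕᵈ.divides 2 refl) p₁≡p₂) (c-refl {a = + 1})) (c-reflexive (cong (λ e → + 1 - e + + 2) ε≡))

N-class-cong : ∀ {ε t u v w ε′ t′ u′ v′ w′} → ε ≡ ε′ → t ≡ t′ → u ≡ u′ → v ≡ v′ → w ≡ w′ →
  N-class ε t u v w ≡ N-class ε′ t′ u′ v′ w′
N-class-cong refl refl refl refl refl = refl

-- A multiple of 16, which serves p itself and the symbols of -1 and 2, and of the period 4|c| of
-- the symbol of c for c = s, s + 1, s - 1.
modulus : ℤ → ℕ
modulus s = 16 ℕ.* (ℤ.∣ s ∣ ℕ.* (ℤ.∣ s + + 1 ∣ ℕ.* ℤ.∣ s - + 1 ∣))

generic-periodic : ∀ {p₁ p₂} (o₁ : OddPrime p₁) (o₂ : OddPrime p₂) s → s ≢ + 0 → s + + 1 ≢ + 0 → s - + 1 ≢ + 0 →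
  ¬ p₁ ℕᵈ.∣ modulus s → ¬ p₂ ℕᵈ.∣ modulus s → Cong (+ modulus s) (+ p₁) (+ p₂) →
  Cong (+ 16) (Fp01 p₁ (s * s)) (Fp01 p₂ (s * s)) × N o₁ (s * s) ≈₂ N o₂ (s * s)
generic-periodic {p₁} {p₂} o₁ o₂ s s≢0 s+1≢0 s-1≢0 p₁∤m p₂∤m p₁≡p₂ =
    c-respˡ (c-respʳ (c-*ˡ ε₂ (c-+ (c-- (c-scale (+ 8) N≈) (c-+ (Cong-∣ 16∣m p₁≡p₂) (c-refl {a = + 1}))) c-refl)) (sym curve₂)) curve₁
  , N≈
  where
  x = ℤ.∣ s ∣
  y = ℤ.∣ s + + 1 ∣
  z = ℤ.∣ s - + 1 ∣
  16∣m : 16 ℕᵈ.∣ modulus s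
  16∣m = ℕᵈ.divides (x ℕ.* (y ℕ.* z)) (ℕₚ.*-comm 16 (x ℕ.* (y ℕ.* z)))
  x∣m : 4 ℕ.* x ℕᵈ.∣ modulus s
  x∣m = ℕᵈ.divides (4 ℕ.* (y ℕ.* z)) (regroup x y z)
    where
    regroup : ∀ x y z → 16 ℕ.* (x ℕ.* (y ℕ.* z)) ≡ 4 ℕ.* (y ℕ.* z) ℕ.* (4 ℕ.* x)
    regroup = ℕ-Ring.solve-∀
  y∣m : 4 ℕ.* y ℕᵈ.∣ modulus s
  y∣m = ℕᵈ.divides (4 ℕ.* (x ℕ.* z)) (regroup x y z)
    where
    regroup : ∀ x y z → 16 ℕ.* (x ℕ.* (y ℕ.* z)) ≡ 4 ℕ.* (x ℕ.* z) ℕ.* (4 ℕ.* y)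
    regroup = ℕ-Ring.solve-∀
  z∣m : 4 ℕ.* z ℕᵈ.∣ modulus s
  z∣m = ℕᵈ.divides (4 ℕ.* (x ℕ.* y)) (regroup x y z)
    where
    regroup : ∀ x y z → 16 ℕ.* (x ℕ.* (y ℕ.* z)) ≡ 4 ℕ.* (x ℕ.* y) ℕ.* (4 ℕ.* z)
    regroup = ℕ-Ring.solve-∀
  coprime : ∀ {p} c → 4 ℕ.* ℤ.∣ c ∣ ℕᵈ.∣ modulus s → ¬ p ℕᵈ.∣ modulus s → ¬ Cong (+ p) c (+ 0)
  coprime c c∣m p∤m c≈0 = p∤m (ℕᵈ.∣-trans (Cong-0⇒∣ c≈0) (ℕᵈ.∣-trans (ℕᵈ.n∣m*n 4) c∣m))
  periodic : ∀ c → c ≢ + 0 → 4 ℕ.* ℤ.∣ c ∣ ℕᵈ.∣ modulus s → χ o₁ c ≡ χ o₂ c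
  periodic c c≢0 c∣m = χ-periodic o₁ o₂ c c≢0 (Cong-∣ c∣m p₁≡p₂) (coprime c c∣m p₁∤m) (coprime c c∣m p₂∤m)
  ε₁ = χ o₁ (- + 1)
  ε₂ = χ o₂ (- + 1)
  ε≡ : ε₁ ≡ ε₂
  ε≡ = χ-1-periodic o₁ o₂ (Cong-∣ (ℕᵈ.∣-trans (ℕᵈ.divides 4 refl) 16∣m) p₁≡p₂)
  t≡ = periodic (+ 2) (λ ()) (ℕᵈ.∣-trans (ℕᵈ.divides 2 refl) 16∣m)
  u≡ = periodic s s≢0 x∣m
  v≡ = periodic (s + + 1) s+1≢0 y∣m
  w≡ = periodic (s - + 1) s-1≢0 z∣m
  class≡ : N-class ε₁ (χ o₁ (+ 2)) (χ o₁ s) (χ o₁ (s + + 1)) (χ o₁ (s - + 1))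
         ≡ N-class ε₂ (χ o₂ (+ 2)) (χ o₂ s) (χ o₂ (s + + 1)) (χ o₂ (s - + 1))
  class≡ = N-class-cong ε≡ t≡ u≡ v≡ w≡
  N≈ : N o₁ (s * s) ≈₂ N o₂ (s * s)
  N≈ = c-trans (c-respʳ (N-classified o₁ s (coprime s x∣m p₁∤m) (coprime (s + + 1) y∣m p₁∤m) (coprime (s - + 1) z∣m p₁∤m)) class≡)
    (c-sym (N-classified o₂ s (coprime s x∣m p₂∤m) (coprime (s + + 1) y∣m p₂∤m) (coprime (s - + 1) z∣m p₂∤m)))
  curve : ℤ → ℤ → ℤ → ℤ → ℤ
  curve e τ k p = e * (+ 8 * k - (p + + 1) + ((+ 1 - e) * (+ 1 - e) + + 2 * (+ 1 - τ) + + 2 * (+ 1 - e * τ)))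
  τ₂ = χ o₂ (s + + 1) * χ o₂ (s - + 1)
  curve₁ : Fp01 p₁ (s * s) ≡ curve ε₂ τ₂ (N o₁ (s * s)) (+ p₁)
  curve₁ = trans (Fp01-N o₁ s (coprime s x∣m p₁∤m) (coprime (s + + 1) y∣m p₁∤m) (coprime (s - + 1) z∣m p₁∤m))
    (cong₂ (λ e τ → curve e τ (N o₁ (s * s)) (+ p₁)) ε≡ (cong₂ _*_ v≡ w≡))
  curve₂ : Fp01 p₂ (s * s) ≡ curve ε₂ τ₂ (N o₂ (s * s)) (+ p₂)
  curve₂ = Fp01-N o₂ s (coprime s x∣m p₂∤m) (coprime (s + + 1) y∣m p₂∤m) (coprime (s - + 1) z∣m p₂∤m)

-- The congruence makes p₁ divide p₂. A prime dividing the period is thus the only prime in its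
-- class, where periodicity is trivial.
prime-divisor-unique : ∀ {m p₁ p₂} → Prime p₁ → Prime p₂ → 3 < p₁ → p₁ ℕᵈ.∣ m → Cong (+ m) (+ p₁) (+ p₂) → p₁ ≡ p₂
prime-divisor-unique p₁-prime p₂-prime 3<p₁ p₁∣m p₁≡p₂
  with prime⇒irreducible p₂-prime (Cong-0⇒∣ (c-trans (c-sym (Cong-∣ p₁∣m p₁≡p₂)) c-modulus))
... | inj₁ refl = ⊥-elim (ℕₚ.<⇒≱ 3<p₁ (s≤s z≤n))
... | inj₂ eq   = eq

module _ (s : ℤ) (s≢0 : ¬ s ≡ + 0) where

  private
    D : ℕ → Set
    D p = Prime p × 3 < p × ¬ ((+ p) ∣ s)

    F P : ℕ → ℤ
    F p = Fp01 p (s * s)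
    P p = prodLeg p (λ i j → s * s * + i * + i - + j * + j)

    Agree : ℕ → ℕ → Set
    Agree p₁ p₂ = F p₁ %ℕ 16 ≡ F p₂ %ℕ 16 × P p₁ ≡ P p₂

    agree : ∀ {p₁ p₂} (o₁ : OddPrime p₁) (o₂ : OddPrime p₂) →
      Cong (+ 16) (F p₁) (F p₂) × N o₁ (s * s) ≈₂ N o₂ (s * s) → Agree p₁ p₂
    agree o₁ o₂ (F≡ , N≈) = modp-unique {16} (s≤s z≤n) F≡ , SignOf-unique (SignOf-resp (c-sym N≈) (prodLeg-N o₁ (s * s))) (prodLeg-N o₂ (s * s))

    common-period : ∃ λ m → 0 < m × (∀ p₁ p₂ → D p₁ → D p₂ → Cong (+ m) (+ p₁) (+ p₂) → Agree p₁ p₂)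
    common-period with s + + 1 ℤₚ.≟ + 0 | s - + 1 ℤₚ.≟ + 0
    -- For s = -1 and s = 1 the number `modulus s` is 0 and cannot serve as a period.
    ... | yes s+1≡0 | _ = 16 , s≤s z≤n , λ { p₁ p₂ (prime₁ , 3<p₁ , _) (prime₂ , 3<p₂ , _) p₁≡p₂ →
          let o₁ = oddPrime prime₁ 3<p₁; o₂ = oddPrime prime₂ 3<p₂; (F≡ , N≈) = residue-periodic o₁ o₂ s s²≡1 p₁≡p₂
          in agree o₁ o₂ (c-reflexive F≡ , N≈) }
      where
      factor : ∀ s → s * s ≡ (s + + 1) * (s - + 1) + + 1
      factor = solve-∀
      s²≡1 : s * s ≡ + 1
      s²≡1 = trans (factor s) (cong (λ z → z * (s - + 1) + + 1) s+1≡0)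
    ... | no _ | yes s-1≡0 = 16 , s≤s z≤n , λ { p₁ p₂ (prime₁ , 3<p₁ , _) (prime₂ , 3<p₂ , _) p₁≡p₂ →
          let o₁ = oddPrime prime₁ 3<p₁; o₂ = oddPrime prime₂ 3<p₂; (F≡ , N≈) = residue-periodic o₁ o₂ s s²≡1 p₁≡p₂
          in agree o₁ o₂ (c-reflexive F≡ , N≈) }
      where
      factor : ∀ s → s * s ≡ (s - + 1) * (s + + 1) + + 1
      factor = solve-∀
      s²≡1 : s * s ≡ + 1
      s²≡1 = trans (factor s) (cong (λ z → z * (s + + 1) + + 1) s-1≡0)
    ... | no s+1≢0 | no s-1≢0 = modulus s , 0<m , period
      where
      0<m : 0 < modulus s
      0<m = ℕₚ.n≢0⇒n>0 (λ m≡0 → Sum.[ (λ ()) , Sum.[ s≢0 ∘ ℤₚ.∣i∣≡0⇒i≡0 , (λ h → Sum.[ s+1≢0 ∘ ℤₚ.∣i∣≡0⇒i≡0 , s-1≢0 ∘ ℤₚ.∣i∣≡0⇒i≡0 ]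
        (ℕₚ.m*n≡0⇒m≡0∨n≡0 ℤ.∣ s + + 1 ∣ h)) ] ∘ ℕₚ.m*n≡0⇒m≡0∨n≡0 ℤ.∣ s ∣ ] (ℕₚ.m*n≡0⇒m≡0∨n≡0 16 m≡0))
      period : ∀ p₁ p₂ → D p₁ → D p₂ → Cong (+ modulus s) (+ p₁) (+ p₂) → Agree p₁ p₂
      period p₁ p₂ (prime₁ , 3<p₁ , _) (prime₂ , 3<p₂ , _) p₁≡p₂ = compare (p₁ ℕᵈ.∣? modulus s) (p₂ ℕᵈ.∣? modulus s)
        where
        o₁ = oddPrime prime₁ 3<p₁
        o₂ = oddPrime prime₂ 3<p₂
        compare : Dec (p₁ ℕᵈ.∣ modulus s) → Dec (p₂ ℕᵈ.∣ modulus s) → Agree p₁ p₂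
        compare (yes p₁∣m) _          = subst (Agree p₁) (prime-divisor-unique prime₁ prime₂ 3<p₁ p₁∣m p₁≡p₂) (refl , refl)
        compare (no _)     (yes p₂∣m) = subst (λ p → Agree p p₂) (prime-divisor-unique prime₂ prime₁ 3<p₂ p₂∣m (c-sym p₁≡p₂)) (refl , refl)
        compare (no p₁∤m)  (no p₂∤m)  = agree o₁ o₂ (generic-periodic o₁ o₂ s s≢0 s+1≢0 s-1≢0 p₁∤m p₂∤m p₁≡p₂)

  periodicity : Periodic D (λ p → F p %ℕ 16) × Periodic D P
  periodicity = let (m , 0<m , period) = common-period in
      (m , 0<m , λ p₁ p₂ d₁ d₂ eq → proj₁ (period p₁ p₂ d₁ d₂ (modp-reflect 0<m eq)))
    , (m , 0<m , λ p₁ p₂ d₁ d₂ eq → proj₂ (period p₁ p₂ d₁ d₂ (modp-reflect 0<m eq)))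

theorem3p3 :
  (∀ (p : ℕ) → Prime p → 3 < p → (u v : ℤ) → ¬ ((+ p) ∣ u) →
    let r = ratRed p v u
        P = prodLeg p (λ i j → + i * + i - + i * + j + r * + j * + j)
        C = (p % 8 ≡ 5 ⊎ p % 8 ≡ 7) × legendre p (+ 4 * r - + 1) ≡ - (+ 1)
    in (C → P ≡ - (+ 1)) × (¬ C → P ≡ + 1))
  ×
  (∀ (s : ℤ) → ¬ (s ≡ + 0) →
    let D = λ (p : ℕ) → Prime p × 3 < p × ¬ ((+ p) ∣ s)
    in Periodic D (λ p → Fp01 p (s * s) %ℕ 16)
       × Periodic D (λ p → prodLeg p (λ i j → s * s * + i * + i - + j * + j)))
theorem3p3 = (λ p p-prime 3<p u v _ → prodLeg-quadratic-form p p-prime 3<p (ratRed p v u)) , periodicity
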